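{- Assume the injectivity hypothesis: for every $r\geq 2$ and every $N>0$, the $\mathbb{Q}$-linear map $\mathbf W_{N,r}\to\{v\in\mathsf{Vect}_{N,r}: vE_{N,r}=0\}$, $P\mapsto \pi(P)F_{N,r}$, is injective. Then $$\sum_{N>0}\dim_{\mathbb Q}\ker C_{N,3}\cdot x^N\;\geq\; 2\,\mathbb O(x)\,\mathbb S(x),$$ where $\geq$ means that for every $N>0$ the coefficient of $x^N$ on the left is at least the coefficient of $x^N$ on the right.
   Context: All vector spaces are over $\mathbb Q$. For positive integers $N,r$ let $S_{N,r}=\{(n_1,\dots,n_r)\in\mathbb Z^r: n_1+\dots+n_r=N,\ n_i\geq 3 \text{ odd}\}$, ordered lexicographically decreasingly and used as index set. $\mathsf{Vect}_{N,r}=\mathbb Q^{S_{N,r}}$ (row vectors). $\mathbf V_{N,r}$ is the span of the monomials $x_1^{n_1-1}\cdots x_r^{n_r-1}$, $(n_1,\dots,n_r)\in S_{N,r}$, and $\pi:\mathbf V_{N,r}\to\mathsf{Vect}_{N,r}$ sends a polynomial to its coefficient vector. For $r\ge2$, $\mathbf W_{N,r}=\{P\in\mathbf V_{N,r}: P(x_1,\dots,x_r)=P(x_2-x_1,x_2,x_3,\dots,x_r)-P(x_2-x_1,x_1,x_3,\dots,x_r)\}$. For $f$ a polynomial in one variable and $g$ a polynomial in $r-1$ variables, define $(f\circ g)(x_1,\dots,x_r)=f(x_1)g(x_2,\dots,x_r)+\sum_{i=1}^{r-1}\big(f(x_{i+1}-x_i)g(x_1,\dots,\widehat{x_{i+1}},\dots,x_r)-(-1)^{\deg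 f}f(x_i-x_{i+1})g(x_1,\dots,\widehat{x_i},\dots,x_r)\big)$ (hats denote omission). For integers $m_i,n_i\geq1$ let $e\binom{m_1,\dots,m_r}{n_1,\dots,n_r}$ be the coefficient of $x_1^{n_1-1}\cdots x_r^{n_r-1}$ in $x_1^{m_1-1}\circ(x_1^{m_2-1}\cdots x_{r-1}^{m_r-1})$. $E_{N,r}$ is the $S_{N,r}\times S_{N,r}$ matrix with $(m,n)$ entry $e\binom{m_1,\dots,m_r}{n_1,\dots,n_r}$; for $2\le j\le r$, $E^{(j)}_{N,r}$ has $(m,n)$ entry $\delta_{(m_1,\dots,m_{r-j}),(n_1,\dots,n_{r-j})}\,e\binom{m_{r-j+1},\dots,m_r}{n_{r-j+1},\dots,n_r}$ (Kronecker delta; $E^{(r)}_{N,r}=E_{N,r}$). $C_{N,r}=E^{(2)}_{N,r}E^{(3)}_{N,r}\cdots E^{(r-1)}_{N,r}E_{N,r}$ (so $C_{N,2}=E_{N,2}$). $F_{N,r}=E_{N,r}-\mathrm{id}$. It is known that for $P\in\mathbf W_{N,r}$ one has $\pi(P)F_{N,r}E_{N,r}=0$, so the map in the hypothesis is well defined. $\ker A$ denotes the space of right annihilators (column vectors $v$ with $Av=0$). $\mathbb O(x)=\frac{x^3}{1-x^2}$, $\mathbb S(x)=\frac{x^{12}}{(1-x^4)(1-x^6)}$. -}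

module Defs where

open import Data.Bool using (Bool; true; false; if_then_else_; _∧_)
open import Data.Nat as ℕ using (ℕ; zero; suc; _∸_; _≤_; _≤?_)
import Data.Nat.Properties as ℕₚ
open import Data.Nat.DivMod using (_%_)
open import Data.Nat.ListAction using () renaming (sum to sumℕ)
open import Data.Nat.Divisibility using (_∣?_)
open import Data.Fin using (Fin; zero; suc)
open import Data.List as List using (List; []; _∷_; _++_; map; concatMap; filter; length; lookup; upTo; downFrom; zipWith; replicate; take; drop)
import Data.List.Properties as Lₚ
open import Data.Product using (_×_; _,_; Σ; ∃)
open import Data.Rational as ℚ using (ℚ; 0ℚ; 1ℚ; _+_; _*_; -_; _-_)
open import Relation.Nullary using (does)
open import Relation.Binary.PropositionalEquality using (_≡_)

-- Index sets S_{N,r}: tuples (n₁,…,n_r) of odd integers ≥ 3 summing to N,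
-- listed in lexicographically decreasing order.

isOdd≥3 : ℕ → Bool
isOdd≥3 n = does (3 ≤? n) ∧ does (n % 2 ℕ.≟ 1)

oddsDown : ℕ → List ℕ
oddsDown N = List.filter (λ n → 3 ≤? n) (List.filter (λ n → n % 2 ℕ.≟ 1) (downFrom (suc N)))

S : ℕ → ℕ → List (List ℕ)
S zero    zero    = [] ∷ []
S (suc _) zero    = []
S N       (suc r) = concatMap (λ n₁ → map (n₁ ∷_) (S (N ∸ n₁) r)) (oddsDown N)

∣S∣ : ℕ → ℕ → ℕ
∣S∣ N r = length (S N r)

idx : ∀ N r → Fin (∣S∣ N r) → List ℕ
idx N r = lookup (S N r)

Vect : ℕ → Set
Vect k = Fin k → ℚ

Mat : ℕ → Set
Mat k = Fin k → Fin k → ℚ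

sumFin : ∀ {k} → (Fin k → ℚ) → ℚ
sumFin {zero}  f = 0ℚ
sumFin {suc k} f = f zero + sumFin (λ i → f (suc i))

_·M_ : ∀ {k} → Mat k → Mat k → Mat k
(A ·M B) i j = sumFin (λ l → A i l * B l j)

idM : ∀ {k} → Mat k
idM zero    zero    = 1ℚ
idM zero    (suc _) = 0ℚ
idM (suc _) zero    = 0ℚ
idM (suc i) (suc j) = idM i j

_-M_ : ∀ {k} → Mat k → Mat k → Mat k
(A -M B) i j = A i j - B i j

_⟨·_ : ∀ {k} → Vect k → Mat k → Vect k
(v ⟨· A) j = sumFin (λ i → v i * A i j)

_·⟩_ : ∀ {k} → Mat k → Vect k → Vect k
(A ·⟩ v) i = sumFin (λ j → A i j * v j)

-- Multivariate polynomials over ℚ as formal sums of terms c·x^a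
-- (a = exponent list, one entry per variable x₁,…,x_r ; 0-indexed here).

Term : Set
Term = ℚ × List ℕ

Poly : Set
Poly = List Term

coeff : Poly → List ℕ → ℚ
coeff []             a = 0ℚ
coeff ((c , b) ∷ p) a = if does (Lₚ.≡-dec ℕ._≟_ b a) then c + coeff p a else coeff p a

negP : Poly → Poly
negP = map (λ { (c , a) → (- c , a) })

scaleP : ℚ → Poly → Poly
scaleP d = map (λ { (c , a) → (d * c , a) })

_-P_ : Poly → Poly → Poly
p -P q = p ++ negP q

mulP : Poly → Poly → Poly
mulP p q = concatMap (λ { (c , a) → map (λ { (d , b) → (c * d , zipWith ℕ._+_ a b) }) q }) p

monoP : List ℕ → Poly
monoP a = (1ℚ , a) ∷ []

oneP : ℕ → Poly
oneP r = monoP (replicate r 0)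

unitExp : ℕ → ℕ → List ℕ
unitExp zero    _       = []
unitExp (suc r) zero    = 1 ∷ replicate r 0
unitExp (suc r) (suc i) = 0 ∷ unitExp r i

X : ℕ → ℕ → Poly
X r i = monoP (unitExp r i)

powP : ℕ → Poly → ℕ → Poly
powP r p zero    = oneP r
powP r p (suc k) = mulP p (powP r p k)

substTerm : ℕ → List Poly → Term → Poly
substTerm r Ls (c , a) = scaleP c (List.foldr mulP (oneP r) (zipWith (powP r) Ls a))

subst : ℕ → Poly → List Poly → Poly
subst r P Ls = concatMap (substTerm r Ls) P

-- V_{N,r}, π, and W_{N,r}.
-- An element of V_{N,r} is determined by its coefficient vector
-- v = π(P); polyOf gives P = π⁻¹(v).

polyOf : ∀ N r → Vect (∣S∣ N r) → Poly
polyOf N r v = map (λ i → (v i , map ℕ.pred (idx N r i))) (List.allFin (∣S∣ N r))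

InW : ℕ → Poly → Set
InW r P = ∀ a → coeff P a ≡ coeff (subst r P L₁) a - coeff (subst r P L₂) a
  where
  rest : List Poly
  rest = map (λ k → X r (2 ℕ.+ k)) (upTo (r ∸ 2))
  L₁ L₂ : List Poly
  L₁ = (X r 1 -P X r 0) ∷ X r 1 ∷ rest
  L₂ = (X r 1 -P X r 0) ∷ X r 0 ∷ rest

insertAt : ℕ → ℕ → List ℕ → List ℕ
insertAt zero    x l       = x ∷ l
insertAt (suc i) x []      = x ∷ []
insertAt (suc i) x (y ∷ l) = y ∷ insertAt i x l

sgn : ℕ → ℚ
sgn zero    = 1ℚ
sgn (suc a) = - sgn a

-- f = x^a (deg f = a), g = monomial with exponent list b in r-1 = length b variables.
-- 0-based index i = 0,…,r-2 corresponds to the paper's i+1 = 1,…,r-1.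
compo : ℕ → List ℕ → Poly
compo a b =
  monoP (a ∷ b) ++
  concatMap (λ i →
      mulP (powP r (X r (suc i) -P X r i) a) (monoP (insertAt (suc i) 0 b))
   -P scaleP (sgn a) (mulP (powP r (X r i -P X r (suc i)) a) (monoP (insertAt i 0 b))))
    (upTo (r ∸ 1))
  where
  r : ℕ
  r = suc (length b)

e : List ℕ → List ℕ → ℚ
e []        ns = 0ℚ
e (m₁ ∷ ms) ns = coeff (compo (m₁ ∸ 1) (map (_∸ 1) ms)) (map (_∸ 1) ns)

E : ∀ N r → Mat (∣S∣ N r)
E N r i j = e (idx N r i) (idx N r j)

E^ : ∀ N r → ℕ → Mat (∣S∣ N r)
E^ N r j i k =
  if does (Lₚ.≡-dec ℕ._≟_ (take (r ∸ j) m) (take (r ∸ j) n))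
  then e (drop (r ∸ j) m) (drop (r ∸ j) n) else 0ℚ
  where
  m n : List ℕ
  m = idx N r i
  n = idx N r k

F : ∀ N r → Mat (∣S∣ N r)
F N r = E N r -M idM

C₃ : ∀ N → Mat (∣S∣ N 3)
C₃ N = E^ N 3 2 ·M E N 3

InKer : ∀ {k} → Mat k → Vect k → Set
InKer A v = ∀ i → (A ·⟩ v) i ≡ 0ℚ

lincomb : ∀ {k d} → (Fin d → Vect k) → (Fin d → ℚ) → Vect k
lincomb vs λs j = sumFin (λ t → λs t * vs t j)

LinIndep : ∀ {k d} → (Fin d → Vect k) → Set
LinIndep vs = ∀ λs → (∀ j → lincomb vs λs j ≡ 0ℚ) → ∀ t → λs t ≡ 0ℚ

IsKerBasis : ∀ {k d} → Mat k → (Fin d → Vect k) → Set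
IsKerBasis A vs =
  (∀ t → InKer A (vs t)) × LinIndep vs ×
  (∀ v → InKer A v → Σ _ λ λs → ∀ j → v j ≡ lincomb vs λs j)

DimKer : ∀ {k} → Mat k → ℕ → Set
DimKer {k} A d = Σ (Fin d → Vect k) λ vs → IsKerBasis A vs

Series : Set
Series = ℕ → ℕ

_⊛_ : Series → Series → Series
(f ⊛ g) n = sumℕ (map (λ k → f k ℕ.* g (n ∸ k)) (upTo (suc n)))

xpow : ℕ → Series
xpow k n = if does (n ℕ.≟ k) then 1 else 0

-- 1/(1 - x^k) = Σ_j x^{kj}   (k > 0)
geom : ℕ → Series
geom k n = if does (k ∣? n) then 1 else 0

𝕆 : Series
𝕆 = xpow 3 ⊛ geom 2

𝕊 : Series
𝕊 = xpow 12 ⊛ (geom 4 ⊛ geom 6)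

twoOS : Series
twoOS n = 2 ℕ.* (𝕆 ⊛ 𝕊) n

InjectivityHypothesis : Set
InjectivityHypothesis =
  ∀ r N → 2 ≤ r → 1 ≤ N →
  ∀ (v w : Vect (∣S∣ N r)) →
  InW r (polyOf N r v) → InW r (polyOf N r w) →
  (∀ j → (v ⟨· F N r) j ≡ (w ⟨· F N r) j) →
  ∀ i → v i ≡ w i

{-# OPTIONS --safe #-}
-- Left multiplication by E^(2) and by E acts on polynomials through ∘, with the first variable passive for E^(2).
-- Let U = π(W_{N,3}), and let U′ consist of the vectors whose polynomial satisfies the period relation in its last
-- two variables; rotating the variables identifies U′ with U.  For v ∈ U one has v E^(2) = - v F by antisymmetry of
-- the polynomial, so the hypothesis makes v ↦ v E^(2) injective on U, and the fifteen terms of v E^(2) E cancel.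
-- For v ∈ U′ already v E^(2) = 0.  Hence U ⊕ U′ lies in the left kernel of C = E^(2) E, which has the dimension of
-- the right kernel.
--
-- It remains to bound dim U′ from below.  In degree D = 2m an antisymmetric even P(y,z) satisfies the period
-- relation iff R(y,z) = P(y,z) + P(z-y,y) - P(z-y,z) vanishes.  R changes sign under (y,z) ↦ (z,y) and
-- (y,z) ↦ (z-y,z), so each root y of R(y,1) comes with its orbit under y ↦ 1-y, 1/y, and vanishing at ⌊m/3⌋
-- points already forces R = 0.  This leaves m - 1 - ⌊m/2⌋ - ⌊m/3⌋ ≥ dim S_{2m+2} dimensions.

module Submission where

open import Data.Bool using (Bool; true; false; if_then_else_)
import Data.Fin as Fin
open import Data.Fin using (Fin; zero; suc; punchIn; punchOut; _↑ˡ_; _↑ʳ_; splitAt; fromℕ<)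
import Data.Fin.Properties as Finₚ
import Data.List as List
open import Data.List using (List; []; _∷_; _++_; map; concatMap; filter; length; lookup; upTo; downFrom; zipWith; replicate; take; drop; applyUpTo)
open import Data.List.Membership.Propositional using (_∈_; find; lose)
import Data.List.Membership.Propositional.Properties as ∈ₚ
import Data.List.Properties as Lₚ
open import Data.List.Relation.Binary.Permutation.Propositional using (_↭_; ↭-sym)
import Data.List.Relation.Binary.Permutation.Propositional.Properties as ↭ₚ
open import Data.List.Relation.Unary.All as All using (All; []; _∷_)
import Data.List.Relation.Unary.All.Properties as Allₚ
open import Data.List.Relation.Unary.AllPairs as AllPairs using ([]; _∷_)
import Data.List.Relation.Unary.AllPairs.Properties as APₚ
open import Data.List.Relation.Unary.Any as Any using (here)
import Data.List.Relation.Unary.Any.Properties as Anyₚ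
open import Data.List.Relation.Unary.Unique.Propositional using (Unique)
import Data.List.Relation.Unary.Unique.Propositional.Properties as Uniqueₚ
open import Data.Nat as ℕ using (ℕ; zero; suc; _∸_; _≤_; _<_; z≤n; s≤s; _≤?_)
import Data.Nat.DivMod as DM
open import Data.Nat.Divisibility using (divides; _∣?_)
open import Data.Nat.ListAction using () renaming (sum to sumℕ)
import Data.Nat.ListAction.Properties as ListActionₚ
import Data.Nat.Properties as ℕₚ
import Data.Nat.Tactic.RingSolver as ℕ-solver
open import Data.Product using (_×_; _,_; Σ; ∃; proj₁; proj₂)
open import Data.Rational as ℚ using (ℚ; 0ℚ; 1ℚ; _+_; _*_; -_; _-_)
import Data.Rational.Properties as ℚₚ
open import Data.Sum as Sum using (_⊎_; inj₁; inj₂; [_,_]′)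
import Data.Vec.Functional as VF
import Data.Vec.Functional.Properties as VFₚ
open import Defs
open import Function using (_∘_; id)
open import Level using (0ℓ)
open import Relation.Binary.Definitions using (tri<; tri≈; tri>)
open import Relation.Binary.PropositionalEquality as ≡ using (_≡_; _≢_; refl; sym; trans; cong; cong₂; module ≡-Reasoning)
open import Relation.Nullary using (¬_; Dec; yes; no; does; contradiction)
import Relation.Nullary.Decidable as Dec
open import Tactic.RingSolver using (solve-∀)
open import Tactic.RingSolver.Core.AlmostCommutativeRing using (AlmostCommutativeRing; fromCommutativeRing)

-- Linear algebra over ℚ

-- The sum U ⊕ U′ is direct because E^(2) is injective on U and zero on U′. The obstacle is that C
-- is a product of matrices on the index set, whereas the cancellation of the fifteen terms is an
-- identity of polynomials. As a polynomial, v E^(2) also has monomials with odd or zero exponents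
-- in the last two variables, and its coefficient vector forgets them before E is applied. This does
-- no harm: ∘ turns each of them into a polynomial without any coefficient in the index set. The
-- points 3, 4, ... have six distinct images each under y ↦ 1-y, 1/y. The two short orbits of
-- rational points, 0, 1, ∞ and -1, 1/2, 2, contain fixed points at which the sign change alone
-- forces a zero, so they supply five finite roots free of charge. Hence q conditions give 6q+5
-- roots, enough for an even degree D ≤ 6q+4. Only this lower bound enters; the space of period
-- polynomials is never computed. A dimension has to be exhibited as a basis, so rank arguments take
-- the form of elimination steps that carry a basis along.

ℚ-ring : AlmostCommutativeRing 0ℓ 0ℓ
ℚ-ring = fromCommutativeRing ℚₚ.+-*-commutativeRing (λ x → Dec.dec⇒maybe (0ℚ ℚₚ.≟ x))

inverse : ∀ {c} → c ≢ 0ℚ → ∃ λ c′ → c * c′ ≡ 1ℚ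
inverse {c} c≢0 = ℚ.1/ c , ℚₚ.*-inverseʳ c
  where instance
    nz : ℚ.NonZero c
    nz = ℚ.≢-nonZero c≢0

*-cancelˡ-0 : ∀ {c x} → c ≢ 0ℚ → c * x ≡ 0ℚ → x ≡ 0ℚ
*-cancelˡ-0 {c} {x} c≢0 cx≡0 with inverse c≢0
... | c′ , cc′ = begin
  x              ≡⟨ sym (ℚₚ.*-identityˡ x) ⟩
  1ℚ * x         ≡⟨ cong (_* x) (sym cc′) ⟩
  c * c′ * x     ≡⟨ shuffle c c′ x ⟩
  c′ * (c * x)   ≡⟨ cong (c′ *_) cx≡0 ⟩
  c′ * 0ℚ        ≡⟨ ℚₚ.*-zeroʳ c′ ⟩
  0ℚ             ∎
  where
  open ≡-Reasoning
  shuffle : ∀ c c′ x → c * c′ * x ≡ c′ * (c * x)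
  shuffle = solve-∀ ℚ-ring

a-b≡0⇒a≡b : ∀ {a b} → a - b ≡ 0ℚ → a ≡ b
a-b≡0⇒a≡b {a} {b} eq = begin
  a             ≡⟨ lemma a b ⟩
  (a - b) + b   ≡⟨ cong (_+ b) eq ⟩
  0ℚ + b        ≡⟨ ℚₚ.+-identityˡ b ⟩
  b             ∎
  where
  open ≡-Reasoning
  lemma : ∀ a b → a ≡ (a - b) + b
  lemma = solve-∀ ℚ-ring

a≡b⇒a-b≡0 : ∀ {a b} → a ≡ b → a - b ≡ 0ℚ
a≡b⇒a-b≡0 {a} refl = ℚₚ.+-inverseʳ a

dot : ∀ {k} → Vect k → Vect k → ℚ
dot φ v = sumFin (λ j → φ j * v j)

sum-cong : ∀ {k} {f g : Vect k} → (∀ i → f i ≡ g i) → sumFin f ≡ sumFin g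
sum-cong {zero}  f≗g = refl
sum-cong {suc k} f≗g = cong₂ _+_ (f≗g zero) (sum-cong (f≗g ∘ suc))

sum-+ : ∀ {k} (f g : Vect k) → sumFin (λ i → f i + g i) ≡ sumFin f + sumFin g
sum-+ {zero}  f g = refl
sum-+ {suc k} f g =
  trans (cong (f zero + g zero +_) (sum-+ (f ∘ suc) (g ∘ suc)))
        (interchange (f zero) (g zero) _ _)
  where
  interchange : ∀ a b c d → a + b + (c + d) ≡ a + c + (b + d)
  interchange = solve-∀ ℚ-ring

sum-*ˡ : ∀ {k} c (f : Vect k) → sumFin (λ i → c * f i) ≡ c * sumFin f
sum-*ˡ {zero}  c f = sym (ℚₚ.*-zeroʳ c)
sum-*ˡ {suc k} c f =
  trans (cong (c * f zero +_) (sum-*ˡ c (f ∘ suc))) (sym (ℚₚ.*-distribˡ-+ c _ _))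

sum-*ʳ : ∀ {k} c (f : Vect k) → sumFin (λ i → f i * c) ≡ sumFin f * c
sum-*ʳ c f = trans (sum-cong (λ i → ℚₚ.*-comm (f i) c)) (trans (sum-*ˡ c f) (ℚₚ.*-comm c _))

sum-0 : ∀ k → sumFin {k} (λ _ → 0ℚ) ≡ 0ℚ
sum-0 zero    = refl
sum-0 (suc k) = trans (ℚₚ.+-identityˡ _) (sum-0 k)

sum-zero : ∀ {k} {f : Vect k} → (∀ i → f i ≡ 0ℚ) → sumFin f ≡ 0ℚ
sum-zero {k} f≗0 = trans (sum-cong f≗0) (sum-0 k)

sum-swap : ∀ {k l} (f : Fin k → Fin l → ℚ) →
  sumFin (λ i → sumFin (f i)) ≡ sumFin (λ j → sumFin (λ i → f i j))
sum-swap {zero}  {l} f = sym (sum-0 l)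
sum-swap {suc k} {l} f =
  trans (cong (sumFin (f zero) +_) (sum-swap (f ∘ suc)))
        (sym (sum-+ (f zero) (λ j → sumFin (λ i → f (suc i) j))))

sum-remove : ∀ {k} (t : Fin (suc k)) (f : Vect (suc k)) → sumFin f ≡ f t + sumFin (f ∘ punchIn t)
sum-remove         zero    f = refl
sum-remove {suc k} (suc t) f =
  trans (cong (f zero +_) (sum-remove t (f ∘ suc))) (exchange (f zero) (f (suc t)) _)
  where
  exchange : ∀ a b c → a + (b + c) ≡ b + (a + c)
  exchange = solve-∀ ℚ-ring

sum-idM : ∀ {k} (f : Vect k) j → sumFin (λ i → f i * idM i j) ≡ f j
sum-idM {suc k} f zero =
  trans (cong₂ _+_ (ℚₚ.*-identityʳ (f zero)) (sum-zero (λ i → ℚₚ.*-zeroʳ (f (suc i)))))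
        (ℚₚ.+-identityʳ _)
sum-idM {suc k} f (suc j) =
  trans (cong₂ _+_ (ℚₚ.*-zeroʳ (f zero)) (sum-idM (f ∘ suc) j)) (ℚₚ.+-identityˡ _)

dot-lincomb : ∀ {k d} (φ : Vect k) (vs : Fin d → Vect k) (λs : Vect d) →
  dot φ (lincomb vs λs) ≡ sumFin (λ t → λs t * dot φ (vs t))
dot-lincomb φ vs λs = begin
  sumFin (λ j → φ j * sumFin (λ t → λs t * vs t j))
    ≡⟨ sum-cong (λ j → sym (sum-*ˡ (φ j) (λ t → λs t * vs t j))) ⟩
  sumFin (λ j → sumFin (λ t → φ j * (λs t * vs t j)))
    ≡⟨ sum-swap (λ j t → φ j * (λs t * vs t j)) ⟩
  sumFin (λ t → sumFin (λ j → φ j * (λs t * vs t j)))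
    ≡⟨ sum-cong (λ t → trans (sum-cong (λ j → exchange (φ j) (λs t) (vs t j))) (sum-*ˡ (λs t) (λ j → φ j * vs t j))) ⟩
  sumFin (λ t → λs t * dot φ (vs t)) ∎
  where
  open ≡-Reasoning
  exchange : ∀ a b c → a * (b * c) ≡ b * (a * c)
  exchange = solve-∀ ℚ-ring

-- Gaussian elimination

pivot : ∀ {k} (f : Vect k) → (∀ t → f t ≡ 0ℚ) ⊎ ∃ λ t → f t ≢ 0ℚ
pivot {zero}  f = inj₁ (λ ())
pivot {suc k} f with f zero ℚₚ.≟ 0ℚ | pivot (f ∘ suc)
... | no f0≢0 | _                = inj₂ (zero , f0≢0)
... | yes _   | inj₂ (t , ft≢0)  = inj₂ (suc t , ft≢0)
... | yes f0  | inj₁ f≗0         = inj₁ (λ { zero → f0 ; (suc t) → f≗0 t })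

-- For the predicate `λ v → ∀ i → dot (A i) v ≡ 0ℚ` this unfolds to `DimKer A d`, so the kernel
-- basis built below serves in the theorem as it stands.
Basis : ∀ {k} → (Vect k → Set) → ℕ → Set
Basis {k} P d = Σ (Fin d → Vect k) λ vs →
  (∀ t → P (vs t)) × LinIndep vs × (∀ v → P v → Σ (Vect d) λ λs → ∀ j → v j ≡ lincomb vs λs j)

Basis-⇔ : ∀ {k d} {P Q : Vect k → Set} →
  (∀ {v} → P v → Q v) → (∀ {v} → Q v → P v) → Basis P d → Basis Q d
Basis-⇔ f g (vs , mem , ind , spans) = vs , f ∘ mem , ind , λ v → spans v ∘ g

Annihilated : ∀ {k} → List (Vect k) → Vect k → Set
Annihilated φs v = All (λ φ → dot φ v ≡ 0ℚ) φs

-- One elimination step: `vs t₀`, on which `φ` does not vanish, corrects the other vectors until `φ`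
-- kills them, and is then given up. `P` stands for the conditions imposed so far.
module Eliminate {k d} (P : Vect k → Set) (φ : Vect k) (vs : Fin (suc d) → Vect k)
  (ind : LinIndep vs) (spans : ∀ v → P v → Σ (Vect (suc d)) λ λs → ∀ j → v j ≡ lincomb vs λs j)
  (t₀ : Fin (suc d)) (φ≢0 : dot φ (vs t₀) ≢ 0ℚ) where

  c⁻¹ : ℚ
  c⁻¹ = proj₁ (inverse φ≢0)

  cc⁻¹ : dot φ (vs t₀) * c⁻¹ ≡ 1ℚ
  cc⁻¹ = proj₂ (inverse φ≢0)

  rest : Fin d → Vect k
  rest = vs ∘ punchIn t₀

  ws : Fin d → Vect k
  ws t j = rest t j - dot φ (rest t) * c⁻¹ * vs t₀ j

  φ-sum : Vect d → ℚ
  φ-sum μ = sumFin (λ t → μ t * dot φ (rest t))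

  dot-ws : ∀ t → dot φ (ws t) ≡ 0ℚ
  dot-ws t = begin
    sumFin (λ j → φ j * (rest t j - a * vs t₀ j))
      ≡⟨ sum-cong (λ j → expand (φ j) (rest t j) a (vs t₀ j)) ⟩
    sumFin (λ j → φ j * rest t j + (- a) * (φ j * vs t₀ j))
      ≡⟨ sum-+ _ (λ j → (- a) * (φ j * vs t₀ j)) ⟩
    dot φ (rest t) + sumFin (λ j → (- a) * (φ j * vs t₀ j))
      ≡⟨ cong (dot φ (rest t) +_) (sum-*ˡ (- a) (λ j → φ j * vs t₀ j)) ⟩
    dot φ (rest t) + (- a) * dot φ (vs t₀)
      ≡⟨ regroup (dot φ (rest t)) c⁻¹ (dot φ (vs t₀)) ⟩
    dot φ (rest t) - dot φ (rest t) * (dot φ (vs t₀) * c⁻¹)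
      ≡⟨ cong (λ z → dot φ (rest t) - dot φ (rest t) * z) cc⁻¹ ⟩
    dot φ (rest t) - dot φ (rest t) * 1ℚ
      ≡⟨ vanish (dot φ (rest t)) ⟩
    0ℚ ∎
    where
    open ≡-Reasoning
    a : ℚ
    a = dot φ (rest t) * c⁻¹
    expand : ∀ p r a v → p * (r - a * v) ≡ p * r + (- a) * (p * v)
    expand = solve-∀ ℚ-ring
    regroup : ∀ r i c → r + (- (r * i)) * c ≡ r - r * (c * i)
    regroup = solve-∀ ℚ-ring
    vanish : ∀ r → r - r * 1ℚ ≡ 0ℚ
    vanish = solve-∀ ℚ-ring

  lincomb-ws : ∀ μ j → lincomb ws μ j ≡ lincomb rest μ j - φ-sum μ * c⁻¹ * vs t₀ j
  lincomb-ws μ j = begin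
    sumFin (λ t → μ t * (rest t j - dot φ (rest t) * c⁻¹ * vs t₀ j))
      ≡⟨ sum-cong (λ t → expand (μ t) (rest t j) (dot φ (rest t)) c⁻¹ (vs t₀ j)) ⟩
    sumFin (λ t → μ t * rest t j + (- (c⁻¹ * vs t₀ j)) * (μ t * dot φ (rest t)))
      ≡⟨ sum-+ _ (λ t → (- (c⁻¹ * vs t₀ j)) * (μ t * dot φ (rest t))) ⟩
    lincomb rest μ j + sumFin (λ t → (- (c⁻¹ * vs t₀ j)) * (μ t * dot φ (rest t)))
      ≡⟨ cong (lincomb rest μ j +_) (sum-*ˡ (- (c⁻¹ * vs t₀ j)) (λ t → μ t * dot φ (rest t))) ⟩
    lincomb rest μ j + (- (c⁻¹ * vs t₀ j)) * φ-sum μ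
      ≡⟨ regroup (lincomb rest μ j) c⁻¹ (vs t₀ j) (φ-sum μ) ⟩
    lincomb rest μ j - φ-sum μ * c⁻¹ * vs t₀ j ∎
    where
    open ≡-Reasoning
    expand : ∀ m r p i v → m * (r - p * i * v) ≡ m * r + (- (i * v)) * (m * p)
    expand = solve-∀ ℚ-ring
    regroup : ∀ l i v s → l + (- (i * v)) * s ≡ l - s * i * v
    regroup = solve-∀ ℚ-ring

  -- A relation among the corrected vectors is one among `vs` in which the coefficient of `vs t₀`
  -- collects all the subtracted multiples.
  ws-indep : LinIndep ws
  ws-indep μ μws≡0 t = trans (sym (VFₚ.insertAt-punchIn μ t₀ a t)) (ind λs zeros (punchIn t₀ t))
    where
    open ≡-Reasoning
    a : ℚ
    a = - (φ-sum μ * c⁻¹)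
    λs : Vect (suc d)
    λs = VF.insertAt μ t₀ a
    neg-* : ∀ a b l → (- a) * b + l ≡ l - a * b
    neg-* = solve-∀ ℚ-ring
    zeros : ∀ j → lincomb vs λs j ≡ 0ℚ
    zeros j = begin
      sumFin (λ s → λs s * vs s j)
        ≡⟨ sum-remove t₀ (λ s → λs s * vs s j) ⟩
      λs t₀ * vs t₀ j + sumFin (λ s → λs (punchIn t₀ s) * rest s j)
        ≡⟨ cong₂ _+_ (cong (_* vs t₀ j) (VFₚ.insertAt-lookup μ t₀ a))
                     (sum-cong (λ s → cong (_* rest s j) (VFₚ.insertAt-punchIn μ t₀ a s))) ⟩
      a * vs t₀ j + lincomb rest μ j
        ≡⟨ neg-* (φ-sum μ * c⁻¹) (vs t₀ j) _ ⟩
      lincomb rest μ j - φ-sum μ * c⁻¹ * vs t₀ j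
        ≡⟨ sym (lincomb-ws μ j) ⟩
      lincomb ws μ j
        ≡⟨ μws≡0 j ⟩
      0ℚ ∎

  ws-spans : ∀ v → P v → dot φ v ≡ 0ℚ → Σ (Vect d) λ μ → ∀ j → v j ≡ lincomb ws μ j
  ws-spans v Pv φv≡0 with spans v Pv
  ... | λs , v≡ = μ , λ j → begin
    v j                                                 ≡⟨ v≡ j ⟩
    lincomb vs λs j                                     ≡⟨ sum-remove t₀ (λ s → λs s * vs s j) ⟩
    λs t₀ * vs t₀ j + lincomb rest μ j                  ≡⟨ cong (λ z → z * vs t₀ j + lincomb rest μ j) coefficient ⟩
    (- (φ-sum μ * c⁻¹)) * vs t₀ j + lincomb rest μ j    ≡⟨ neg-* (φ-sum μ * c⁻¹) (vs t₀ j) _ ⟩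
    lincomb rest μ j - φ-sum μ * c⁻¹ * vs t₀ j          ≡⟨ sym (lincomb-ws μ j) ⟩
    lincomb ws μ j                                      ∎
    where
    open ≡-Reasoning
    μ : Vect d
    μ = λs ∘ punchIn t₀
    c : ℚ
    c = dot φ (vs t₀)
    neg-* : ∀ a b l → (- a) * b + l ≡ l - a * b
    neg-* = solve-∀ ℚ-ring
    total : λs t₀ * c + φ-sum μ ≡ 0ℚ
    total = begin
      λs t₀ * c + φ-sum μ                        ≡⟨ sym (sum-remove t₀ (λ t → λs t * dot φ (vs t))) ⟩
      sumFin (λ t → λs t * dot φ (vs t))         ≡⟨ sym (dot-lincomb φ vs λs) ⟩
      dot φ (lincomb vs λs)                      ≡⟨ sum-cong (λ j → cong (φ j *_) (sym (v≡ j))) ⟩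
      dot φ v                                    ≡⟨ φv≡0 ⟩
      0ℚ                                         ∎
    expand : ∀ l c s i → l * (c * i) ≡ (l * c + s) * i + (- (s * i))
    expand = solve-∀ ℚ-ring
    0*i : ∀ i x → 0ℚ * i + x ≡ x
    0*i = solve-∀ ℚ-ring
    -- Applying `φ` to the expansion of `v` gives `total`, which determines the pivot coefficient
    -- from the others: it is the one that `lincomb ws μ` produces.
    coefficient : λs t₀ ≡ - (φ-sum μ * c⁻¹)
    coefficient = begin
      λs t₀                                            ≡⟨ sym (ℚₚ.*-identityʳ _) ⟩
      λs t₀ * 1ℚ                                       ≡⟨ cong (λs t₀ *_) (sym cc⁻¹) ⟩
      λs t₀ * (c * c⁻¹)                                ≡⟨ expand (λs t₀) c (φ-sum μ) c⁻¹ ⟩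
      (λs t₀ * c + φ-sum μ) * c⁻¹ + (- (φ-sum μ * c⁻¹)) ≡⟨ cong (λ z → z * c⁻¹ + (- (φ-sum μ * c⁻¹))) total ⟩
      0ℚ * c⁻¹ + (- (φ-sum μ * c⁻¹))                   ≡⟨ 0*i c⁻¹ _ ⟩
      - (φ-sum μ * c⁻¹)                                ∎

dot-annihilates-lincomb : ∀ {k d} (φ : Vect k) (vs : Fin d → Vect k) (λs : Vect d) →
  (∀ t → dot φ (vs t) ≡ 0ℚ) → dot φ (lincomb vs λs) ≡ 0ℚ
dot-annihilates-lincomb φ vs λs φvs≡0 =
  trans (dot-lincomb φ vs λs)
        (sum-zero (λ t → trans (cong (λs t *_) (φvs≡0 t)) (ℚₚ.*-zeroʳ (λs t))))

-- Each functional costs at most one dimension: either it vanishes on the current basis, or one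
-- basis vector is sacrificed as pivot.
annihilator-basis : ∀ {n} (φs : List (Vect n)) →
  Σ ℕ λ d → Basis (Annihilated φs) d × n ≤ d ℕ.+ length φs
annihilator-basis {n} [] = n , (idM , (λ _ → []) , independent , spans) , ℕₚ.m≤m+n n 0
  where
  independent : LinIndep idM
  independent λs eq t = trans (sym (sum-idM λs t)) (eq t)
  spans : ∀ v → Annihilated [] v → Σ (Vect n) λ λs → ∀ j → v j ≡ lincomb idM λs j
  spans v _ = v , λ j → sym (sum-idM v j)
annihilator-basis {n} (φ ∷ φs) with annihilator-basis φs
... | d , (vs , mem , ind , spans) , n≤d+m with pivot (λ t → dot φ (vs t))
...   | inj₁ φvs≡0 =
        d , (vs , (λ t → φvs≡0 t ∷ mem t) , ind , (λ { v (_ ∷ ann) → spans v ann })) ,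
        ℕₚ.≤-trans n≤d+m (ℕₚ.+-monoʳ-≤ d (ℕₚ.n≤1+n _))
annihilator-basis {n} (φ ∷ φs) | suc d , (vs , mem , ind , spans) , n≤d+m | inj₂ (t₀ , φ≢0) =
  d , (ws , ws-mem , ws-indep , (λ { v (φv≡0 ∷ ann) → ws-spans v ann φv≡0 })) ,
  ≡.subst (n ≤_) (sym (ℕₚ.+-suc d (length φs))) n≤d+m
  where
  open Eliminate (Annihilated φs) φ vs ind spans t₀ φ≢0
  annihilated-ws : ∀ {ψ} t → (∀ s → dot ψ (vs s) ≡ 0ℚ) → dot ψ (ws t) ≡ 0ℚ
  annihilated-ws {ψ} t ψvs≡0 = begin
    sumFin (λ j → ψ j * (rest t j - a * vs t₀ j))
      ≡⟨ sum-cong (λ j → expand (ψ j) (rest t j) a (vs t₀ j)) ⟩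
    sumFin (λ j → ψ j * rest t j + (- a) * (ψ j * vs t₀ j))
      ≡⟨ sum-+ _ (λ j → (- a) * (ψ j * vs t₀ j)) ⟩
    dot ψ (rest t) + sumFin (λ j → (- a) * (ψ j * vs t₀ j))
      ≡⟨ cong₂ _+_ (ψvs≡0 (punchIn t₀ t)) (trans (sum-*ˡ (- a) (λ j → ψ j * vs t₀ j)) (cong ((- a) *_) (ψvs≡0 t₀))) ⟩
    0ℚ + (- a) * 0ℚ
      ≡⟨ vanish (- a) ⟩
    0ℚ ∎
    where
    open ≡-Reasoning
    a : ℚ
    a = dot φ (rest t) * c⁻¹
    expand : ∀ p r a v → p * (r - a * v) ≡ p * r + (- a) * (p * v)
    expand = solve-∀ ℚ-ring
    vanish : ∀ a → 0ℚ + a * 0ℚ ≡ 0ℚ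
    vanish = solve-∀ ℚ-ring
  ws-mem : ∀ t → Annihilated (φ ∷ φs) (ws t)
  ws-mem t = dot-ws t ∷ All.tabulate (λ {ψ} ψ∈ → annihilated-ws {ψ} t (λ s → All.lookup (mem s) ψ∈))

-- Left kernel against right kernel

module DropRow {m n k} (A : Fin (suc m) → Vect n) (u : Fin (suc k) → Vect (suc m)) (ind : LinIndep u)
  (uA≡0 : ∀ t j → sumFin (λ i → u t i * A i j) ≡ 0ℚ)
  (i₀ : Fin (suc m)) (u₀≢0 : u zero i₀ ≢ 0ℚ) where

  c⁻¹ : ℚ
  c⁻¹ = proj₁ (inverse u₀≢0)
  r : Fin k → ℚ
  r t = u (suc t) i₀ * c⁻¹
  w : Fin k → Vect (suc m)
  w t i = u (suc t) i - r t * u zero i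
  w-pivot : ∀ t → w t i₀ ≡ 0ℚ
  w-pivot t = begin
    a - a * c⁻¹ * u zero i₀      ≡⟨ regroup a c⁻¹ (u zero i₀) ⟩
    a - a * (u zero i₀ * c⁻¹)    ≡⟨ cong (λ z → a - a * z) (proj₂ (inverse u₀≢0)) ⟩
    a - a * 1ℚ                   ≡⟨ vanish a ⟩
    0ℚ                           ∎
    where
    open ≡-Reasoning
    a : ℚ
    a = u (suc t) i₀
    regroup : ∀ a i c → a - a * i * c ≡ a - a * (c * i)
    regroup = solve-∀ ℚ-ring
    vanish : ∀ r → r - r * 1ℚ ≡ 0ℚ
    vanish = solve-∀ ℚ-ring
  u′ : Fin k → Vect m
  u′ t = w t ∘ punchIn i₀
  wA≡0 : ∀ t j → sumFin (λ i → w t i * A i j) ≡ 0ℚ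
  wA≡0 t j = begin
    sumFin (λ i → (u (suc t) i - r t * u zero i) * A i j)
      ≡⟨ sum-cong (λ i → expand (u (suc t) i) (r t) (u zero i) (A i j)) ⟩
    sumFin (λ i → u (suc t) i * A i j + (- r t) * (u zero i * A i j))
      ≡⟨ sum-+ (λ i → u (suc t) i * A i j) (λ i → (- r t) * (u zero i * A i j)) ⟩
    sumFin (λ i → u (suc t) i * A i j) + sumFin (λ i → (- r t) * (u zero i * A i j))
      ≡⟨ cong₂ _+_ (uA≡0 (suc t) j) (trans (sum-*ˡ (- r t) (λ i → u zero i * A i j)) (cong ((- r t) *_) (uA≡0 zero j))) ⟩
    0ℚ + (- r t) * 0ℚ
      ≡⟨ vanish (- r t) ⟩
    0ℚ ∎
    where
    open ≡-Reasoning
    expand : ∀ a r b c → (a - r * b) * c ≡ a * c + (- r) * (b * c)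
    expand = solve-∀ ℚ-ring
    vanish : ∀ a → 0ℚ + a * 0ℚ ≡ 0ℚ
    vanish = solve-∀ ℚ-ring
  u′A≡0 : ∀ t j → sumFin (λ i → u′ t i * A (punchIn i₀ i) j) ≡ 0ℚ
  u′A≡0 t j = begin
    sumFin (λ i → u′ t i * A (punchIn i₀ i) j)
      ≡⟨ sym (0*x+y (A i₀ j) _) ⟩
    0ℚ * A i₀ j + sumFin (λ i → u′ t i * A (punchIn i₀ i) j)
      ≡⟨ cong (λ z → z * A i₀ j + sumFin (λ i → u′ t i * A (punchIn i₀ i) j)) (sym (w-pivot t)) ⟩
    w t i₀ * A i₀ j + sumFin (λ i → u′ t i * A (punchIn i₀ i) j)
      ≡⟨ sym (sum-remove i₀ (λ i → w t i * A i j)) ⟩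
    sumFin (λ i → w t i * A i j)
      ≡⟨ wA≡0 t j ⟩
    0ℚ ∎
    where
    open ≡-Reasoning
    0*x+y : ∀ x y → 0ℚ * x + y ≡ y
    0*x+y = solve-∀ ℚ-ring
  -- A relation among the shortened vectors is, on the rows kept, one among the `w t`. On row `i₀`
  -- these vanish anyway, so it lifts to a relation among all of `u`, with coefficient `- s` at
  -- `u zero`.
  u′-indep : LinIndep u′
  u′-indep μ μu′≡0 t = ind λs λu≡0 (suc t)
    where
    open ≡-Reasoning
    s : ℚ
    s = sumFin (λ t → μ t * r t)
    λs : Vect (suc k)
    λs zero    = - s
    λs (suc t) = μ t
    expand : ∀ m a r b → m * (a - r * b) ≡ m * a + (- b) * (m * r)
    expand = solve-∀ ℚ-ring
    regroup : ∀ l b s → l + (- b) * s ≡ (- s) * b + l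
    regroup = solve-∀ ℚ-ring
    λu≡μw : ∀ i → lincomb u λs i ≡ sumFin (λ t → μ t * w t i)
    λu≡μw i = sym (begin
      sumFin (λ t → μ t * (u (suc t) i - r t * u zero i))
        ≡⟨ sum-cong (λ t → expand (μ t) (u (suc t) i) (r t) (u zero i)) ⟩
      sumFin (λ t → μ t * u (suc t) i + (- u zero i) * (μ t * r t))
        ≡⟨ sum-+ _ (λ t → (- u zero i) * (μ t * r t)) ⟩
      lincomb (u ∘ suc) μ i + sumFin (λ t → (- u zero i) * (μ t * r t))
        ≡⟨ cong (lincomb (u ∘ suc) μ i +_) (sum-*ˡ (- u zero i) (λ t → μ t * r t)) ⟩
      lincomb (u ∘ suc) μ i + (- u zero i) * s
        ≡⟨ regroup (lincomb (u ∘ suc) μ i) (u zero i) s ⟩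
      (- s) * u zero i + lincomb (u ∘ suc) μ i ∎)
    λu≡0 : ∀ i → lincomb u λs i ≡ 0ℚ
    λu≡0 i with i Finₚ.≟ i₀
    ... | yes refl = trans (λu≡μw i) (sum-zero (λ t → trans (cong (μ t *_) (w-pivot t)) (ℚₚ.*-zeroʳ (μ t))))
    ... | no i≢i₀ = ≡.subst (λ i → lincomb u λs i ≡ 0ℚ) (Finₚ.punchIn-punchOut (i≢i₀ ∘ sym))
                      (trans (λu≡μw _) (μu′≡0 (punchOut (i≢i₀ ∘ sym))))
  u₀-relation : ∀ v → sumFin (λ i → u zero i * dot (A i) v) ≡ 0ℚ
  u₀-relation v = begin
    sumFin (λ i → u zero i * sumFin (λ j → A i j * v j))
      ≡⟨ sum-cong (λ i → sym (sum-*ˡ (u zero i) (λ j → A i j * v j))) ⟩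
    sumFin (λ i → sumFin (λ j → u zero i * (A i j * v j)))
      ≡⟨ sum-swap (λ i j → u zero i * (A i j * v j)) ⟩
    sumFin (λ j → sumFin (λ i → u zero i * (A i j * v j)))
      ≡⟨ sum-cong (λ j → trans (sum-cong (λ i → sym (ℚₚ.*-assoc (u zero i) (A i j) (v j)))) (sum-*ʳ (v j) (λ i → u zero i * A i j))) ⟩
    sumFin (λ j → sumFin (λ i → u zero i * A i j) * v j)
      ≡⟨ sum-zero (λ j → trans (cong (_* v j) (uA≡0 zero j)) (ℚₚ.*-zeroˡ (v j))) ⟩
    0ℚ ∎
    where open ≡-Reasoning
  -- The relation `u zero` has a nonzero entry at `i₀`, so row `i₀` is a combination of the other
  -- rows.
  all-rows : ∀ {v} → (∀ i → dot (A (punchIn i₀ i)) v ≡ 0ℚ) → ∀ i → dot (A i) v ≡ 0ℚ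
  all-rows {v} ker i with i Finₚ.≟ i₀
  ... | no i≢i₀ = ≡.subst (λ i → dot (A i) v ≡ 0ℚ) (Finₚ.punchIn-punchOut (i≢i₀ ∘ sym)) (ker (punchOut (i≢i₀ ∘ sym)))
  ... | yes refl = *-cancelˡ-0 u₀≢0 (begin
    u zero i * dot (A i) v
      ≡⟨ sym (ℚₚ.+-identityʳ _) ⟩
    u zero i * dot (A i) v + 0ℚ
      ≡⟨ cong (u zero i * dot (A i) v +_) (sym (sum-zero (λ s → trans (cong (u zero (punchIn i s) *_) (ker s)) (ℚₚ.*-zeroʳ (u zero (punchIn i s)))))) ⟩
    u zero i * dot (A i) v + sumFin (λ s → u zero (punchIn i s) * dot (A (punchIn i s)) v)
      ≡⟨ sym (sum-remove i (λ s → u zero s * dot (A s) v)) ⟩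
    sumFin (λ s → u zero s * dot (A s) v)
      ≡⟨ u₀-relation v ⟩
    0ℚ ∎)
    where open ≡-Reasoning

-- Induction on `k`: every independent left relation makes one row redundant, and the surviving m -
-- k rows cost at most that many dimensions. For a square matrix this bounds the right kernel from
-- below by the left one, with no notion of rank.
left-kernel⇒kernel-basis : ∀ {m n k} (A : Fin m → Vect n) (u : Fin k → Vect m) → LinIndep u →
  (∀ t j → sumFin (λ i → u t i * A i j) ≡ 0ℚ) →
  Σ ℕ λ d → Basis (λ v → ∀ i → dot (A i) v ≡ 0ℚ) d × n ℕ.+ k ≤ d ℕ.+ m
left-kernel⇒kernel-basis {m} {n} {zero} A u ind uA≡0 with annihilator-basis (List.tabulate A)
... | d , basis , n≤d+m =
  d , Basis-⇔ Allₚ.tabulate⁻ Allₚ.tabulate⁺ basis ,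
  ≡.subst₂ _≤_ (sym (ℕₚ.+-identityʳ n)) (cong (d ℕ.+_) (Lₚ.length-tabulate A)) n≤d+m
left-kernel⇒kernel-basis {m} {n} {suc k} A u ind uA≡0 with pivot (u zero)
-- If `u zero` were the zero vector, the coefficients 1, 0, ..., 0 would be a nontrivial relation.
... | inj₁ u₀≡0 = contradiction (ind (λ { zero → 1ℚ ; (suc _) → 0ℚ }) vanishing zero) (λ ())
  where
  1*x+0 : ∀ x → 1ℚ * x + 0ℚ ≡ x
  1*x+0 = solve-∀ ℚ-ring
  vanishing : ∀ i → 1ℚ * u zero i + sumFin (λ t → 0ℚ * u (suc t) i) ≡ 0ℚ
  vanishing i = trans (cong (1ℚ * u zero i +_) (sum-zero (λ t → ℚₚ.*-zeroˡ (u (suc t) i))))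
                      (trans (1*x+0 (u zero i)) (u₀≡0 i))
left-kernel⇒kernel-basis {suc m} {n} {suc k} A u ind uA≡0 | inj₂ (i₀ , u₀≢0) = extend
  (left-kernel⇒kernel-basis (A ∘ punchIn i₀) u′ u′-indep u′A≡0)
  where
  open DropRow A u ind uA≡0 i₀ u₀≢0
  extend : Σ ℕ (λ d → Basis (λ v → ∀ i → dot (A (punchIn i₀ i)) v ≡ 0ℚ) d × n ℕ.+ k ≤ d ℕ.+ m) →
           Σ ℕ (λ d → Basis (λ v → ∀ i → dot (A i) v ≡ 0ℚ) d × n ℕ.+ suc k ≤ d ℕ.+ suc m)
  extend (d , basis , n+k≤d+m) =
    d , Basis-⇔ all-rows (λ ker i → ker (punchIn i₀ i)) basis ,
    ≡.subst₂ _≤_ (sym (ℕₚ.+-suc n k)) (sym (ℕₚ.+-suc d m)) (s≤s n+k≤d+m)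

-- Polynomial functions of one variable

infixr 8 _^_

_^_ : ℚ → ℕ → ℚ
x ^ zero  = 1ℚ
x ^ suc k = x * x ^ k

^-+ : ∀ x k l → x ^ (k ℕ.+ l) ≡ x ^ k * x ^ l
^-+ x zero    l = sym (ℚₚ.*-identityˡ _)
^-+ x (suc k) l = trans (cong (x *_) (^-+ x k l)) (sym (ℚₚ.*-assoc x _ _))

*-^ : ∀ x y k → (x * y) ^ k ≡ x ^ k * y ^ k
*-^ x y zero    = sym (ℚₚ.*-identityˡ 1ℚ)
*-^ x y (suc k) = trans (cong (x * y *_) (*-^ x y k)) (interchange x y _ _)
  where
  interchange : ∀ a b c d → a * b * (c * d) ≡ a * c * (b * d)
  interchange = solve-∀ ℚ-ring

neg-^ : ∀ x k → (- x) ^ k ≡ sgn k * x ^ k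
neg-^ x zero    = sym (ℚₚ.*-identityˡ 1ℚ)
neg-^ x (suc k) = trans (cong ((- x) *_) (neg-^ x k)) (shuffle x (sgn k) (x ^ k))
  where
  shuffle : ∀ x s y → (- x) * (s * y) ≡ (- s) * (x * y)
  shuffle = solve-∀ ℚ-ring

-- Built from `1ℚ +_` so that `ι (3 + i)` unfolds to a ring expression in `ι i`, which the ring
-- solver can treat.
ι : ℕ → ℚ
ι zero    = 0ℚ
ι (suc n) = 1ℚ + ι n

0<1 : 0ℚ ℚ.< 1ℚ
0<1 = ℚₚ.positive⁻¹ 1ℚ

x<1+x : ∀ x → x ℚ.< 1ℚ + x
x<1+x x = ≡.subst (ℚ._< 1ℚ + x) (ℚₚ.+-identityˡ x) (ℚₚ.+-monoˡ-< x 0<1)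

ι-mono-≤ : ∀ {m n} → m ≤ n → ι m ℚ.≤ ι n
ι-mono-≤ {n = zero}  z≤n       = ℚₚ.≤-refl
ι-mono-≤ {n = suc n} z≤n       = ℚₚ.≤-trans (ι-mono-≤ {n = n} z≤n) (ℚₚ.<⇒≤ (x<1+x (ι n)))
ι-mono-≤             (s≤s m≤n) = ℚₚ.+-monoʳ-≤ 1ℚ (ι-mono-≤ m≤n)

ι-mono-< : ∀ {m n} → m < n → ι m ℚ.< ι n
ι-mono-< {m} m<n = ℚₚ.<-≤-trans (x<1+x (ι m)) (ι-mono-≤ m<n)

-- PolyFun D: polynomial functions of degree < D (so only 0 for D = 0).
PolyFun : ℕ → (ℚ → ℚ) → Set
PolyFun zero    f = ∀ x → f x ≡ 0ℚ
PolyFun (suc D) f = ∃ λ c → ∃ λ g → PolyFun D g × (∀ x → f x ≡ c + x * g x)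

PolyFun-cong : ∀ {D f g} → (∀ x → f x ≡ g x) → PolyFun D f → PolyFun D g
PolyFun-cong {zero}  f≗g pf             x = trans (sym (f≗g x)) (pf x)
PolyFun-cong {suc D} f≗g (c , h , ph , f≡) = c , h , ph , λ x → trans (sym (f≗g x)) (f≡ x)

PolyFun-0 : ∀ {D} → PolyFun D (λ _ → 0ℚ)
PolyFun-0 {zero}  x = refl
PolyFun-0 {suc D} = 0ℚ , (λ _ → 0ℚ) , PolyFun-0 , 0≡0+x*0
  where
  0≡0+x*0 : ∀ x → 0ℚ ≡ 0ℚ + x * 0ℚ
  0≡0+x*0 = solve-∀ ℚ-ring

PolyFun-const : ∀ {D} c → PolyFun (suc D) (λ _ → c)
PolyFun-const c = c , (λ _ → 0ℚ) , PolyFun-0 , λ x → c≡c+x*0 c x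
  where
  c≡c+x*0 : ∀ c x → c ≡ c + x * 0ℚ
  c≡c+x*0 = solve-∀ ℚ-ring

PolyFun-+ : ∀ {D f g} → PolyFun D f → PolyFun D g → PolyFun D (λ x → f x + g x)
PolyFun-+ {zero}  pf pg x = trans (cong₂ _+_ (pf x) (pg x)) (ℚₚ.+-identityˡ 0ℚ)
PolyFun-+ {suc D} (c , f′ , pf , f≡) (d , g′ , pg , g≡) =
  c + d , (λ x → f′ x + g′ x) , PolyFun-+ pf pg ,
  λ x → trans (cong₂ _+_ (f≡ x) (g≡ x)) (regroup c d x (f′ x) (g′ x))
  where
  regroup : ∀ c d x f g → c + x * f + (d + x * g) ≡ c + d + x * (f + g)
  regroup = solve-∀ ℚ-ring

PolyFun-*ˡ : ∀ {D f} a → PolyFun D f → PolyFun D (λ x → a * f x)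
PolyFun-*ˡ {zero}  a pf x = trans (cong (a *_) (pf x)) (ℚₚ.*-zeroʳ a)
PolyFun-*ˡ {suc D} a (c , f′ , pf , f≡) =
  a * c , (λ x → a * f′ x) , PolyFun-*ˡ a pf , λ x → trans (cong (a *_) (f≡ x)) (regroup a c x (f′ x))
  where
  regroup : ∀ a c x f → a * (c + x * f) ≡ a * c + x * (a * f)
  regroup = solve-∀ ℚ-ring

PolyFun-x* : ∀ {D f} → PolyFun D f → PolyFun (suc D) (λ x → x * f x)
PolyFun-x* {f = f} pf = 0ℚ , f , pf , λ x → sym (ℚₚ.+-identityˡ (x * f x))

PolyFun-weaken : ∀ {D f} → PolyFun D f → PolyFun (suc D) f
PolyFun-weaken {zero}  pf                 = PolyFun-cong (sym ∘ pf) PolyFun-0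
PolyFun-weaken {suc D} (c , g , pg , f≡) = c , g , PolyFun-weaken pg , f≡

PolyFun-≤ : ∀ {D D′ f} → D ≤ D′ → PolyFun D f → PolyFun D′ f
PolyFun-≤ D≤D′ = go (ℕₚ.≤⇒≤′ D≤D′)
  where
  go : ∀ {D D′ f} → D ℕ.≤′ D′ → PolyFun D f → PolyFun D′ f
  go (ℕ.≤′-reflexive refl) pf = pf
  go (ℕ.≤′-step D≤D′)      pf = PolyFun-weaken (go D≤D′ pf)

PolyFun-x^ : ∀ {D f} k → PolyFun D f → PolyFun (k ℕ.+ D) (λ x → x ^ k * f x)
PolyFun-x^ {f = f} zero    pf = PolyFun-cong (λ x → sym (ℚₚ.*-identityˡ (f x))) pf
PolyFun-x^ {f = f} (suc k) pf =
  PolyFun-cong (λ x → sym (ℚₚ.*-assoc x (x ^ k) (f x))) (PolyFun-x* (PolyFun-x^ k pf))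

PolyFun-[1-x]^ : ∀ {D f} k → PolyFun D f → PolyFun (k ℕ.+ D) (λ x → (1ℚ - x) ^ k * f x)
PolyFun-[1-x]^ {f = f} zero    pf = PolyFun-cong (λ x → sym (ℚₚ.*-identityˡ (f x))) pf
PolyFun-[1-x]^ {f = f} (suc k) pf =
  PolyFun-cong (λ x → expand x ((1ℚ - x) ^ k) (f x))
    (PolyFun-+ (PolyFun-weaken pg) (PolyFun-*ˡ (- 1ℚ) (PolyFun-x* pg)))
  where
  pg : PolyFun _ (λ x → (1ℚ - x) ^ k * f x)
  pg = PolyFun-[1-x]^ k pf
  expand : ∀ x a f → a * f + (- 1ℚ) * (x * (a * f)) ≡ (1ℚ - x) * a * f
  expand = solve-∀ ℚ-ring

-- Division by x - x₀: the quotient for c + x g arises from the quotient for g, and the remainder is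
-- the value at `x₀`.
factor : ∀ {D f} → PolyFun (suc D) f → ∀ x₀ →
  ∃ λ g → PolyFun D g × (∀ x → f x ≡ f x₀ + (x - x₀) * g x)
factor {zero} {f} (c , g , g≡0 , f≡) x₀ =
  (λ _ → 0ℚ) , (λ _ → refl) , λ x → trans (constant x) (trans (sym (constant x₀)) (add-0 (f x₀) x x₀))
  where
  c+x*0 : ∀ c x → c + x * 0ℚ ≡ c
  c+x*0 = solve-∀ ℚ-ring
  add-0 : ∀ a x y → a ≡ a + (x - y) * 0ℚ
  add-0 = solve-∀ ℚ-ring
  constant : ∀ x → f x ≡ c
  constant x = trans (f≡ x) (trans (cong (λ z → c + x * z) (g≡0 x)) (c+x*0 c x))
factor {suc D} {f} (c , g , pg , f≡) x₀ with factor pg x₀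
... | h , ph , g≡ =
  (λ x → g x₀ + x * h x) , (g x₀ , h , ph , λ _ → refl) , λ x → begin
    f x                                                    ≡⟨ f≡ x ⟩
    c + x * g x                                            ≡⟨ cong (λ z → c + x * z) (g≡ x) ⟩
    c + x * (g x₀ + (x - x₀) * h x)                        ≡⟨ regroup c x x₀ (g x₀) (h x) ⟩
    (c + x₀ * g x₀) + (x - x₀) * (g x₀ + x * h x)          ≡⟨ cong (_+ (x - x₀) * (g x₀ + x * h x)) (sym (f≡ x₀)) ⟩
    f x₀ + (x - x₀) * (g x₀ + x * h x)                     ∎
  where
  open ≡-Reasoning
  regroup : ∀ c x x₀ g h → c + x * (g + (x - x₀) * h) ≡ (c + x₀ * g) + (x - x₀) * (g + x * h)
  regroup = solve-∀ ℚ-ring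

many-roots⇒0 : ∀ {D f} → PolyFun D f → ∀ {xs} → Unique xs → All (λ x → f x ≡ 0ℚ) xs → D ≤ length xs →
  ∀ x → f x ≡ 0ℚ
many-roots⇒0 {zero}  pf _ _ _ = pf
many-roots⇒0 {suc D} {f} pf {x₀ ∷ xs} (x₀∉xs ∷ uniq) (fx₀ ∷ roots) (s≤s D≤) x with factor pf x₀
... | g , pg , f≡ = trans (f≡′ x) (trans (cong ((x - x₀) *_) (g≡0 x)) (ℚₚ.*-zeroʳ (x - x₀)))
  where
  f≡′ : ∀ x → f x ≡ (x - x₀) * g x
  f≡′ x = trans (f≡ x) (trans (cong (_+ (x - x₀) * g x) fx₀) (ℚₚ.+-identityˡ _))
  g≡0 : ∀ x → g x ≡ 0ℚ
  g≡0 = many-roots⇒0 pg uniq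
    (All.zipWith (λ {y} (x₀≢y , fy) →
       *-cancelˡ-0 (λ y-x₀ → x₀≢y (sym (a-b≡0⇒a≡b y-x₀))) (trans (sym (f≡′ y)) fy)) (x₀∉xs , roots)) D≤

-- Allows a factor x to be cancelled from an identity between polynomial functions; the points 1,
-- ..., D are nonzero and numerous enough.
vanishing-off-0⇒0 : ∀ {D f} → PolyFun D f → (∀ x → x ≢ 0ℚ → f x ≡ 0ℚ) → ∀ x → f x ≡ 0ℚ
vanishing-off-0⇒0 {D} pf f≡0 =
  many-roots⇒0 pf
    (APₚ.applyUpTo⁺₁ point D (λ i<j _ → ℚₚ.<⇒≢ (ι-mono-< (s≤s i<j))))
    (Allₚ.applyUpTo⁺₂ point D (λ i → f≡0 (point i) (ℚₚ.<⇒≢ (ι-mono-< {0} {suc i} (s≤s z≤n)) ∘ sym)))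
    (ℕₚ.≤-reflexive (sym (Lₚ.length-applyUpTo point D)))
  where
  point : ℕ → ℚ
  point i = ι (suc i)

-- Formal polynomials and their values

mono : List ℕ → List ℚ → ℚ
mono []       ρ       = 1ℚ
mono (b ∷ bs) []      = 1ℚ
mono (b ∷ bs) (x ∷ ρ) = x ^ b * mono bs ρ

eval : Poly → List ℚ → ℚ
eval []            ρ = 0ℚ
eval ((c , b) ∷ p) ρ = c * mono b ρ + eval p ρ

-- Exponent lists carry no length: `[]` and `0 ∷ []` have the same value under `mono` but count as
-- different monomials for `coeff`. Values determine coefficients only once the length is fixed.
Arity : ℕ → Poly → Set
Arity r = All (λ t → length (proj₂ t) ≡ r)

coeff-≡ : ∀ {b a} c p → b ≡ a → coeff ((c , b) ∷ p) a ≡ c + coeff p a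
coeff-≡ {b} {a} c p b≡a = cong (if_then c + coeff p a else coeff p a) (Dec.dec-true (Lₚ.≡-dec ℕ._≟_ b a) b≡a)

coeff-≢ : ∀ {b a} c p → b ≢ a → coeff ((c , b) ∷ p) a ≡ coeff p a
coeff-≢ {b} {a} c p b≢a = cong (if_then c + coeff p a else coeff p a) (Dec.dec-false (Lₚ.≡-dec ℕ._≟_ b a) b≢a)

≡⊎≢ : (b a : List ℕ) → b ≡ a ⊎ b ≢ a
≡⊎≢ b a = Dec.toSum (Lₚ.≡-dec ℕ._≟_ b a)

coeff-++ : ∀ p q a → coeff (p ++ q) a ≡ coeff p a + coeff q a
coeff-++ []            q a = sym (ℚₚ.+-identityˡ _)
coeff-++ ((c , b) ∷ p) q a with ≡⊎≢ b a
... | inj₁ b≡a = trans (coeff-≡ c (p ++ q) b≡a) (trans (cong (c +_) (coeff-++ p q a))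
                  (trans (sym (ℚₚ.+-assoc c _ _)) (cong (_+ coeff q a) (sym (coeff-≡ c p b≡a)))))
... | inj₂ b≢a = trans (coeff-≢ c (p ++ q) b≢a) (trans (coeff-++ p q a) (cong (_+ coeff q a) (sym (coeff-≢ c p b≢a))))

coeff-scaleP : ∀ d p a → coeff (scaleP d p) a ≡ d * coeff p a
coeff-scaleP d []            a = sym (ℚₚ.*-zeroʳ d)
coeff-scaleP d ((c , b) ∷ p) a with ≡⊎≢ b a
... | inj₁ b≡a = trans (coeff-≡ (d * c) (scaleP d p) b≡a) (trans (cong (d * c +_) (coeff-scaleP d p a))
                  (trans (sym (ℚₚ.*-distribˡ-+ d c _)) (cong (d *_) (sym (coeff-≡ c p b≡a)))))
... | inj₂ b≢a = trans (coeff-≢ (d * c) (scaleP d p) b≢a) (trans (coeff-scaleP d p a) (cong (d *_) (sym (coeff-≢ c p b≢a))))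

negP≡scaleP : ∀ p → negP p ≡ scaleP (- 1ℚ) p
negP≡scaleP []            = refl
negP≡scaleP ((c , b) ∷ p) = cong₂ (λ d q → (d , b) ∷ q) (-c≡-1*c c) (negP≡scaleP p)
  where
  -c≡-1*c : ∀ c → - c ≡ - 1ℚ * c
  -c≡-1*c = solve-∀ ℚ-ring

-1* : ∀ c → - 1ℚ * c ≡ - c
-1* = solve-∀ ℚ-ring

coeff-negP : ∀ p a → coeff (negP p) a ≡ - coeff p a
coeff-negP p a = trans (cong (λ q → coeff q a) (negP≡scaleP p)) (trans (coeff-scaleP (- 1ℚ) p a) (-1* (coeff p a)))

coeff--P : ∀ p q a → coeff (p -P q) a ≡ coeff p a - coeff q a
coeff--P p q a = trans (coeff-++ p (negP q) a) (cong (coeff p a +_) (coeff-negP q a))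

eval-++ : ∀ p q ρ → eval (p ++ q) ρ ≡ eval p ρ + eval q ρ
eval-++ []            q ρ = sym (ℚₚ.+-identityˡ _)
eval-++ ((c , b) ∷ p) q ρ = trans (cong (c * mono b ρ +_) (eval-++ p q ρ)) (sym (ℚₚ.+-assoc (c * mono b ρ) _ _))

eval-scaleP : ∀ d p ρ → eval (scaleP d p) ρ ≡ d * eval p ρ
eval-scaleP d []            ρ = sym (ℚₚ.*-zeroʳ d)
eval-scaleP d ((c , b) ∷ p) ρ = trans (cong (d * c * mono b ρ +_) (eval-scaleP d p ρ)) (distrib d c (mono b ρ) (eval p ρ))
  where
  distrib : ∀ d c m e → d * c * m + d * e ≡ d * (c * m + e)
  distrib = solve-∀ ℚ-ring

eval-negP : ∀ p ρ → eval (negP p) ρ ≡ - eval p ρ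
eval-negP p ρ = trans (cong (λ q → eval q ρ) (negP≡scaleP p)) (trans (eval-scaleP (- 1ℚ) p ρ) (-1* (eval p ρ)))

eval--P : ∀ p q ρ → eval (p -P q) ρ ≡ eval p ρ - eval q ρ
eval--P p q ρ = trans (eval-++ p (negP q) ρ) (cong (eval p ρ +_) (eval-negP q ρ))

Arity-scaleP : ∀ {r} d {p} → Arity r p → Arity r (scaleP d p)
Arity-scaleP d = Allₚ.map⁺

Arity-negP : ∀ {r p} → Arity r p → Arity r (negP p)
Arity-negP = Allₚ.map⁺

Arity--P : ∀ {r p q} → Arity r p → Arity r q → Arity r (p -P q)
Arity--P ap aq = Allₚ.++⁺ ap (Arity-negP aq)

-- p = Σ x₁^k · slice k p = slice 0 p + x₁ · lower p.
slice : ℕ → Poly → Poly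
slice k []                  = []
slice k ((c , [])     ∷ p)  = slice k p
slice k ((c , b ∷ bs) ∷ p)  = if does (b ℕ.≟ k) then (c , bs) ∷ slice k p else slice k p

lower : Poly → Poly
lower []                       = []
lower ((c , [])         ∷ p)   = lower p
lower ((c , zero  ∷ bs) ∷ p)   = lower p
lower ((c , suc b ∷ bs) ∷ p)   = (c , b ∷ bs) ∷ lower p

slice-suc : ∀ k p → slice (suc k) p ≡ slice k (lower p)
slice-suc k []                     = refl
slice-suc k ((c , [])         ∷ p) = slice-suc k p
slice-suc k ((c , zero  ∷ bs) ∷ p) = slice-suc k p
slice-suc k ((c , suc b ∷ bs) ∷ p) =
  cong₂ (λ (t : Bool) q → if t then (c , bs) ∷ q else q)
        (Dec.does-≡ (suc b ℕ.≟ suc k) (Dec.map′ (cong suc) ℕₚ.suc-injective (b ℕ.≟ k)))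
        (slice-suc k p)

Arity-slice : ∀ {r} k {p} → Arity (suc r) p → Arity r (slice k p)
Arity-slice k [] = []
Arity-slice k {(c , b ∷ bs) ∷ p} (len ∷ ap) with does (b ℕ.≟ k)
... | true  = ℕₚ.suc-injective len ∷ Arity-slice k ap
... | false = Arity-slice k ap

Arity-lower : ∀ {r p} → Arity r p → Arity r (lower p)
Arity-lower [] = []
Arity-lower {p = (c , [])         ∷ p} (_   ∷ ap) = Arity-lower ap
Arity-lower {p = (c , zero  ∷ bs) ∷ p} (_   ∷ ap) = Arity-lower ap
Arity-lower {p = (c , suc b ∷ bs) ∷ p} (len ∷ ap) = len ∷ Arity-lower ap

coeff-slice : ∀ {r} p k as → Arity (suc r) p → coeff p (k ∷ as) ≡ coeff (slice k p) as
coeff-slice []                 k as []       = refl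
coeff-slice ((c , b ∷ bs) ∷ p) k as (_ ∷ ap) with Dec.toSum (b ℕ.≟ k)
... | inj₂ b≢k =
  trans (coeff-≢ {b ∷ bs} {k ∷ as} c p (b≢k ∘ Lₚ.∷-injectiveˡ))
        (trans (coeff-slice p k as ap)
               (cong (λ t → coeff (if t then (c , bs) ∷ slice k p else slice k p) as)
                     (sym (Dec.dec-false (b ℕ.≟ k) b≢k))))
... | inj₁ b≡k =
  trans same (cong (λ t → coeff (if t then (c , bs) ∷ slice k p else slice k p) as)
                   (sym (Dec.dec-true (b ℕ.≟ k) b≡k)))
  where
  same : coeff ((c , b ∷ bs) ∷ p) (k ∷ as) ≡ coeff ((c , bs) ∷ slice k p) as
  same with ≡⊎≢ bs as
  ... | inj₁ bs≡as = trans (coeff-≡ c p (cong₂ _∷_ b≡k bs≡as))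
                       (trans (cong (c +_) (coeff-slice p k as ap)) (sym (coeff-≡ c (slice k p) bs≡as)))
  ... | inj₂ bs≢as = trans (coeff-≢ {b ∷ bs} {k ∷ as} c p (bs≢as ∘ Lₚ.∷-injectiveʳ))
                       (trans (coeff-slice p k as ap) (sym (coeff-≢ c (slice k p) bs≢as)))

eval-slice-lower : ∀ {r} p x ρ → Arity (suc r) p →
  eval p (x ∷ ρ) ≡ eval (slice 0 p) ρ + x * eval (lower p) (x ∷ ρ)
eval-slice-lower []                     x ρ []       = 0≡0+x*0 x
  where
  0≡0+x*0 : ∀ x → 0ℚ ≡ 0ℚ + x * 0ℚ
  0≡0+x*0 = solve-∀ ℚ-ring
eval-slice-lower ((c , zero ∷ bs) ∷ p)  x ρ (_ ∷ ap) =
  trans (cong (c * (1ℚ * mono bs ρ) +_) (eval-slice-lower p x ρ ap)) (regroup c (mono bs ρ) _ _)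
  where
  regroup : ∀ c m a b → c * (1ℚ * m) + (a + b) ≡ c * m + a + b
  regroup = solve-∀ ℚ-ring
eval-slice-lower ((c , suc b ∷ bs) ∷ p) x ρ (_ ∷ ap) =
  trans (cong (c * (x * x ^ b * mono bs ρ) +_) (eval-slice-lower p x ρ ap))
        (regroup c x (x ^ b) (mono bs ρ) (eval (slice 0 p) ρ) (eval (lower p) (x ∷ ρ)))
  where
  regroup : ∀ c x y m a b → c * (x * y * m) + (a + x * b) ≡ a + x * (c * (y * m) + b)
  regroup = solve-∀ ℚ-ring

eval-PolyFun : ∀ p ρ → ∃ λ D → PolyFun D (λ x → eval p (x ∷ ρ))
eval-PolyFun []                 ρ = 0 , λ _ → refl
eval-PolyFun ((c , [])     ∷ p) ρ with eval-PolyFun p ρ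
... | D , pf = suc D , PolyFun-+ (PolyFun-const (c * 1ℚ)) (PolyFun-weaken pf)
eval-PolyFun ((c , b ∷ bs) ∷ p) ρ with eval-PolyFun p ρ
... | D , pf = b ℕ.+ 1 ℕ.+ D ,
  PolyFun-+ (PolyFun-≤ (ℕₚ.m≤m+n (b ℕ.+ 1) D) (PolyFun-*ˡ c (PolyFun-x^ b (PolyFun-const (mono bs ρ)))))
            (PolyFun-≤ (ℕₚ.m≤n+m D (b ℕ.+ 1)) pf)

-- Setting the first variable to 0 isolates `slice 0 p`. What remains is x times `lower p`, so
-- `lower p` vanishes away from 0, hence everywhere, and the next coefficient is its constant one.
slice-vanishes : ∀ {r} k p ρ → Arity (suc r) p → (∀ x → eval p (x ∷ ρ) ≡ 0ℚ) → eval (slice k p) ρ ≡ 0ℚ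
slice-vanishes zero p ρ ap ev≡0 =
  trans (sym (trans (eval-slice-lower p 0ℚ ρ ap) (a+0*b (eval (slice 0 p) ρ) (eval (lower p) (0ℚ ∷ ρ))))) (ev≡0 0ℚ)
  where
  a+0*b : ∀ a b → a + 0ℚ * b ≡ a
  a+0*b = solve-∀ ℚ-ring
slice-vanishes (suc k) p ρ ap ev≡0 =
  trans (cong (λ q → eval q ρ) (slice-suc k p))
        (slice-vanishes k (lower p) ρ (Arity-lower ap)
          (vanishing-off-0⇒0 (proj₂ (eval-PolyFun (lower p) ρ)) (λ x x≢0 → *-cancelˡ-0 x≢0 (x*lower≡0 x))))
  where
  x*lower≡0 : ∀ x → x * eval (lower p) (x ∷ ρ) ≡ 0ℚ
  x*lower≡0 x = begin
    x * eval (lower p) (x ∷ ρ)                          ≡⟨ sym (ℚₚ.+-identityˡ _) ⟩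
    0ℚ + x * eval (lower p) (x ∷ ρ)                     ≡⟨ cong (_+ x * eval (lower p) (x ∷ ρ)) (sym (slice-vanishes zero p ρ ap ev≡0)) ⟩
    eval (slice 0 p) ρ + x * eval (lower p) (x ∷ ρ)     ≡⟨ sym (eval-slice-lower p x ρ ap) ⟩
    eval p (x ∷ ρ)                                      ≡⟨ ev≡0 x ⟩
    0ℚ                                                  ∎
    where open ≡-Reasoning

vanishing⇒coeff≡0 : ∀ r p → Arity r p → (∀ ρ → length ρ ≡ r → eval p ρ ≡ 0ℚ) → ∀ a → coeff p a ≡ 0ℚ
vanishing⇒coeff≡0 zero    p ap ev≡0 []       = trans (constant-coeff p ap) (ev≡0 [] refl)
  where
  constant-coeff : ∀ p → Arity 0 p → coeff p [] ≡ eval p []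
  constant-coeff []             []       = refl
  constant-coeff ((c , []) ∷ p) (_ ∷ ap) =
    trans (coeff-≡ c p refl) (cong₂ _+_ (sym (ℚₚ.*-identityʳ c)) (constant-coeff p ap))
vanishing⇒coeff≡0 zero    p ap ev≡0 (k ∷ as) = no-coeff p ap
  where
  no-coeff : ∀ p → Arity 0 p → coeff p (k ∷ as) ≡ 0ℚ
  no-coeff []             []       = refl
  no-coeff ((c , []) ∷ p) (_ ∷ ap) = trans (coeff-≢ {[]} {k ∷ as} c p (λ ())) (no-coeff p ap)
vanishing⇒coeff≡0 (suc r) p ap ev≡0 []       = no-coeff p ap
  where
  no-coeff : ∀ p → Arity (suc r) p → coeff p [] ≡ 0ℚ
  no-coeff []                 []       = refl
  no-coeff ((c , b ∷ bs) ∷ p) (_ ∷ ap) = trans (coeff-≢ {b ∷ bs} {[]} c p (λ ())) (no-coeff p ap)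
vanishing⇒coeff≡0 (suc r) p ap ev≡0 (k ∷ as) =
  trans (coeff-slice p k as ap)
        (vanishing⇒coeff≡0 r (slice k p) (Arity-slice k ap)
          (λ ρ len → slice-vanishes k p ρ ap (λ x → ev≡0 (x ∷ ρ) (cong suc len))) as)

-- The bridge between the two views of a polynomial: identities are checked on values, by ring
-- arithmetic, and then read off for coefficients, which are the matrix entries.
eval-≡⇒coeff-≡ : ∀ r {p q} → Arity r p → Arity r q → (∀ ρ → length ρ ≡ r → eval p ρ ≡ eval q ρ) →
  ∀ a → coeff p a ≡ coeff q a
eval-≡⇒coeff-≡ r {p} {q} ap aq ev≡ a = a-b≡0⇒a≡b (trans (sym (coeff--P p q a))
  (vanishing⇒coeff≡0 r (p -P q) (Arity--P ap aq)
    (λ ρ len → trans (eval--P p q ρ) (a≡b⇒a-b≡0 (ev≡ ρ len))) a))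

length-zipWith-+ : ∀ {r a b} → length a ≡ r → length b ≡ r → length (zipWith ℕ._+_ a b) ≡ r
length-zipWith-+ {r} {a} {b} la lb =
  trans (Lₚ.length-zipWith ℕ._+_ a b) (trans (cong₂ ℕ._⊓_ la lb) (ℕₚ.⊓-idem r))

Arity-mulP : ∀ {r p q} → Arity r p → Arity r q → Arity r (mulP p q)
Arity-mulP             []       aq = []
Arity-mulP {p = (c , a) ∷ p} (la ∷ ap) aq =
  Allₚ.++⁺ (Allₚ.map⁺ (All.map (λ {t} lb → length-zipWith-+ {a = a} {proj₂ t} la lb) aq)) (Arity-mulP ap aq)

mono-zipWith : ∀ a b ρ → length a ≡ length b → mono (zipWith ℕ._+_ a b) ρ ≡ mono a ρ * mono b ρ
mono-zipWith []       []       ρ       eq = sym (ℚₚ.*-identityˡ 1ℚ)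
mono-zipWith (a ∷ as) (b ∷ bs) []      eq = sym (ℚₚ.*-identityˡ 1ℚ)
mono-zipWith (a ∷ as) (b ∷ bs) (x ∷ ρ) eq =
  trans (cong₂ _*_ (^-+ x a b) (mono-zipWith as bs ρ (ℕₚ.suc-injective eq)))
        (interchange (x ^ a) (x ^ b) (mono as ρ) (mono bs ρ))
  where
  interchange : ∀ a b c d → a * b * (c * d) ≡ a * c * (b * d)
  interchange = solve-∀ ℚ-ring

eval-mulP : ∀ {r p q} → Arity r p → Arity r q → ∀ ρ → eval (mulP p q) ρ ≡ eval p ρ * eval q ρ
eval-mulP {q = q} [] aq ρ = sym (ℚₚ.*-zeroˡ (eval q ρ))
eval-mulP {p = (c , a) ∷ p} {q} (la ∷ ap) aq ρ = begin
  eval (map _ q ++ mulP p q) ρ                        ≡⟨ eval-++ (map _ q) (mulP p q) ρ ⟩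
  eval (map _ q) ρ + eval (mulP p q) ρ                ≡⟨ cong₂ _+_ (single q aq) (eval-mulP ap aq ρ) ⟩
  c * mono a ρ * eval q ρ + eval p ρ * eval q ρ       ≡⟨ sym (ℚₚ.*-distribʳ-+ (eval q ρ) (c * mono a ρ) (eval p ρ)) ⟩
  (c * mono a ρ + eval p ρ) * eval q ρ                ∎
  where
  open ≡-Reasoning
  regroup : ∀ c d m n e → c * d * (m * n) + c * m * e ≡ c * m * (d * n + e)
  regroup = solve-∀ ℚ-ring
  single : ∀ q → Arity _ q → eval (map (λ { (d , b) → (c * d , zipWith ℕ._+_ a b) }) q) ρ ≡ c * mono a ρ * eval q ρ
  single []            []        = sym (ℚₚ.*-zeroʳ (c * mono a ρ))
  single ((d , b) ∷ q) (lb ∷ aq) =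
    trans (cong₂ _+_ (cong (c * d *_) (mono-zipWith a b ρ (trans la (sym lb)))) (single q aq))
          (regroup c d (mono a ρ) (mono b ρ) (eval q ρ))

mono-replicate-0 : ∀ r ρ → mono (replicate r 0) ρ ≡ 1ℚ
mono-replicate-0 zero    ρ       = refl
mono-replicate-0 (suc r) []      = refl
mono-replicate-0 (suc r) (x ∷ ρ) = trans (ℚₚ.*-identityˡ _) (mono-replicate-0 r ρ)

eval-monoP : ∀ a ρ → eval (monoP a) ρ ≡ mono a ρ
eval-monoP a ρ = 1*x+0 (mono a ρ)
  where
  1*x+0 : ∀ x → 1ℚ * x + 0ℚ ≡ x
  1*x+0 = solve-∀ ℚ-ring

Arity-oneP : ∀ r → Arity r (oneP r)
Arity-oneP r = Lₚ.length-replicate r ∷ []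

Arity-powP : ∀ {r p} → Arity r p → ∀ k → Arity r (powP r p k)
Arity-powP {r} ap zero    = Arity-oneP r
Arity-powP     ap (suc k) = Arity-mulP ap (Arity-powP ap k)

eval-powP : ∀ {r p} → Arity r p → ∀ k ρ → eval (powP r p k) ρ ≡ eval p ρ ^ k
eval-powP {r}     ap zero    ρ = trans (eval-monoP (replicate r 0) ρ) (mono-replicate-0 r ρ)
eval-powP {r} {p} ap (suc k) ρ =
  trans (eval-mulP ap (Arity-powP ap k) ρ) (cong (eval p ρ *_) (eval-powP ap k ρ))

length-unitExp : ∀ r i → length (unitExp r i) ≡ r
length-unitExp zero    i       = refl
length-unitExp (suc r) zero    = cong suc (Lₚ.length-replicate r)
length-unitExp (suc r) (suc i) = cong suc (length-unitExp r i)

Arity-X : ∀ r i → Arity r (X r i)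
Arity-X r i = length-unitExp r i ∷ []

Arity-subst : ∀ r P Ls → Arity r P → length Ls ≡ r → All (Arity r) Ls → Arity r (subst r P Ls)
Arity-subst r []            Ls []       len aL = []
Arity-subst r ((c , a) ∷ P) Ls (_ ∷ aP) len aL =
  Allₚ.++⁺ (Arity-scaleP c (go Ls a aL)) (Arity-subst r P Ls aP len aL)
  where
  go : ∀ Ls a → All (Arity r) Ls → Arity r (List.foldr mulP (oneP r) (zipWith (powP r) Ls a))
  go []       a       aL         = Arity-oneP r
  go (L ∷ Ls) []      aL         = Arity-oneP r
  go (L ∷ Ls) (k ∷ a) (aL ∷ aLs) = Arity-mulP (Arity-powP aL k) (go Ls a aLs)

eval-subst : ∀ r P Ls → All (Arity r) Ls → ∀ ρ → eval (subst r P Ls) ρ ≡ eval P (map (λ L → eval L ρ) Ls)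
eval-subst r []            Ls aL ρ = refl
eval-subst r ((c , a) ∷ P) Ls aL ρ =
  trans (eval-++ (substTerm r Ls (c , a)) (subst r P Ls) ρ)
        (cong₂ _+_ (trans (eval-scaleP c (List.foldr mulP (oneP r) (zipWith (powP r) Ls a)) ρ)
                          (cong (c *_) (proj₂ (go Ls a aL))))
                   (eval-subst r P Ls aL ρ))
  where
  unit : eval (oneP r) ρ ≡ 1ℚ
  unit = trans (eval-monoP (replicate r 0) ρ) (mono-replicate-0 r ρ)
  go : ∀ Ls a → All (Arity r) Ls →
    Arity r (List.foldr mulP (oneP r) (zipWith (powP r) Ls a)) ×
    eval (List.foldr mulP (oneP r) (zipWith (powP r) Ls a)) ρ ≡ mono a (map (λ L → eval L ρ) Ls)
  go []       []      aL         = Arity-oneP r , unit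
  go []       (k ∷ a) aL         = Arity-oneP r , unit
  go (L ∷ Ls) []      aL         = Arity-oneP r , unit
  go (L ∷ Ls) (k ∷ a) (aL ∷ aLs) with go Ls a aLs
  ... | arity , ev = Arity-mulP (Arity-powP aL k) arity ,
        trans (eval-mulP (Arity-powP aL k) arity ρ) (cong₂ _*_ (eval-powP aL k ρ) ev)

-- The index sets S_{N,r}

data Even : ℕ → Set where
  even-0  : Even 0
  even-2+ : ∀ {n} → Even n → Even (suc (suc n))

even⊎odd : ∀ n → Even n ⊎ Even (suc n)
even⊎odd zero    = inj₁ even-0
even⊎odd (suc n) with even⊎odd n
... | inj₁ e = inj₂ (even-2+ e)
... | inj₂ o = inj₁ o

¬even∧odd : ∀ {n} → Even n → ¬ Even (suc n)
¬even∧odd even-0      ()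
¬even∧odd (even-2+ e) (even-2+ o) = ¬even∧odd e o

Even-+ : ∀ {m n} → Even m → Even n → Even (m ℕ.+ n)
Even-+ even-0      en = en
Even-+ (even-2+ e) en = even-2+ (Even-+ e en)

Even-+⁻ : ∀ {m n} → Even m → Even (m ℕ.+ n) → Even n
Even-+⁻ even-0      e           = e
Even-+⁻ (even-2+ e) (even-2+ f) = Even-+⁻ e f

sgn-even : ∀ {n} → Even n → sgn n ≡ 1ℚ
sgn-even even-0      = refl
sgn-even (even-2+ {n} e) = trans (neg-neg (sgn n)) (sgn-even e)
  where
  neg-neg : ∀ x → - - x ≡ x
  neg-neg = solve-∀ ℚ-ring

neg-^-even : ∀ {n} x → Even n → (- x) ^ n ≡ x ^ n
neg-^-even {n} x e = trans (neg-^ x n) (trans (cong (_* x ^ n) (sgn-even e)) (ℚₚ.*-identityˡ _))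

PosEven : ℕ → Set
PosEven n = Even n × 0 < n

-- Exponent lists b = (n₁-1,…,n_r-1) of the index set S_{N,r}.
record Exponents (N r : ℕ) (b : List ℕ) : Set where
  constructor exponents
  field
    length-≡ : length b ≡ r
    posEven  : All PosEven b
    weight   : r ℕ.+ sumℕ b ≡ N

odd⇒pred-even : ∀ n → n ℕ.% 2 ≡ 1 → ∃ λ p → n ≡ suc p × Even p
odd⇒pred-even (suc zero)    _  = 0 , refl , even-0
odd⇒pred-even (suc (suc n)) eq with odd⇒pred-even n eq
... | p , refl , e = suc (suc p) , refl , even-2+ e

pred-even⇒odd : ∀ {p} → Even p → suc p ℕ.% 2 ≡ 1
pred-even⇒odd even-0      = refl
pred-even⇒odd (even-2+ e) = pred-even⇒odd e

∈-oddsDown⁻ : ∀ {N n} → n ∈ oddsDown N → ∃ λ p → n ≡ suc p × PosEven p × suc p ≤ N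
∈-oddsDown⁻ {N} {n} n∈ with ∈ₚ.∈-filter⁻ (λ n → 3 ≤? n) {xs = filter (λ n → n ℕ.% 2 ℕ.≟ 1) (downFrom (suc N))} n∈
... | n∈′ , 3≤n with ∈ₚ.∈-filter⁻ (λ n → n ℕ.% 2 ℕ.≟ 1) {xs = downFrom (suc N)} n∈′
...   | n∈″ , odd with odd⇒pred-even n odd
...     | p , refl , e = p , refl , (e , ℕₚ.≤-trans (s≤s z≤n) (ℕₚ.≤-pred 3≤n)) , ℕₚ.≤-pred (∈ₚ.∈-downFrom⁻ n∈″)

∈-oddsDown⁺ : ∀ {N p} → PosEven p → suc p ≤ N → suc p ∈ oddsDown N
∈-oddsDown⁺ {N} {suc (suc p)} (e , _) p<N =
  ∈ₚ.∈-filter⁺ (λ n → 3 ≤? n)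
    (∈ₚ.∈-filter⁺ (λ n → n ℕ.% 2 ℕ.≟ 1) (∈ₚ.∈-downFrom⁺ (s≤s p<N)) (pred-even⇒odd e)) (s≤s (s≤s (s≤s z≤n)))

oddsDown-unique : ∀ N → Unique (oddsDown N)
oddsDown-unique N =
  Uniqueₚ.filter⁺ (λ n → 3 ≤? n) (Uniqueₚ.filter⁺ (λ n → n ℕ.% 2 ℕ.≟ 1) (Uniqueₚ.downFrom⁺ (suc N)))

-- `S` splits on its first argument, so its last clause does not compute for a variable `N`.
S-suc : ∀ N r → S N (suc r) ≡ concatMap (λ n₁ → map (n₁ ∷_) (S (N ∸ n₁) r)) (oddsDown N)
S-suc zero    r = refl
S-suc (suc N) r = refl

S-sound : ∀ N r {m} → m ∈ S N r → ∃ λ b → m ≡ map suc b × Exponents N r b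
S-sound zero zero (here refl) = [] , refl , exponents refl [] refl
S-sound N (suc r) {m} m∈
  with find (∈ₚ.∈-concatMap⁻ (λ n₁ → map (n₁ ∷_) (S (N ∸ n₁) r)) {xs = oddsDown N} (≡.subst (m ∈_) (S-suc N r) m∈))
... | n , n∈ , m∈′ with ∈-oddsDown⁻ {N} n∈ | ∈ₚ.∈-map⁻ (n ∷_) m∈′
...   | p , refl , pe , p<N | m′ , m′∈ , refl with S-sound (N ∸ suc p) r m′∈
...     | b , refl , exponents len pes wt =
  p ∷ b , refl , exponents (cong suc len) (pe ∷ pes) (begin
    suc (r ℕ.+ (p ℕ.+ sumℕ b))   ≡⟨ cong suc (sym (ℕₚ.+-assoc r p (sumℕ b))) ⟩
    suc (r ℕ.+ p ℕ.+ sumℕ b)     ≡⟨ cong (λ z → suc (z ℕ.+ sumℕ b)) (ℕₚ.+-comm r p) ⟩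
    suc (p ℕ.+ r ℕ.+ sumℕ b)     ≡⟨ cong suc (ℕₚ.+-assoc p r (sumℕ b)) ⟩
    suc p ℕ.+ (r ℕ.+ sumℕ b)     ≡⟨ cong (suc p ℕ.+_) wt ⟩
    suc p ℕ.+ (N ∸ suc p)        ≡⟨ ℕₚ.m+[n∸m]≡n p<N ⟩
    N                            ∎)
  where open ≡-Reasoning

S-complete : ∀ N r {b} → Exponents N r b → map suc b ∈ S N r
S-complete zero zero {[]} _ = here refl
S-complete (suc N) zero {[]} (exponents _ _ ())
S-complete N (suc r) {p ∷ b} (exponents len (pe ∷ pes) wt) =
  ≡.subst (map suc (p ∷ b) ∈_) (sym (S-suc N r))
    (∈ₚ.∈-concatMap⁺ (λ n₁ → map (n₁ ∷_) (S (N ∸ n₁) r))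
      (lose (∈-oddsDown⁺ pe (≡.subst (suc p ≤_) wt′ (ℕₚ.m≤m+n (suc p) (r ℕ.+ sumℕ b))))
            (∈ₚ.∈-map⁺ (suc p ∷_) (S-complete (N ∸ suc p) r (exponents (ℕₚ.suc-injective len) pes
              (trans (sym (ℕₚ.m+n∸m≡n (suc p) (r ℕ.+ sumℕ b))) (cong (_∸ suc p) wt′)))))))
  where
  wt′ : suc p ℕ.+ (r ℕ.+ sumℕ b) ≡ N
  wt′ = trans (cong suc (trans (sym (ℕₚ.+-assoc p r (sumℕ b))) (trans (cong (ℕ._+ sumℕ b) (ℕₚ.+-comm p r)) (ℕₚ.+-assoc r p (sumℕ b))))) wt

S-unique : ∀ N r → Unique (S N r)
S-unique zero    zero    = [] ∷ []
S-unique (suc N) zero    = []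
S-unique N       (suc r) = ≡.subst Unique (sym (S-suc N r))
  (Uniqueₚ.concat⁺
    (Allₚ.map⁺ (All.universal (λ n → Uniqueₚ.map⁺ Lₚ.∷-injectiveʳ (S-unique (N ∸ n) r)) (oddsDown N)))
    (APₚ.map⁺ (AllPairs.map disjoint (oddsDown-unique N))))
  where
  disjoint : ∀ {n n′} → n ≢ n′ → ∀ {m} → ¬ (m ∈ map (n ∷_) (S (N ∸ n) r) × m ∈ map (n′ ∷_) (S (N ∸ n′) r))
  disjoint n≢n′ (m∈ , m∈′) with ∈ₚ.∈-map⁻ (_ ∷_) m∈ | ∈ₚ.∈-map⁻ (_ ∷_) m∈′
  ... | _ , _ , refl | _ , _ , eq = n≢n′ (Lₚ.∷-injectiveˡ eq)

lookup-injective : ∀ {A : Set} {xs : List A} → Unique xs → ∀ i j → lookup xs i ≡ lookup xs j → i ≡ j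
lookup-injective (_    ∷ _)  zero    zero    _  = refl
lookup-injective {xs = _ ∷ xs} (x∉xs ∷ _) zero    (suc j) eq = contradiction eq (All.lookup x∉xs (∈ₚ.∈-lookup j))
lookup-injective {xs = _ ∷ xs} (x∉xs ∷ _) (suc i) zero    eq = contradiction (sym eq) (All.lookup x∉xs (∈ₚ.∈-lookup i))
lookup-injective (_    ∷ un) (suc i) (suc j) eq = cong suc (lookup-injective un i j eq)

expo : ∀ N r → Fin (∣S∣ N r) → List ℕ
expo N r i = map ℕ.pred (idx N r i)

map-pred-suc : ∀ b → map ℕ.pred (map suc b) ≡ b
map-pred-suc b = trans (sym (Lₚ.map-∘ b)) (Lₚ.map-id b)

idx≡suc-expo : ∀ N r i → idx N r i ≡ map suc (expo N r i)
idx≡suc-expo N r i with idx N r i | S-sound N r (∈ₚ.∈-lookup {xs = S N r} i)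
... | _ | b , refl , _ = cong (map suc) (sym (map-pred-suc b))

expo-sound : ∀ N r i → Exponents N r (expo N r i)
expo-sound N r i with idx N r i | S-sound N r (∈ₚ.∈-lookup {xs = S N r} i)
... | _ | b , refl , ex = ≡.subst (Exponents N r) (sym (map-pred-suc b)) ex

expo-complete : ∀ N r {b} → Exponents N r b → ∃ λ i → expo N r i ≡ b
expo-complete N r {b} ex =
  Any.index m∈ , trans (cong (map ℕ.pred) (sym (Anyₚ.lookup-index m∈))) (map-pred-suc b)
  where
  m∈ : map suc b ∈ S N r
  m∈ = S-complete N r ex

expo-injective : ∀ N r i j → expo N r i ≡ expo N r j → i ≡ j
expo-injective N r i j eq = lookup-injective (S-unique N r) i j
  (trans (idx≡suc-expo N r i) (trans (cong (map suc) eq) (sym (idx≡suc-expo N r j))))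

-- Matrices as operators on polynomials

-- The linear functional with value `φ b` at the monomial `b`. Coefficients, values and products of
-- a row vector with a matrix are all of this kind.
lin : (List ℕ → ℚ) → Poly → ℚ
lin φ []            = 0ℚ
lin φ ((c , b) ∷ p) = c * φ b + lin φ p

δ : List ℕ → List ℕ → ℚ
δ b a = if does (Lₚ.≡-dec ℕ._≟_ b a) then 1ℚ else 0ℚ

δ-≡ : ∀ {b a} → b ≡ a → δ b a ≡ 1ℚ
δ-≡ {b} {a} b≡a = cong (if_then 1ℚ else 0ℚ) (Dec.dec-true (Lₚ.≡-dec ℕ._≟_ b a) b≡a)

δ-≢ : ∀ {b a} → b ≢ a → δ b a ≡ 0ℚ
δ-≢ {b} {a} b≢a = cong (if_then 1ℚ else 0ℚ) (Dec.dec-false (Lₚ.≡-dec ℕ._≟_ b a) b≢a)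

lin-++ : ∀ φ p q → lin φ (p ++ q) ≡ lin φ p + lin φ q
lin-++ φ []            q = sym (ℚₚ.+-identityˡ _)
lin-++ φ ((c , b) ∷ p) q = trans (cong (c * φ b +_) (lin-++ φ p q)) (sym (ℚₚ.+-assoc (c * φ b) _ _))

lin-scaleP : ∀ φ d p → lin φ (scaleP d p) ≡ d * lin φ p
lin-scaleP φ d []            = sym (ℚₚ.*-zeroʳ d)
lin-scaleP φ d ((c , b) ∷ p) = trans (cong (d * c * φ b +_) (lin-scaleP φ d p)) (regroup d c (φ b) (lin φ p))
  where
  regroup : ∀ d c f l → d * c * f + d * l ≡ d * (c * f + l)
  regroup = solve-∀ ℚ-ring

lin-cong : ∀ {φ ψ p} → All (λ t → φ (proj₂ t) ≡ ψ (proj₂ t)) p → lin φ p ≡ lin ψ p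
lin-cong []                             = refl
lin-cong {p = (c , b) ∷ p} (eq ∷ eqs) = cong₂ _+_ (cong (c *_) eq) (lin-cong eqs)

lin-sum : ∀ {k} (φ : Fin k → List ℕ → ℚ) p → lin (λ b → sumFin (λ i → φ i b)) p ≡ sumFin (λ i → lin (φ i) p)
lin-sum {k} φ []            = sym (sum-0 k)
lin-sum     φ ((c , b) ∷ p) =
  trans (cong₂ _+_ (sym (sum-*ˡ c (λ i → φ i b))) (lin-sum φ p))
        (sym (sum-+ (λ i → c * φ i b) (λ i → lin (φ i) p)))

lin-*ʳ : ∀ φ c p → lin (λ b → φ b * c) p ≡ lin φ p * c
lin-*ʳ φ c []            = sym (ℚₚ.*-zeroˡ c)
lin-*ʳ φ c ((d , b) ∷ p) = trans (cong (d * (φ b * c) +_) (lin-*ʳ φ c p)) (regroup d (φ b) c (lin φ p))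
  where
  regroup : ∀ d f c l → d * (f * c) + l * c ≡ (d * f + l) * c
  regroup = solve-∀ ℚ-ring

coeff-lin : ∀ p a → coeff p a ≡ lin (λ b → δ b a) p
coeff-lin []            a = refl
coeff-lin ((c , b) ∷ p) a with ≡⊎≢ b a
... | inj₁ b≡a = trans (coeff-≡ c p b≡a) (cong₂ _+_ (sym (trans (cong (c *_) (δ-≡ b≡a)) (ℚₚ.*-identityʳ c))) (coeff-lin p a))
... | inj₂ b≢a = trans (coeff-≢ c p b≢a) (trans (coeff-lin p a)
                   (sym (trans (cong (_+ lin (λ b → δ b a) p) (trans (cong (c *_) (δ-≢ b≢a)) (ℚₚ.*-zeroʳ c))) (ℚₚ.+-identityˡ _))))

eval-lin : ∀ p ρ → eval p ρ ≡ lin (λ b → mono b ρ) p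
eval-lin []            ρ = refl
eval-lin ((c , b) ∷ p) ρ = cong (c * mono b ρ +_) (eval-lin p ρ)

linearExtend : (List ℕ → Poly) → Poly → Poly
linearExtend f = concatMap (λ { (c , b) → scaleP c (f b) })

lin-linearExtend : ∀ φ f p → lin φ (linearExtend f p) ≡ lin (λ b → lin φ (f b)) p
lin-linearExtend φ f []            = refl
lin-linearExtend φ f ((c , b) ∷ p) =
  trans (lin-++ φ (scaleP c (f b)) (linearExtend f p))
        (cong₂ _+_ (lin-scaleP φ c (f b)) (lin-linearExtend φ f p))

coeff-linearExtend : ∀ f p a → coeff (linearExtend f p) a ≡ lin (λ b → coeff (f b) a) p
coeff-linearExtend f p a = trans (coeff-lin (linearExtend f p) a)
  (trans (lin-linearExtend (λ b → δ b a) f p)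
         (lin-cong (All.universal (λ t → sym (coeff-lin (f (proj₂ t)) a)) p)))

All-linearExtend : ∀ {Q : List ℕ → Set} f p → All (λ t → All (Q ∘ proj₂) (f (proj₂ t))) p → All (Q ∘ proj₂) (linearExtend f p)
All-linearExtend f []            []         = []
All-linearExtend f ((c , b) ∷ p) (qb ∷ qs) = Allₚ.++⁺ (Allₚ.map⁺ qb) (All-linearExtend f p qs)

lin-map-tabulate : ∀ φ {A : Set} {k} (g : A → Term) (h : Fin k → A) →
  lin φ (map g (List.tabulate h)) ≡ sumFin (λ i → proj₁ (g (h i)) * φ (proj₂ (g (h i))))
lin-map-tabulate φ {k = zero}  g h = refl
lin-map-tabulate φ {k = suc k} g h = cong (proj₁ (g (h zero)) * φ (proj₂ (g (h zero))) +_) (lin-map-tabulate φ g (h ∘ suc))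

idM-≡ : ∀ {n} (j : Fin n) → idM j j ≡ 1ℚ
idM-≡ zero    = refl
idM-≡ (suc j) = idM-≡ j

idM-≢ : ∀ {n} {j k : Fin n} → j ≢ k → idM j k ≡ 0ℚ
idM-≢ {j = zero}  {zero}  j≢k = contradiction refl j≢k
idM-≢ {j = zero}  {suc k} j≢k = refl
idM-≢ {j = suc j} {zero}  j≢k = refl
idM-≢ {j = suc j} {suc k} j≢k = idM-≢ (j≢k ∘ cong suc)

idM-⇔ : ∀ {m n} {j k : Fin m} {j′ k′ : Fin n} → (j ≡ k → j′ ≡ k′) → (j′ ≡ k′ → j ≡ k) → idM j k ≡ idM j′ k′
idM-⇔ {j = j} {k} {j′} f g with j Finₚ.≟ k
... | no j≢k   = trans (idM-≢ j≢k) (sym (idM-≢ (j≢k ∘ g)))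
... | yes refl = trans (idM-≡ j) (sym (≡.subst (λ k′ → idM j′ k′ ≡ 1ℚ) (f refl) (idM-≡ j′)))

idM-sym : ∀ {n} (j k : Fin n) → idM j k ≡ idM k j
idM-sym j k = idM-⇔ {j = j} {k} {k} {j} sym sym

sum-idMˡ : ∀ {n} j (g : Vect n) → sumFin (λ k → idM j k * g k) ≡ g j
sum-idMˡ j g = trans (sum-cong (λ k → trans (ℚₚ.*-comm (idM j k) (g k)) (cong (g k *_) (idM-sym j k)))) (sum-idM g j)

δ-injective : ∀ {n} {f : Fin n → List ℕ} → (∀ {j k} → f j ≡ f k → j ≡ k) → ∀ j k → δ (f j) (f k) ≡ idM j k
δ-injective {f = f} inj j k with j Finₚ.≟ k
... | yes refl = trans (δ-≡ {f j} refl) (sym (idM-≡ j))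
... | no j≢k   = trans (δ-≢ {f j} (j≢k ∘ inj)) (sym (idM-≢ j≢k))

-- Inserting the identity matrix makes a double sum of the permuted sum; summing in the other order
-- gives the original one.
sum-reindex : ∀ {n} (σ τ : Fin n → Fin n) → (∀ i → σ (τ i) ≡ i) → (∀ i → τ (σ i) ≡ i) →
  (f : Vect n) → sumFin (f ∘ σ) ≡ sumFin f
sum-reindex σ τ στ τσ f = begin
  sumFin (λ i → f (σ i))
    ≡⟨ sum-cong (λ i → sym (sum-idMˡ (σ i) f)) ⟩
  sumFin (λ i → sumFin (λ j → idM (σ i) j * f j))
    ≡⟨ sum-swap (λ i j → idM (σ i) j * f j) ⟩
  sumFin (λ j → sumFin (λ i → idM (σ i) j * f j))
    ≡⟨ sum-cong (λ j → trans (sum-cong (λ i → cong (_* f j) (idM-⇔ {j = σ i} {j} {i} {τ j} (λ { refl → sym (τσ i) }) (λ { refl → στ j }))))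
                              (sum-*ʳ (f j) (λ i → idM i (τ j)))) ⟩
  sumFin (λ j → sumFin (λ i → idM i (τ j)) * f j)
    ≡⟨ sum-cong (λ j → trans (cong (_* f j) (trans (sum-cong (λ i → sym (ℚₚ.*-identityˡ (idM i (τ j))))) (sum-idM (λ _ → 1ℚ) (τ j))))
                              (ℚₚ.*-identityˡ (f j))) ⟩
  sumFin f ∎
  where open ≡-Reasoning

module IndexSet (N r : ℕ) where

  ex : Fin (∣S∣ N r) → List ℕ
  ex = expo N r

  lin-polyOf : ∀ φ (v : Vect (∣S∣ N r)) → lin φ (polyOf N r v) ≡ sumFin (λ i → v i * φ (ex i))
  lin-polyOf φ v = lin-map-tabulate φ (λ i → (v i , ex i)) id

  δ-ex : ∀ j k → δ (ex j) (ex k) ≡ idM j k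
  δ-ex = δ-injective (expo-injective N r _ _)

  sum-δ : ∀ j (g : Vect (∣S∣ N r)) → sumFin (λ k → δ (ex j) (ex k) * g k) ≡ g j
  sum-δ j g = trans (sum-cong (λ k → cong (_* g k) (δ-ex j k))) (sum-idMˡ j g)

  coeff-polyOf : ∀ v j → coeff (polyOf N r v) (ex j) ≡ v j
  coeff-polyOf v j = trans (coeff-lin (polyOf N r v) (ex j))
    (trans (lin-polyOf (λ b → δ b (ex j)) v)
           (trans (sum-cong (λ i → cong (v i *_) (δ-ex i j))) (sum-idM v j)))

  All-polyOf : ∀ {Q : List ℕ → Set} v → (∀ i → Q (ex i)) → All (Q ∘ proj₂) (polyOf N r v)
  All-polyOf v q = Allₚ.map⁺ (Allₚ.tabulate⁺ q)

  Arity-polyOf : ∀ v → Arity r (polyOf N r v)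
  Arity-polyOf v = All-polyOf v (λ i → Exponents.length-≡ (expo-sound N r i))

  row-times-matrix : ∀ (f : List ℕ → Poly) (A : Mat (∣S∣ N r)) → (∀ i k → A i k ≡ coeff (f (ex i)) (ex k)) →
    ∀ v k → (v ⟨· A) k ≡ coeff (linearExtend f (polyOf N r v)) (ex k)
  row-times-matrix f A A≡ v k = trans (sum-cong (λ i → cong (v i *_) (A≡ i k)))
    (trans (sym (lin-polyOf (λ b → coeff (f b) (ex k)) v)) (sym (coeff-linearExtend f (polyOf N r v) (ex k))))

  -- A monomial outside the index set is dropped when passing to the coefficient vector, so the matrix A
  -- computes the full operator f on p as soon as f b contributes nothing for such monomials b.
  coefficients-times-matrix : ∀ (f : List ℕ → Poly) (A : Mat (∣S∣ N r)) → (∀ i k → A i k ≡ coeff (f (ex i)) (ex k)) →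
    ∀ p n → All (λ t → (∃ λ i → ex i ≡ proj₂ t) ⊎ ((∀ i → proj₂ t ≢ ex i) × coeff (f (proj₂ t)) (ex n) ≡ 0ℚ)) p →
    ((λ k → coeff p (ex k)) ⟨· A) n ≡ coeff (linearExtend f p) (ex n)
  coefficients-times-matrix f A A≡ p n cases = begin
    sumFin (λ k → coeff p (ex k) * A k n)
      ≡⟨ sum-cong (λ k → trans (cong (_* A k n) (coeff-lin p (ex k))) (sym (lin-*ʳ (λ b → δ b (ex k)) (A k n) p))) ⟩
    sumFin (λ k → lin (λ b → δ b (ex k) * A k n) p)
      ≡⟨ sym (lin-sum (λ k b → δ b (ex k) * A k n) p) ⟩
    lin (λ b → sumFin (λ k → δ b (ex k) * A k n)) p
      ≡⟨ lin-cong (All.map (λ {t} → termwise {t}) cases) ⟩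
    lin (λ b → coeff (f b) (ex n)) p
      ≡⟨ sym (coeff-linearExtend f p (ex n)) ⟩
    coeff (linearExtend f p) (ex n) ∎
    where
    open ≡-Reasoning
    termwise : ∀ {t} → (∃ λ i → ex i ≡ proj₂ t) ⊎ ((∀ i → proj₂ t ≢ ex i) × coeff (f (proj₂ t)) (ex n) ≡ 0ℚ) →
      sumFin (λ k → δ (proj₂ t) (ex k) * A k n) ≡ coeff (f (proj₂ t)) (ex n)
    termwise (inj₁ (i , refl)) = trans (sum-δ i (λ k → A k n)) (A≡ i n)
    termwise {t} (inj₂ (outside , f≡0)) =
      trans (sum-zero (λ k → trans (cong (_* A k n) (δ-≢ {proj₂ t} (outside k))) (ℚₚ.*-zeroˡ (A k n)))) (sym f≡0)

-- The operation ∘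

-- The summand of `compo` that belongs to the neighbouring variables `i` and `j`, with the two
-- inserted monomials left free.
step : ℕ → ℕ → ℕ → ℕ → List ℕ → List ℕ → Poly
step r i j a m m′ = mulP (powP r (X r j -P X r i) a) (monoP m) -P scaleP (sgn a) (mulP (powP r (X r i -P X r j) a) (monoP m′))

All-mulP : ∀ {P Q R : List ℕ → Set} → (∀ {a b} → P a → Q b → R (zipWith ℕ._+_ a b)) →
  ∀ {p q} → All (P ∘ proj₂) p → All (Q ∘ proj₂) q → All (R ∘ proj₂) (mulP p q)
All-mulP f []        qs = []
All-mulP f (pa ∷ ps) qs = Allₚ.++⁺ (Allₚ.map⁺ (All.map (f pa) qs)) (All-mulP f ps qs)

All-step : ∀ {r i j a m m′} {P Q R : List ℕ → Set} → (∀ {b c} → P b → Q c → R (zipWith ℕ._+_ b c)) →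
  All (P ∘ proj₂) (powP r (X r j -P X r i) a) → All (P ∘ proj₂) (powP r (X r i -P X r j) a) →
  Q m → Q m′ → All (R ∘ proj₂) (step r i j a m m′)
All-step f ps ps′ qm qm′ = Allₚ.++⁺ (All-mulP f ps (qm ∷ [])) (Allₚ.map⁺ (Allₚ.map⁺ (All-mulP f ps′ (qm′ ∷ []))))

Arity-X-X : ∀ r i j → Arity r (X r i -P X r j)
Arity-X-X r i j = Arity--P (Arity-X r i) (Arity-X r j)

Arity-step : ∀ r i j a {m m′} → length m ≡ r → length m′ ≡ r → Arity r (step r i j a m m′)
Arity-step r i j a {m} {m′} lm lm′ =
  All-step {r} {i} {j} {a} {m} {m′} {λ b → length b ≡ r} {λ b → length b ≡ r} {λ b → length b ≡ r} (λ {b} {c} → length-zipWith-+ {r} {b} {c})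
    (Arity-powP (Arity-X-X r j i) a) (Arity-powP (Arity-X-X r i j) a) lm lm′

-- For even `a` the sign is 1 and the orientation of the difference of variables is immaterial, so
-- both halves carry the same power.
eval-step : ∀ r i j {a} {m m′} ρ → Even a → length m ≡ r → length m′ ≡ r →
  eval (step r i j a m m′) ρ ≡
  (eval (X r j) ρ - eval (X r i) ρ) ^ a * mono m ρ - (eval (X r j) ρ - eval (X r i) ρ) ^ a * mono m′ ρ
eval-step r i j {a} {m} {m′} ρ ev-a lm lm′ = begin
  eval (step r i j a m m′) ρ
    ≡⟨ eval--P (part j i m) (scaleP (sgn a) (part i j m′)) ρ ⟩
  eval (part j i m) ρ - eval (scaleP (sgn a) (part i j m′)) ρ
    ≡⟨ cong₂ _-_ (eval-part j i m lm) (trans (eval-scaleP (sgn a) (part i j m′) ρ)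
         (trans (cong (_* eval (part i j m′) ρ) (sgn-even ev-a)) (trans (ℚₚ.*-identityˡ _) (eval-part i j m′ lm′)))) ⟩
  (xj - xi) ^ a * mono m ρ - (xi - xj) ^ a * mono m′ ρ
    ≡⟨ cong (λ z → (xj - xi) ^ a * mono m ρ - z * mono m′ ρ)
         (trans (cong (_^ a) (negate xi xj)) (neg-^-even (xj - xi) ev-a)) ⟩
  (xj - xi) ^ a * mono m ρ - (xj - xi) ^ a * mono m′ ρ ∎
  where
  open ≡-Reasoning
  xi xj : ℚ
  xi = eval (X r i) ρ
  xj = eval (X r j) ρ
  part : ℕ → ℕ → List ℕ → Poly
  part k l n = mulP (powP r (X r k -P X r l) a) (monoP n)
  negate : ∀ x y → x - y ≡ - (y - x)
  negate = solve-∀ ℚ-ring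
  eval-part : ∀ k l n → length n ≡ r → eval (part k l n) ρ ≡ (eval (X r k) ρ - eval (X r l) ρ) ^ a * mono n ρ
  eval-part k l n ln =
    trans (eval-mulP (Arity-powP (Arity-X-X r k l) a) (ln ∷ []) ρ)
          (cong₂ _*_ (trans (eval-powP (Arity-X-X r k l) a ρ) (cong (_^ a) (eval--P (X r k) (X r l) ρ)))
                     (eval-monoP n ρ))

eval-X₂₀ : ∀ x y → eval (X 2 0) (x ∷ y ∷ []) ≡ x
eval-X₂₀ = identity
  where
  identity : ∀ x y → 1ℚ * ((x * 1ℚ) * (1ℚ * 1ℚ)) + 0ℚ ≡ x
  identity = solve-∀ ℚ-ring

eval-X₂₁ : ∀ x y → eval (X 2 1) (x ∷ y ∷ []) ≡ y
eval-X₂₁ = identity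
  where
  identity : ∀ x y → 1ℚ * (1ℚ * ((y * 1ℚ) * 1ℚ)) + 0ℚ ≡ y
  identity = solve-∀ ℚ-ring

eval-X₃₀ : ∀ x y z → eval (X 3 0) (x ∷ y ∷ z ∷ []) ≡ x
eval-X₃₀ = identity
  where
  identity : ∀ x y z → 1ℚ * ((x * 1ℚ) * (1ℚ * (1ℚ * 1ℚ))) + 0ℚ ≡ x
  identity = solve-∀ ℚ-ring

eval-X₃₁ : ∀ x y z → eval (X 3 1) (x ∷ y ∷ z ∷ []) ≡ y
eval-X₃₁ = identity
  where
  identity : ∀ x y z → 1ℚ * (1ℚ * ((y * 1ℚ) * (1ℚ * 1ℚ))) + 0ℚ ≡ y
  identity = solve-∀ ℚ-ring

eval-X₃₂ : ∀ x y z → eval (X 3 2) (x ∷ y ∷ z ∷ []) ≡ z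
eval-X₃₂ = identity
  where
  identity : ∀ x y z → 1ℚ * (1ℚ * (1ℚ * ((z * 1ℚ) * 1ℚ))) + 0ℚ ≡ z
  identity = solve-∀ ℚ-ring

-- The value of f ∘ g at (x,y) resp. (x,y,z) in terms of P = f ⊗ g, for f of even degree.
ihara₂ : (ℚ → ℚ → ℚ) → ℚ → ℚ → ℚ
ihara₂ P x y = P x y + P (y - x) x - P (y - x) y

ihara₃ : (ℚ → ℚ → ℚ → ℚ) → ℚ → ℚ → ℚ → ℚ
ihara₃ P x y z = P x y z + P (y - x) x z - P (y - x) y z + P (z - y) x y - P (z - y) x z

eval-compo₂ : ∀ {a} b x y → Even a →
  eval (compo a (b ∷ [])) (x ∷ y ∷ []) ≡ ihara₂ (λ x y → mono (a ∷ b ∷ []) (x ∷ y ∷ [])) x y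
eval-compo₂ {a} b x y ev-a = begin
  eval (compo a (b ∷ [])) ρ
    ≡⟨ eval-++ (monoP (a ∷ b ∷ [])) (s₀ ++ []) ρ ⟩
  eval (monoP (a ∷ b ∷ [])) ρ + eval (s₀ ++ []) ρ
    ≡⟨ cong₂ _+_ (eval-monoP (a ∷ b ∷ []) ρ) (trans (eval-++ s₀ [] ρ) (cong (_+ 0ℚ) eval-s₀)) ⟩
  mono (a ∷ b ∷ []) ρ + (D * mono (b ∷ 0 ∷ []) ρ - D * mono (0 ∷ b ∷ []) ρ + 0ℚ)
    ≡⟨ regroup (x ^ a) (x ^ b) (y ^ b) D ⟩
  ihara₂ (λ x y → mono (a ∷ b ∷ []) (x ∷ y ∷ [])) x y ∎
  where
  open ≡-Reasoning
  ρ : List ℚ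
  ρ = x ∷ y ∷ []
  D : ℚ
  D = (y - x) ^ a
  s₀ : Poly
  s₀ = step 2 0 1 a (b ∷ 0 ∷ []) (0 ∷ b ∷ [])
  eval-s₀ : eval s₀ ρ ≡ D * mono (b ∷ 0 ∷ []) ρ - D * mono (0 ∷ b ∷ []) ρ
  eval-s₀ = trans (eval-step 2 0 1 ρ ev-a refl refl)
    (cong (λ z → z ^ a * mono (b ∷ 0 ∷ []) ρ - z ^ a * mono (0 ∷ b ∷ []) ρ) (cong₂ _-_ (eval-X₂₁ x y) (eval-X₂₀ x y)))
  regroup : ∀ xa xb yb D →
    xa * (yb * 1ℚ) + (D * (xb * (1ℚ * 1ℚ)) - D * (1ℚ * (yb * 1ℚ)) + 0ℚ) ≡
    xa * (yb * 1ℚ) + D * (xb * 1ℚ) - D * (yb * 1ℚ)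
  regroup = solve-∀ ℚ-ring

eval-compo₃ : ∀ {a} b c x y z → Even a →
  eval (compo a (b ∷ c ∷ [])) (x ∷ y ∷ z ∷ []) ≡ ihara₃ (λ x y z → mono (a ∷ b ∷ c ∷ []) (x ∷ y ∷ z ∷ [])) x y z
eval-compo₃ {a} b c x y z ev-a = begin
  eval (compo a (b ∷ c ∷ [])) ρ
    ≡⟨ eval-++ (monoP (a ∷ b ∷ c ∷ [])) (s₀ ++ (s₁ ++ [])) ρ ⟩
  eval (monoP (a ∷ b ∷ c ∷ [])) ρ + eval (s₀ ++ (s₁ ++ [])) ρ
    ≡⟨ cong₂ _+_ (eval-monoP (a ∷ b ∷ c ∷ []) ρ)
         (trans (eval-++ s₀ (s₁ ++ []) ρ) (cong₂ _+_ eval-s₀ (trans (eval-++ s₁ [] ρ) (cong (_+ 0ℚ) eval-s₁)))) ⟩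
  mono (a ∷ b ∷ c ∷ []) ρ + ((D₀ * mono (b ∷ 0 ∷ c ∷ []) ρ - D₀ * mono (0 ∷ b ∷ c ∷ []) ρ) +
                            (D₁ * mono (b ∷ c ∷ 0 ∷ []) ρ - D₁ * mono (b ∷ 0 ∷ c ∷ []) ρ + 0ℚ))
    ≡⟨ regroup (x ^ a) (x ^ b) (y ^ b) (y ^ c) (z ^ c) D₀ D₁ ⟩
  ihara₃ (λ x y z → mono (a ∷ b ∷ c ∷ []) (x ∷ y ∷ z ∷ [])) x y z ∎
  where
  open ≡-Reasoning
  ρ : List ℚ
  ρ = x ∷ y ∷ z ∷ []
  D₀ D₁ : ℚ
  D₀ = (y - x) ^ a
  D₁ = (z - y) ^ a
  s₀ s₁ : Poly
  s₀ = step 3 0 1 a (b ∷ 0 ∷ c ∷ []) (0 ∷ b ∷ c ∷ [])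
  s₁ = step 3 1 2 a (b ∷ c ∷ 0 ∷ []) (b ∷ 0 ∷ c ∷ [])
  eval-s₀ : eval s₀ ρ ≡ D₀ * mono (b ∷ 0 ∷ c ∷ []) ρ - D₀ * mono (0 ∷ b ∷ c ∷ []) ρ
  eval-s₀ = trans (eval-step 3 0 1 ρ ev-a refl refl)
    (cong (λ t → t ^ a * mono (b ∷ 0 ∷ c ∷ []) ρ - t ^ a * mono (0 ∷ b ∷ c ∷ []) ρ)
          (cong₂ _-_ (eval-X₃₁ x y z) (eval-X₃₀ x y z)))
  eval-s₁ : eval s₁ ρ ≡ D₁ * mono (b ∷ c ∷ 0 ∷ []) ρ - D₁ * mono (b ∷ 0 ∷ c ∷ []) ρ
  eval-s₁ = trans (eval-step 3 1 2 ρ ev-a refl refl)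
    (cong (λ t → t ^ a * mono (b ∷ c ∷ 0 ∷ []) ρ - t ^ a * mono (b ∷ 0 ∷ c ∷ []) ρ)
          (cong₂ _-_ (eval-X₃₂ x y z) (eval-X₃₁ x y z)))
  regroup : ∀ xa xb yb yc zc D₀ D₁ →
    xa * (yb * (zc * 1ℚ)) + ((D₀ * (xb * (1ℚ * (zc * 1ℚ))) - D₀ * (1ℚ * (yb * (zc * 1ℚ)))) +
                            (D₁ * (xb * (yc * (1ℚ * 1ℚ))) - D₁ * (xb * (1ℚ * (zc * 1ℚ))) + 0ℚ)) ≡
    xa * (yb * (zc * 1ℚ)) + D₀ * (xb * (zc * 1ℚ)) - D₀ * (yb * (zc * 1ℚ))
      + D₁ * (xb * (yc * 1ℚ)) - D₁ * (xb * (zc * 1ℚ))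
  regroup = solve-∀ ℚ-ring

-- circ m and circTail m generate the rows of E and of E^(2): circTail leaves the first variable alone.
circ : List ℕ → Poly
circ []       = []
circ (b ∷ bs) = compo b bs

prepend : ℕ → Poly → Poly
prepend a = map (λ { (c , b) → (c , a ∷ b) })

circTail : List ℕ → Poly
circTail []       = []
circTail (b ∷ bs) = prepend b (circ bs)

e≡coeff-circ : ∀ m n → e m n ≡ coeff (circ (map ℕ.pred m)) (map ℕ.pred n)
e≡coeff-circ []       n = refl
e≡coeff-circ (m ∷ ms) n = refl

coeff-prepend-≡ : ∀ a p as → coeff (prepend a p) (a ∷ as) ≡ coeff p as
coeff-prepend-≡ a []            as = refl
coeff-prepend-≡ a ((c , b) ∷ p) as with ≡⊎≢ b as
... | inj₁ b≡as = trans (coeff-≡ c (prepend a p) (cong (a ∷_) b≡as))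
                    (trans (cong (c +_) (coeff-prepend-≡ a p as)) (sym (coeff-≡ c p b≡as)))
... | inj₂ b≢as = trans (coeff-≢ {a ∷ b} {a ∷ as} c (prepend a p) (b≢as ∘ Lₚ.∷-injectiveʳ))
                    (trans (coeff-prepend-≡ a p as) (sym (coeff-≢ c p b≢as)))

coeff-outside : ∀ p a → All (λ t → proj₂ t ≢ a) p → coeff p a ≡ 0ℚ
coeff-outside []            a []           = refl
coeff-outside ((c , b) ∷ p) a (b≢a ∷ rest) = trans (coeff-≢ c p b≢a) (coeff-outside p a rest)

coeff-prepend-≢ : ∀ {a a′} p as → a ≢ a′ → coeff (prepend a p) (a′ ∷ as) ≡ 0ℚ
coeff-prepend-≢ {a} {a′} p as a≢a′ =
  coeff-outside (prepend a p) (a′ ∷ as) (Allₚ.map⁺ (All.universal (λ _ → a≢a′ ∘ Lₚ.∷-injectiveˡ) p))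

eval-prepend : ∀ a p x ρ → eval (prepend a p) (x ∷ ρ) ≡ x ^ a * eval p ρ
eval-prepend a []            x ρ = sym (ℚₚ.*-zeroʳ (x ^ a))
eval-prepend a ((c , b) ∷ p) x ρ =
  trans (cong (c * (x ^ a * mono b ρ) +_) (eval-prepend a p x ρ)) (regroup c (x ^ a) (mono b ρ) (eval p ρ))
  where
  regroup : ∀ c x m e → c * (x * m) + x * e ≡ x * (c * m + e)
  regroup = solve-∀ ℚ-ring

E^-entry : ∀ a as b bs →
  (if does (Lₚ.≡-dec ℕ._≟_ (take 1 (suc a ∷ map suc as)) (take 1 (suc b ∷ map suc bs)))
   then e (drop 1 (suc a ∷ map suc as)) (drop 1 (suc b ∷ map suc bs)) else 0ℚ)
  ≡ coeff (circTail (a ∷ as)) (b ∷ bs)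
E^-entry a as b bs with Dec.toSum (a ℕ.≟ b)
... | inj₁ refl = trans (cong (if_then e (map suc as) (map suc bs) else 0ℚ)
    (Dec.dec-true (Lₚ.≡-dec ℕ._≟_ (suc a ∷ []) (suc a ∷ [])) refl))
    (trans (e≡coeff-circ (map suc as) (map suc bs))
      (trans (cong₂ (λ m n → coeff (circ m) n) (map-pred-suc as) (map-pred-suc bs)) (sym (coeff-prepend-≡ a (circ as) bs))))
... | inj₂ a≢b  = trans (cong (if_then e (map suc as) (map suc bs) else 0ℚ)
    (Dec.dec-false (Lₚ.≡-dec ℕ._≟_ (suc a ∷ []) (suc b ∷ [])) (a≢b ∘ ℕₚ.suc-injective ∘ Lₚ.∷-injectiveˡ)))
    (sym (coeff-prepend-≢ (circ as) bs a≢b))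

E≡coeff-circ : ∀ N r i k → E N r i k ≡ coeff (circ (expo N r i)) (expo N r k)
E≡coeff-circ N r i k = e≡coeff-circ (idx N r i) (idx N r k)

E^≡coeff-circTail : ∀ N i k → E^ N 3 2 i k ≡ coeff (circTail (expo N 3 i)) (expo N 3 k)
E^≡coeff-circTail N i k = entry (idx≡suc-expo N 3 i) (idx≡suc-expo N 3 k) (expo-sound N 3 i) (expo-sound N 3 k)
  where
  entry : ∀ {m n a b} → m ≡ map suc a → n ≡ map suc b → Exponents N 3 a → Exponents N 3 b →
    (if does (Lₚ.≡-dec ℕ._≟_ (take 1 m) (take 1 n)) then e (drop 1 m) (drop 1 n) else 0ℚ) ≡ coeff (circTail a) b
  entry {a = a ∷ as} {b ∷ bs} refl refl _ _ = E^-entry a as b bs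
  entry {a = []} _ _ (exponents () _ _) _
  entry {a = _ ∷ _} {[]} _ _ _ (exponents () _ _)

-- Monomials that can occur after ∘

at : ℕ → List ℕ → ℕ
at i       []      = 0
at zero    (b ∷ _) = b
at (suc i) (_ ∷ b) = at i b

at-zipWith : ∀ i {a b} → length a ≡ length b → at i (zipWith ℕ._+_ a b) ≡ at i a ℕ.+ at i b
at-zipWith i       {[]}    {[]}    len = refl
at-zipWith zero    {_ ∷ _} {_ ∷ _} len = refl
at-zipWith (suc i) {_ ∷ a} {_ ∷ b} len = at-zipWith i {a} {b} (ℕₚ.suc-injective len)

HasExponent : ℕ → ℕ → ℕ → List ℕ → Set
HasExponent r i d b = length b ≡ r × at i b ≡ d

HasExponent-zipWith : ∀ {r i d d′ a b} → HasExponent r i d a → HasExponent r i d′ b → HasExponent r i (d ℕ.+ d′) (zipWith ℕ._+_ a b)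
HasExponent-zipWith {i = i} {a = a} {b} (la , da) (lb , db) =
  length-zipWith-+ {a = a} {b} la lb , trans (at-zipWith i {a} {b} (trans la (sym lb))) (cong₂ ℕ._+_ da db)

at-replicate-0 : ∀ i r → at i (replicate r 0) ≡ 0
at-replicate-0 i       zero    = refl
at-replicate-0 zero    (suc r) = refl
at-replicate-0 (suc i) (suc r) = at-replicate-0 i r

at-unitExp : ∀ i r j → i ≢ j → at i (unitExp r j) ≡ 0
at-unitExp i       zero    j       i≢j = refl
at-unitExp zero    (suc r) zero    i≢j = contradiction refl i≢j
at-unitExp (suc i) (suc r) zero    i≢j = at-replicate-0 i r
at-unitExp zero    (suc r) (suc j) i≢j = refl
at-unitExp (suc i) (suc r) (suc j) i≢j = at-unitExp i r j (i≢j ∘ cong suc)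

HasExponent-pow : ∀ {r l} i j k → l ≢ i → l ≢ j → All (HasExponent r l 0 ∘ proj₂) (powP r (X r i -P X r j) k)
HasExponent-pow {r} {l} i j zero    l≢i l≢j = (Lₚ.length-replicate r , at-replicate-0 l r) ∷ []
HasExponent-pow {r} {l} i j (suc k) l≢i l≢j =
  All-mulP {HasExponent r l 0} {HasExponent r l 0} {HasExponent r l 0}
    (λ {a} {b} → HasExponent-zipWith {r} {l} {0} {0} {a} {b}) {X r i -P X r j} {powP r (X r i -P X r j) k}
    ((length-unitExp r i , at-unitExp l r i l≢i) ∷ (length-unitExp r j , at-unitExp l r j l≢j) ∷ [])
    (HasExponent-pow i j k l≢i l≢j)

-- The powers in `step` involve only the variables `i` and `j`; a third variable `l` keeps the
-- exponent `d` that it has in `m` and `m′`.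
step-outside : ∀ {r i j k} m m′ {l d} a → l ≢ i → l ≢ j → HasExponent r l d m → HasExponent r l d m′ → d ≢ at l a →
  coeff (step r i j k m m′) a ≡ 0ℚ
step-outside {r} {i} {j} {k} m m′ {l} {d} a l≢i l≢j hm hm′ d≢ =
  coeff-outside (step r i j k m m′) a (All.map (λ { (_ , eq) refl → d≢ (sym eq) })
    (All-step {r} {i} {j} {k} {m} {m′} {HasExponent r l 0} {HasExponent r l d} {HasExponent r l d} (λ {b} {c} → HasExponent-zipWith {r} {l} {0} {d} {b} {c})
      (HasExponent-pow j i k l≢j l≢i) (HasExponent-pow i j k l≢i l≢j) hm hm′))

-- With equal monomials and even `k` the two halves are the same polynomial.
step-cancels : ∀ {r i j k} m a → Even k → length m ≡ r → coeff (step r i j k m m) a ≡ 0ℚ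
step-cancels {r} {i} {j} {k} m a ev-k len =
  vanishing⇒coeff≡0 r (step r i j k m m) (Arity-step r i j k len len)
    (λ ρ _ → trans (eval-step r i j ρ ev-k len len) (ℚₚ.+-inverseʳ ((eval (X r j) ρ - eval (X r i) ρ) ^ k * mono m ρ))) a

coeff-compo₃-≡0 : ∀ {k b c} a → coeff (monoP (k ∷ b ∷ c ∷ [])) a ≡ 0ℚ →
  coeff (step 3 0 1 k (b ∷ 0 ∷ c ∷ []) (0 ∷ b ∷ c ∷ [])) a ≡ 0ℚ →
  coeff (step 3 1 2 k (b ∷ c ∷ 0 ∷ []) (b ∷ 0 ∷ c ∷ [])) a ≡ 0ℚ →
  coeff (compo k (b ∷ c ∷ [])) a ≡ 0ℚ
coeff-compo₃-≡0 {k} {b} {c} a m≡0 s₀≡0 s₁≡0 =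
  trans (coeff-++ (monoP (k ∷ b ∷ c ∷ [])) (s₀ ++ (s₁ ++ [])) a)
  (cong₂ _+_ m≡0 (trans (coeff-++ s₀ (s₁ ++ []) a) (cong₂ _+_ s₀≡0 (trans (coeff-++ s₁ [] a) (cong (_+ 0ℚ) s₁≡0)))))
  where
  s₀ s₁ : Poly
  s₀ = step 3 0 1 k (b ∷ 0 ∷ c ∷ []) (0 ∷ b ∷ c ∷ [])
  s₁ = step 3 1 2 k (b ∷ c ∷ 0 ∷ []) (b ∷ 0 ∷ c ∷ [])

monoP-outside : ∀ {m a} l → at l m ≢ at l a → coeff (monoP m) a ≡ 0ℚ
monoP-outside {m} {a} l ne = coeff-outside (monoP m) a ((λ { refl → ne refl }) ∷ [])

even≢odd : ∀ {m n} → Even (suc m) → Even n → m ≢ n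
even≢odd odd even refl = ¬even∧odd even odd

0≢pos : ∀ {n} → 0 < n → 0 ≢ n
0≢pos () refl

-- The monomials occurring in circTail of a monomial of the index set.
data TailTerm (N : ℕ) : List ℕ → Set where
  tailTerm : ∀ {a b c} → PosEven a → Even (b ℕ.+ c) → 3 ℕ.+ (a ℕ.+ (b ℕ.+ (c ℕ.+ 0))) ≡ N → TailTerm N (a ∷ b ∷ c ∷ [])

-- Odd powers and powers x_i^0 of the last two variables are invisible in the even, positive part after ∘.
tailTerm-cases : ∀ {N n b} → TailTerm N b → Exponents N 3 n → Exponents N 3 b ⊎ coeff (circ b) n ≡ 0ℚ
tailTerm-cases {n = n₁ ∷ n₂ ∷ n₃ ∷ []} (tailTerm {a} {b} {c} (ev-a , 0<a) ev-bc wt)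
  (exponents refl ((e₁ , 0<n₁) ∷ (e₂ , 0<n₂) ∷ (e₃ , 0<n₃) ∷ []) _) = cases b c ev-bc wt
  where
  n : List ℕ
  n = n₁ ∷ n₂ ∷ n₃ ∷ []
  cases : ∀ b c → Even (b ℕ.+ c) → 3 ℕ.+ (a ℕ.+ (b ℕ.+ (c ℕ.+ 0))) ≡ _ →
    Exponents _ 3 (a ∷ b ∷ c ∷ []) ⊎ coeff (circ (a ∷ b ∷ c ∷ [])) n ≡ 0ℚ
  -- When an exponent is 0, one of the two steps inserts into equal monomials and cancels, and the
  -- other leaves a variable with exponent 0 untouched.
  cases zero c _ _ = inj₂ (coeff-compo₃-≡0 {a} {0} {c} n
    (monoP-outside {a ∷ 0 ∷ c ∷ []} {n} 1 (0≢pos 0<n₂))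
    (step-cancels {3} {0} {1} {a} (0 ∷ 0 ∷ c ∷ []) n ev-a refl)
    (step-outside {3} {1} {2} {a} (0 ∷ c ∷ 0 ∷ []) (0 ∷ 0 ∷ c ∷ []) {0} n (λ ()) (λ ()) (refl , refl) (refl , refl) (0≢pos 0<n₁)))
  cases (suc b) zero _ _ = inj₂ (coeff-compo₃-≡0 {a} {suc b} {0} n
    (monoP-outside {a ∷ suc b ∷ 0 ∷ []} {n} 2 (0≢pos 0<n₃))
    (step-outside {3} {0} {1} {a} (suc b ∷ 0 ∷ 0 ∷ []) (0 ∷ suc b ∷ 0 ∷ []) {2} n (λ ()) (λ ()) (refl , refl) (refl , refl) (0≢pos 0<n₃))
    (step-cancels {3} {1} {2} {a} (suc b ∷ 0 ∷ 0 ∷ []) n ev-a refl))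
  -- The two exponents have the same parity. If they are odd, each of the three parts of ∘ leaves an
  -- odd exponent in some variable that it does not touch.
  cases (suc b) (suc c) ev-bc wt with even⊎odd (suc b)
  ... | inj₁ ev-b = inj₁ (exponents refl ((ev-a , 0<a) ∷ (ev-b , s≤s z≤n) ∷ (Even-+⁻ ev-b ev-bc , s≤s z≤n) ∷ []) wt)
  ... | inj₂ od-b = inj₂ (coeff-compo₃-≡0 {a} {suc b} {suc c} n
    (monoP-outside {a ∷ suc b ∷ suc c ∷ []} {n} 1 (even≢odd od-b e₂))
    (step-outside {3} {0} {1} {a} (suc b ∷ 0 ∷ suc c ∷ []) (0 ∷ suc b ∷ suc c ∷ []) {2} n (λ ()) (λ ()) (refl , refl) (refl , refl) (even≢odd od-c e₃))
    (step-outside {3} {1} {2} {a} (suc b ∷ suc c ∷ 0 ∷ []) (suc b ∷ 0 ∷ suc c ∷ []) {0} n (λ ()) (λ ()) (refl , refl) (refl , refl) (even≢odd od-b e₁)))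
    where
    od-c : Even (suc (suc c))
    od-c = Even-+⁻ od-b (≡.subst Even (sym (ℕₚ.+-suc (suc (suc b)) (suc c))) (even-2+ ev-bc))

Graded : ℕ → ℕ → List ℕ → Set
Graded r d b = length b ≡ r × sumℕ b ≡ d

sum-zipWith : ∀ {a b} → length a ≡ length b → sumℕ (zipWith ℕ._+_ a b) ≡ sumℕ a ℕ.+ sumℕ b
sum-zipWith {[]}    {[]}    len = refl
sum-zipWith {k ∷ a} {l ∷ b} len = trans (cong (k ℕ.+ l ℕ.+_) (sum-zipWith {a} {b} (ℕₚ.suc-injective len))) (interchange k l (sumℕ a) (sumℕ b))
  where
  interchange : ∀ a b c d → a ℕ.+ b ℕ.+ (c ℕ.+ d) ≡ a ℕ.+ c ℕ.+ (b ℕ.+ d)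
  interchange = ℕ-solver.solve-∀

Graded-zipWith : ∀ {r d d′ a b} → Graded r d a → Graded r d′ b → Graded r (d ℕ.+ d′) (zipWith ℕ._+_ a b)
Graded-zipWith {a = a} {b} (la , da) (lb , db) =
  length-zipWith-+ {a = a} {b} la lb , trans (sum-zipWith {a} {b} (trans la (sym lb))) (cong₂ ℕ._+_ da db)

Graded-pow : ∀ {r p} → All (Graded r 1 ∘ proj₂) p → ∀ k → All (Graded r k ∘ proj₂) (powP r p k)
Graded-pow {r} gp zero    = (Lₚ.length-replicate r , sum-replicate-0 r) ∷ []
  where
  sum-replicate-0 : ∀ r → sumℕ (replicate r 0) ≡ 0
  sum-replicate-0 zero    = refl
  sum-replicate-0 (suc r) = sum-replicate-0 r
Graded-pow {r} {p} gp (suc k) = All-mulP {Graded r 1} {Graded r k} {Graded r (suc k)} (λ {a} {b} → Graded-zipWith {r} {1} {k} {a} {b}) {p} {powP r p k} gp (Graded-pow gp k)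

-- Homogeneity yields all that `TailTerm` records: it preserves the weight, and an even total degree
-- gives the last two exponents equal parity.
Graded-compo₂ : ∀ a b → All (Graded 2 (a ℕ.+ b) ∘ proj₂) (compo a (b ∷ []))
Graded-compo₂ a b = (refl , cong (a ℕ.+_) (ℕₚ.+-identityʳ b)) ∷ Allₚ.++⁺
  (All-step {2} {0} {1} {a} {b ∷ 0 ∷ []} {0 ∷ b ∷ []} {Graded 2 a} {Graded 2 b} {Graded 2 (a ℕ.+ b)}
    (λ {c} {d} → Graded-zipWith {2} {a} {b} {c} {d})
    (Graded-pow {2} {X 2 1 -P X 2 0} ((refl , refl) ∷ (refl , refl) ∷ []) a)
    (Graded-pow {2} {X 2 0 -P X 2 1} ((refl , refl) ∷ (refl , refl) ∷ []) a)
    (refl , ℕₚ.+-identityʳ b) (refl , ℕₚ.+-identityʳ b)) []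

circTail-terms : ∀ {N b} → Exponents N 3 b → All (TailTerm N ∘ proj₂) (circTail b)
circTail-terms {N} {a ∷ b ∷ c ∷ []} (exponents refl (pa ∷ (ev-b , _) ∷ (ev-c , _) ∷ []) wt) =
  Allₚ.map⁺ (All.map (λ {t} → term {t}) (Graded-compo₂ b c))
  where
  term : ∀ {t : Term} → Graded 2 (b ℕ.+ c) (proj₂ t) → TailTerm N (a ∷ proj₂ t)
  term {_ , b′ ∷ c′ ∷ []} (refl , eq) = tailTerm pa
    (≡.subst Even (sym (trans (cong (b′ ℕ.+_) (sym (ℕₚ.+-identityʳ c′))) eq)) (Even-+ ev-b ev-c))
    (trans (cong (λ z → 3 ℕ.+ (a ℕ.+ z)) (trans eq (cong (b ℕ.+_) (sym (ℕₚ.+-identityʳ c))))) wt)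

Arity-circ : ∀ {a b c} → Arity 3 (circ (a ∷ b ∷ c ∷ []))
Arity-circ {a} {b} {c} = refl ∷ Allₚ.++⁺ (Arity-step 3 0 1 a {b ∷ 0 ∷ c ∷ []} {0 ∷ b ∷ c ∷ []} refl refl)
  (Allₚ.++⁺ (Arity-step 3 1 2 a {b ∷ c ∷ 0 ∷ []} {b ∷ 0 ∷ c ∷ []} refl refl) [])

eval₃ : Poly → ℚ → ℚ → ℚ → ℚ
eval₃ p x y z = eval p (x ∷ y ∷ z ∷ [])

-- Evenness of the one exponent that becomes a power of a difference under `circ`. The terms of v
-- E^(2) still have it, although their later exponents may be odd. `EvenSecond` is the counterpart
-- for `circTail`.
data EvenHead : List ℕ → Set where
  evenHead : ∀ {a b c} → Even a → EvenHead (a ∷ b ∷ c ∷ [])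

data EvenSecond : List ℕ → Set where
  evenSecond : ∀ {a b c} → Even b → EvenSecond (a ∷ b ∷ c ∷ [])

eval-linear-circ : ∀ {p} → All (EvenHead ∘ proj₂) p → ∀ x y z → eval₃ (linearExtend circ p) x y z ≡ ihara₃ (eval₃ p) x y z
eval-linear-circ [] x y z = refl
eval-linear-circ {(k , a ∷ b ∷ c ∷ []) ∷ p} (evenHead ev-a ∷ evs) x y z =
  trans (eval-++ (scaleP k (circ (a ∷ b ∷ c ∷ []))) (linearExtend circ p) (x ∷ y ∷ z ∷ []))
  (trans (cong₂ _+_ (trans (eval-scaleP k (circ (a ∷ b ∷ c ∷ [])) (x ∷ y ∷ z ∷ [])) (cong (k *_) (eval-compo₃ b c x y z ev-a)))
                    (eval-linear-circ evs x y z))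
         (distrib k (M x y z) (M (y - x) x z) (M (y - x) y z) (M (z - y) x y) (M (z - y) x z)
                    (eval₃ p x y z) (eval₃ p (y - x) x z) (eval₃ p (y - x) y z) (eval₃ p (z - y) x y) (eval₃ p (z - y) x z)))
  where
  M : ℚ → ℚ → ℚ → ℚ
  M x y z = mono (a ∷ b ∷ c ∷ []) (x ∷ y ∷ z ∷ [])
  distrib : ∀ k m₁ m₂ m₃ m₄ m₅ e₁ e₂ e₃ e₄ e₅ →
    k * (m₁ + m₂ - m₃ + m₄ - m₅) + (e₁ + e₂ - e₃ + e₄ - e₅) ≡
    (k * m₁ + e₁) + (k * m₂ + e₂) - (k * m₃ + e₃) + (k * m₄ + e₄) - (k * m₅ + e₅)
  distrib = solve-∀ ℚ-ring

eval-linear-circTail : ∀ {p} → All (EvenSecond ∘ proj₂) p → ∀ x y z →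
  eval₃ (linearExtend circTail p) x y z ≡ ihara₂ (eval₃ p x) y z
eval-linear-circTail [] x y z = refl
eval-linear-circTail {(k , a ∷ b ∷ c ∷ []) ∷ p} (evenSecond ev-b ∷ evs) x y z =
  trans (eval-++ (scaleP k (circTail (a ∷ b ∷ c ∷ []))) (linearExtend circTail p) (x ∷ y ∷ z ∷ []))
  (trans (cong₂ _+_ (trans (eval-scaleP k (circTail (a ∷ b ∷ c ∷ [])) (x ∷ y ∷ z ∷ []))
                           (cong (k *_) (trans (eval-prepend a (compo b (c ∷ [])) x (y ∷ z ∷ []))
                                               (cong (x ^ a *_) (eval-compo₂ c y z ev-b)))))
                    (eval-linear-circTail evs x y z))
         (distrib k (x ^ a) (M y z) (M (z - y) y) (M (z - y) z)
                    (eval₃ p x y z) (eval₃ p x (z - y) y) (eval₃ p x (z - y) z)))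
  where
  M : ℚ → ℚ → ℚ
  M y z = mono (b ∷ c ∷ []) (y ∷ z ∷ [])
  distrib : ∀ k w m₁ m₂ m₃ e₁ e₂ e₃ →
    k * (w * (m₁ + m₂ - m₃)) + (e₁ + e₂ - e₃) ≡ (k * (w * m₁) + e₁) + (k * (w * m₂) + e₂) - (k * (w * m₃) + e₃)
  distrib = solve-∀ ℚ-ring

-- The period relation and its cancellations

EvenFirstArgument : (ℚ → ℚ → ℚ → ℚ) → Set
EvenFirstArgument P = ∀ x y z → P (- x) y z ≡ P x y z

PeriodRelation : (ℚ → ℚ → ℚ → ℚ) → Set
PeriodRelation P = ∀ x y z → P x y z ≡ P (y - x) y z - P (y - x) x z

-- Exchanging x and y swaps the two terms on the right of the period relation and negates y - x,
-- which an even first argument does not notice.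
antisymmetric : ∀ {P} → EvenFirstArgument P → PeriodRelation P → ∀ x y z → P y x z ≡ - P x y z
antisymmetric {P} even rel x y z = begin
  P y x z                           ≡⟨ rel y x z ⟩
  P (x - y) x z - P (x - y) y z     ≡⟨ cong (λ w → P w x z - P w y z) (negate x y) ⟩
  P (- (y - x)) x z - P (- (y - x)) y z ≡⟨ cong₂ _-_ (even (y - x) x z) (even (y - x) y z) ⟩
  P (y - x) x z - P (y - x) y z     ≡⟨ swap (P (y - x) x z) (P (y - x) y z) ⟩
  - (P (y - x) y z - P (y - x) x z) ≡⟨ cong -_ (sym (rel x y z)) ⟩
  - P x y z                         ∎
  where
  open ≡-Reasoning
  negate : ∀ x y → x - y ≡ - (y - x)
  negate = solve-∀ ℚ-ring
  swap : ∀ a b → a - b ≡ - (b - a)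
  swap = solve-∀ ℚ-ring

-- The third argument is passive in the period relation, so it may be x, y or z in the last six terms.
ihara₃-ihara₂-vanishes : ∀ {P} → EvenFirstArgument P → PeriodRelation P → ∀ x y z →
  ihara₃ (λ x y z → ihara₂ (P x) y z) x y z ≡ 0ℚ
ihara₃-ihara₂-vanishes {P} even rel x y z = cancel
  (P (y - x) y z) (P (y - x) x z) (P (z - y) x y) (P (z - y) x z)
  (P (z - y) (z - x) x) (P (z - y) (y - x) x) (P (z - y) (y - x) y) (P (z - y) (z - x) z) (P (z - y) (y - x) z)
  (rel x y z) (anti (z - y) x y) (anti (z - y) x z) (shifted x) (shifted z) (anti (z - y) (y - x) y) (anti (z - y) (y - x) z)
  where
  anti : ∀ x y z → P y x z ≡ - P x y z
  anti = antisymmetric even rel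
  difference : ∀ x y z → (z - x) - (y - x) ≡ z - y
  difference = solve-∀ ℚ-ring
  -- The relation at the pair (y - x, z - x), whose difference is z - y, rewrites inner terms in the
  -- form of the outer ones.
  shifted : ∀ w → P (y - x) (z - x) w ≡ P (z - y) (z - x) w - P (z - y) (y - x) w
  shifted w = trans (rel (y - x) (z - x) w) (cong (λ t → P t (z - x) w - P t (y - x) w) (difference x y z))
  -- Seven of the fifteen terms are rewritten by the relation or by antisymmetry; afterwards each
  -- `u` occurs once with either sign.
  cancel : ∀ {d₁ d₂ d₃ d₄ d₅ d₆ d₇} u₁ u₂ u₃ u₄ u₅ u₆ u₇ u₈ u₉ →
    d₁ ≡ u₁ - u₂ → d₂ ≡ - u₃ → d₃ ≡ - u₄ → d₄ ≡ u₅ - u₆ → d₅ ≡ u₈ - u₉ → d₆ ≡ - u₇ → d₇ ≡ - u₉ →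
    (d₁ + d₂ - d₃) + (u₂ + d₄ - d₅) - (u₁ + d₆ - d₇) + (u₃ + u₆ - u₇) - (u₄ + u₅ - u₈) ≡ 0ℚ
  cancel u₁ u₂ u₃ u₄ u₅ u₆ u₇ u₈ u₉ refl refl refl refl refl refl refl = identity u₁ u₂ u₃ u₄ u₅ u₆ u₇ u₈ u₉
    where
    identity : ∀ u₁ u₂ u₃ u₄ u₅ u₆ u₇ u₈ u₉ →
      ((u₁ - u₂) + (- u₃) - (- u₄)) + (u₂ + (u₅ - u₆) - (u₈ - u₉)) - (u₁ + (- u₇) - (- u₉)) + (u₃ + u₆ - u₇) - (u₄ + u₅ - u₈) ≡ 0ℚ
    identity = solve-∀ ℚ-ring

-- The action of E, E^(2) and F on coefficient vectors

module CoefficientVectors (N : ℕ) where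

  open IndexSet N 3 public

  V : Set
  V = Vect (∣S∣ N 3)

  P⟦_⟧ : V → ℚ → ℚ → ℚ → ℚ
  P⟦ v ⟧ = eval₃ (polyOf N 3 v)

  Ex : List ℕ → Set
  Ex = Exponents N 3

  polyOf-terms : ∀ {Q : List ℕ → Set} v → (∀ {b} → Ex b → Q b) → All (Q ∘ proj₂) (polyOf N 3 v)
  polyOf-terms v f = All-polyOf v (λ i → f (expo-sound N 3 i))

  ex⇒evenHead : ∀ {b} → Ex b → EvenHead b
  ex⇒evenHead {_ ∷ _ ∷ _ ∷ []} (exponents refl ((ev , _) ∷ _) _) = evenHead ev

  ex⇒evenSecond : ∀ {b} → Ex b → EvenSecond b
  ex⇒evenSecond {_ ∷ _ ∷ _ ∷ []} (exponents refl (_ ∷ (ev , _) ∷ _) _) = evenSecond ev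

  tailTerm⇒evenHead : ∀ {b} → TailTerm N b → EvenHead b
  tailTerm⇒evenHead (tailTerm (ev , _) _ _) = evenHead ev

  -- The full polynomials behind v E and v E^(2), with their monomials outside the index set.
  T H : V → Poly
  T v = linearExtend circ (polyOf N 3 v)
  H v = linearExtend circTail (polyOf N 3 v)

  E-row : ∀ v k → (v ⟨· E N 3) k ≡ coeff (T v) (ex k)
  E-row = row-times-matrix circ (E N 3) (E≡coeff-circ N 3)

  E²-row : ∀ v k → (v ⟨· E^ N 3 2) k ≡ coeff (H v) (ex k)
  E²-row = row-times-matrix circTail (E^ N 3 2) (E^≡coeff-circTail N)

  eval-T : ∀ v x y z → eval₃ (T v) x y z ≡ ihara₃ P⟦ v ⟧ x y z
  eval-T v = eval-linear-circ (polyOf-terms v ex⇒evenHead)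

  eval-H : ∀ v x y z → eval₃ (H v) x y z ≡ ihara₂ (P⟦ v ⟧ x) y z
  eval-H v = eval-linear-circTail (polyOf-terms v ex⇒evenSecond)

  H-terms : ∀ v → All (TailTerm N ∘ proj₂) (H v)
  H-terms v = All-linearExtend circTail (polyOf N 3 v) (polyOf-terms {λ b → All (TailTerm N ∘ proj₂) (circTail b)} v circTail-terms)

  tailTerm⇒length : ∀ {b} → TailTerm N b → length b ≡ 3
  tailTerm⇒length (tailTerm _ _ _) = refl

  Arity-H : ∀ v → Arity 3 (H v)
  Arity-H v = All.map tailTerm⇒length (H-terms v)

  evenHead⇒Arity-circ : ∀ {b} → EvenHead b → Arity 3 (circ b)
  evenHead⇒Arity-circ (evenHead {a} {b} {c} _) = Arity-circ {a} {b} {c}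

  Arity-linear-circ : ∀ {p} → All (EvenHead ∘ proj₂) p → Arity 3 (linearExtend circ p)
  Arity-linear-circ {p} evs = All-linearExtend {λ b → length b ≡ 3} circ p (All.map evenHead⇒Arity-circ evs)

  coeff-≡-by-eval : ∀ {p q} → Arity 3 p → Arity 3 q → (∀ x y z → eval₃ p x y z ≡ eval₃ q x y z) → ∀ a → coeff p a ≡ coeff q a
  coeff-≡-by-eval ap aq ev≡ = eval-≡⇒coeff-≡ 3 ap aq (λ { (x ∷ y ∷ z ∷ []) refl → ev≡ x y z })

  P-even : ∀ v → EvenFirstArgument P⟦ v ⟧
  P-even v x y z = go (polyOf-terms v ex⇒evenHead)
    where
    go : ∀ {p} → All (EvenHead ∘ proj₂) p → eval₃ p (- x) y z ≡ eval₃ p x y z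
    go []                                                            = refl
    go {(k , a ∷ b ∷ c ∷ []) ∷ p} (evenHead ev ∷ evs) =
      cong₂ _+_ (cong (λ w → k * (w * mono (b ∷ c ∷ []) (y ∷ z ∷ []))) (neg-^-even x ev)) (go evs)

  E²-vanishes : ∀ v → (∀ x y z → ihara₂ (P⟦ v ⟧ x) y z ≡ 0ℚ) → ∀ k → (v ⟨· E^ N 3 2) k ≡ 0ℚ
  E²-vanishes v ihara≡0 k = trans (E²-row v k)
    (coeff-≡-by-eval (Arity-H v) [] (λ x y z → trans (eval-H v x y z) (ihara≡0 x y z)) (ex k))

  F-row : ∀ v k → (v ⟨· F N 3) k ≡ (v ⟨· E N 3) k - v k
  F-row v k = begin
    sumFin (λ i → v i * (E N 3 i k - idM i k))
      ≡⟨ sum-cong (λ i → expand (v i) (E N 3 i k) (idM i k)) ⟩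
    sumFin (λ i → v i * E N 3 i k + (- 1ℚ) * (v i * idM i k))
      ≡⟨ sum-+ (λ i → v i * E N 3 i k) (λ i → (- 1ℚ) * (v i * idM i k)) ⟩
    (v ⟨· E N 3) k + sumFin (λ i → (- 1ℚ) * (v i * idM i k))
      ≡⟨ cong ((v ⟨· E N 3) k +_) (trans (sum-*ˡ (- 1ℚ) (λ i → v i * idM i k)) (trans (-1* _) (cong -_ (sum-idM v k)))) ⟩
    (v ⟨· E N 3) k - v k ∎
    where
    open ≡-Reasoning
    expand : ∀ v e d → v * (e - d) ≡ v * e + (- 1ℚ) * (v * d)
    expand = solve-∀ ℚ-ring

  -- The period relation reduces `T v` to its terms in z - y, and antisymmetry makes these the
  -- negatives of the ones in `H v`. So `H v` and `T v` add up to the polynomial of `v` itself.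
  E²-row≡-F-row : ∀ v → PeriodRelation P⟦ v ⟧ → ∀ k → (v ⟨· E^ N 3 2) k ≡ - (v ⟨· F N 3) k
  E²-row≡-F-row v rel k = begin
    (v ⟨· E^ N 3 2) k              ≡⟨ E²-row v k ⟩
    coeff (H v) (ex k)             ≡⟨ isolate (coeff (H v) (ex k)) (coeff (T v) (ex k)) (v k) total ⟩
    - (coeff (T v) (ex k) - v k)   ≡⟨ cong (λ w → - (w - v k)) (sym (E-row v k)) ⟩
    - ((v ⟨· E N 3) k - v k)       ≡⟨ cong -_ (sym (F-row v k)) ⟩
    - (v ⟨· F N 3) k               ∎
    where
    open ≡-Reasoning
    isolate : ∀ h t v → h + t ≡ v → h ≡ - (t - v)
    isolate h t _ refl = identity h t
      where
      identity : ∀ h t → h ≡ - (t - (h + t))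
      identity = solve-∀ ℚ-ring
    evals : ∀ x y z → eval₃ (H v ++ T v) x y z ≡ P⟦ v ⟧ x y z
    evals x y z = trans (eval-++ (H v) (T v) (x ∷ y ∷ z ∷ []))
      (trans (cong₂ _+_ (eval-H v x y z) (eval-T v x y z))
        (collapse (P⟦ v ⟧ x y z) (P⟦ v ⟧ (y - x) y z) (P⟦ v ⟧ (y - x) x z) (P⟦ v ⟧ (z - y) x y) (P⟦ v ⟧ (z - y) x z)
          (rel x y z) (antisymmetric (P-even v) rel (z - y) x y) (antisymmetric (P-even v) rel (z - y) x z)))
      where
      collapse : ∀ p q₁ q₂ r s {r′ s′} → p ≡ q₁ - q₂ → r′ ≡ - r → s′ ≡ - s →
        (p + r′ - s′) + (p + q₂ - q₁ + r - s) ≡ p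
      collapse _ q₁ q₂ r s refl refl refl = identity q₁ q₂ r s
        where
        identity : ∀ q₁ q₂ r s → ((q₁ - q₂) + (- r) - (- s)) + ((q₁ - q₂) + q₂ - q₁ + r - s) ≡ q₁ - q₂
        identity = solve-∀ ℚ-ring
    total : coeff (H v) (ex k) + coeff (T v) (ex k) ≡ v k
    total = trans (sym (coeff-++ (H v) (T v) (ex k)))
      (trans (coeff-≡-by-eval (Allₚ.++⁺ (Arity-H v) (Arity-linear-circ (polyOf-terms v ex⇒evenHead))) (Arity-polyOf v) evals (ex k))
             (coeff-polyOf v k))

  -- The product of matrices drops the monomials of `H v` outside the index set. By `tailTerm-cases`
  -- they contribute nothing, so the product still computes the composite of the two polynomial
  -- operators.
  E²E-vanishes : ∀ v → PeriodRelation P⟦ v ⟧ → ∀ n → ((v ⟨· E^ N 3 2) ⟨· E N 3) n ≡ 0ℚ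
  E²E-vanishes v rel n = begin
    ((v ⟨· E^ N 3 2) ⟨· E N 3) n                  ≡⟨ sum-cong (λ k → cong (_* E N 3 k n) (E²-row v k)) ⟩
    ((λ k → coeff (H v) (ex k)) ⟨· E N 3) n       ≡⟨ coefficients-times-matrix circ (E N 3) (E≡coeff-circ N 3) (H v) n cases ⟩
    coeff (linearExtend circ (H v)) (ex n)        ≡⟨ coeff-≡-by-eval (Arity-linear-circ heads) [] evals (ex n) ⟩
    0ℚ                                            ∎
    where
    open ≡-Reasoning
    heads : All (EvenHead ∘ proj₂) (H v)
    heads = All.map tailTerm⇒evenHead (H-terms v)
    evals : ∀ x y z → eval₃ (linearExtend circ (H v)) x y z ≡ 0ℚ
    evals x y z = trans (eval-linear-circ heads x y z)
      (trans (ihara₃-cong (eval-H v)) (ihara₃-ihara₂-vanishes (P-even v) rel x y z))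
      where
      ihara₃-cong : ∀ {P Q} → (∀ x y z → P x y z ≡ Q x y z) → ihara₃ P x y z ≡ ihara₃ Q x y z
      ihara₃-cong eq = cong₂ _-_ (cong₂ _+_ (cong₂ _-_ (cong₂ _+_ (eq x y z) (eq (y - x) x z)) (eq (y - x) y z)) (eq (z - y) x y)) (eq (z - y) x z)
    InIndexSet⊎Vanishes : List ℕ → Set
    InIndexSet⊎Vanishes b = (∃ λ i → ex i ≡ b) ⊎ ((∀ i → b ≢ ex i) × coeff (circ b) (ex n) ≡ 0ℚ)
    classify : ∀ {b} → TailTerm N b → InIndexSet⊎Vanishes b
    classify {b} t with Finₚ.any? (λ i → Lₚ.≡-dec ℕ._≟_ (ex i) b) | tailTerm-cases t (expo-sound N 3 n)
    ... | yes inside | _            = inj₁ inside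
    ... | no outside | inj₁ exb     = contradiction (expo-complete N 3 exb) outside
    ... | no outside | inj₂ coeff≡0 = inj₂ ((λ i b≡ → outside (i , sym b≡)) , coeff≡0)
    cases : All (InIndexSet⊎Vanishes ∘ proj₂) (H v)
    cases = All.map classify (H-terms v)

-- Period polynomials

0<ι-suc : ∀ k → 0ℚ ℚ.< ι (suc k)
0<ι-suc k = ι-mono-< {0} {suc k} (s≤s z≤n)

ι-suc≢0 : ∀ k → ι (suc k) ≢ 0ℚ
ι-suc≢0 k eq = ℚₚ.<⇒≢ (0<ι-suc k) (sym eq)

-- The inverse of k + 1, so that `recip 0` is 1 and `recip 1` is one half.
recip : ℕ → ℚ
recip k = proj₁ (inverse (ι-suc≢0 k))

ι*recip : ∀ k → ι (suc k) * recip k ≡ 1ℚ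
ι*recip k = proj₂ (inverse (ι-suc≢0 k))

*-pos : ∀ {x y} → 0ℚ ℚ.< x → 0ℚ ℚ.< y → 0ℚ ℚ.< x * y
*-pos {x} {y} 0<x 0<y = ≡.subst (ℚ._< x * y) (ℚₚ.*-zeroʳ x) (ℚₚ.*-monoʳ-<-pos x {{ℚ.positive 0<x}} 0<y)

0<recip : ∀ k → 0ℚ ℚ.< recip k
0<recip k with ℚₚ.<-cmp 0ℚ (recip k)
... | tri< 0<r _ _ = 0<r
... | tri≈ _ 0≡r _ = contradiction (trans (sym (ι*recip k)) (trans (cong (ι (suc k) *_) (sym 0≡r)) (ℚₚ.*-zeroʳ (ι (suc k))))) (λ ())
... | tri> _ _ r<0 = contradiction
  (ℚₚ.<-trans 0<1 (≡.subst₂ ℚ._<_ (ι*recip k) (ℚₚ.*-zeroʳ (ι (suc k))) (ℚₚ.*-monoʳ-<-pos (ι (suc k)) {{ℚ.positive (0<ι-suc k)}} r<0)))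
  (ℚₚ.<-irrefl refl)

recip-anti : ∀ {j k} → j < k → recip k ℚ.< recip j
recip-anti {j} {k} j<k = ≡.subst₂ ℚ._<_ (left (recip k) (recip j) (ι (suc j)) (ι*recip j)) (right (recip k) (recip j) (ι (suc k)) (ι*recip k))
  (ℚₚ.*-monoʳ-<-pos (recip k * recip j) {{ℚ.positive (*-pos (0<recip k) (0<recip j))}} (ι-mono-< (s≤s j<k)))
  where
  left : ∀ r s i → i * s ≡ 1ℚ → r * s * i ≡ r
  left r s i eq = trans (shuffle r s i) (trans (cong (r *_) eq) (ℚₚ.*-identityʳ r))
    where
    shuffle : ∀ r s i → r * s * i ≡ r * (i * s)
    shuffle = solve-∀ ℚ-ring
  right : ∀ r s i → i * r ≡ 1ℚ → r * s * i ≡ s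
  right r s i eq = trans (shuffle r s i) (trans (cong (s *_) eq) (ℚₚ.*-identityʳ s))
    where
    shuffle : ∀ r s i → r * s * i ≡ s * (i * r)
    shuffle = solve-∀ ℚ-ring

recip-0 : recip 0 ≡ 1ℚ
recip-0 = trans (1+0* (recip 0)) (ι*recip 0)
  where
  1+0* : ∀ x → x ≡ (1ℚ + 0ℚ) * x
  1+0* = solve-∀ ℚ-ring

1-recip-1 : 1ℚ - recip 1 ≡ recip 1
1-recip-1 = trans (cong (_- recip 1) (sym (ι*recip 1))) (halve (recip 1))
  where
  halve : ∀ x → (1ℚ + (1ℚ + 0ℚ)) * x - x ≡ x
  halve = solve-∀ ℚ-ring

-- A symmetry with a change of sign forces a zero at its fixed points; the roots 1 and 1/2 arise in
-- this way.
x≡-x⇒x≡0 : ∀ {x} → x ≡ - x → x ≡ 0ℚ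
x≡-x⇒x≡0 {x} eq = *-cancelˡ-0 (ι-suc≢0 1) (trans (double x) (trans (cong (x +_) eq) (ℚₚ.+-inverseʳ x)))
  where
  double : ∀ x → (1ℚ + (1ℚ + 0ℚ)) * x ≡ x + x
  double = solve-∀ ℚ-ring

-- The orbits of 3, 4, …, q+2 under ⟨ x ↦ 1-x , x ↦ 1/x ⟩ together with the degenerate orbits of 0 and 1/2,
-- in six intervals separated by -1 < 0 < 1/2 < 1 < 2.
module Roots (q : ℕ) where

  -- For n = i + 3 these are n, n - 1, 1/n and 1/(n - 1), so the orbit of n consists of `p`, `- u`,
  -- `w`, `- s`, `1 - w` and `1 + s`. The integer 2 is left out because it lies in the short orbit
  -- of 1/2.
  p u w s : ℕ → ℚ
  p i = ι (3 ℕ.+ i)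
  u i = ι (2 ℕ.+ i)
  w i = recip (2 ℕ.+ i)
  s i = recip (1 ℕ.+ i)

  roots : List ℚ
  roots = applyUpTo (λ i → - u i) q ++ - 1ℚ ∷ (applyUpTo (λ i → - s i) q ++ 0ℚ ∷ (applyUpTo w q ++ recip 1 ∷
    (applyUpTo (λ i → 1ℚ - w i) q ++ 1ℚ ∷ (applyUpTo (λ i → 1ℚ + s i) q ++ ι 2 ∷ applyUpTo p q))))

  length-roots : length roots ≡ 6 ℕ.* q ℕ.+ 5
  length-roots =
    trans (grow (λ i → - u i) _) (trans (cong (λ l → q ℕ.+ suc l) (trans (grow (λ i → - s i) _) (cong (λ l → q ℕ.+ suc l)
      (trans (grow w _) (cong (λ l → q ℕ.+ suc l) (trans (grow (λ i → 1ℚ - w i) _) (cong (λ l → q ℕ.+ suc l)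
        (trans (grow (λ i → 1ℚ + s i) _) (cong (λ l → q ℕ.+ suc l) (Lₚ.length-applyUpTo p q)))))))))) (total q))
    where
    grow : ∀ f {x} ys → length (applyUpTo f q ++ x ∷ ys) ≡ q ℕ.+ suc (length ys)
    grow f {x} ys = trans (Lₚ.length-++ (applyUpTo f q)) (cong (ℕ._+ suc (length ys)) (Lₚ.length-applyUpTo f q))
    total : ∀ q → q ℕ.+ suc (q ℕ.+ suc (q ℕ.+ suc (q ℕ.+ suc (q ℕ.+ suc q)))) ≡ 6 ℕ.* q ℕ.+ 5
    total = ℕ-solver.solve-∀

  Above : ℚ → List ℚ → Set
  Above c xs = Unique xs × All (c ℚ.<_) xs

  join-left : ∀ d {f} {ys} → (∀ {i j} → i < j → f i ≢ f j) → (∀ i → f i ℚ.< d) →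
    Above d ys → Unique (applyUpTo f q ++ d ∷ ys)
  join-left d {f} {ys} inj f<d (uniq , d<ys) =
    APₚ.++⁺ (APₚ.applyUpTo⁺₁ f q (λ i<j _ → inj i<j)) (All.map ℚₚ.<⇒≢ d<ys ∷ uniq)
      (Allₚ.applyUpTo⁺₂ f q (λ i → ℚₚ.<⇒≢ (f<d i) ∷ All.map (λ d<y → ℚₚ.<⇒≢ (ℚₚ.<-trans (f<d i) d<y)) d<ys))

  -- Members of different blocks are told apart by the separators; injectivity is needed only within
  -- a block, which may run in either direction.
  join : ∀ c d {f} {ys} → c ℚ.< d → (∀ {i j} → i < j → f i ≢ f j) → (∀ i → c ℚ.< f i) → (∀ i → f i ℚ.< d) →
    Above d ys → Above c (applyUpTo f q ++ d ∷ ys)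
  join c d {f} c<d inj c<f f<d above =
    join-left d inj f<d above ,
    Allₚ.++⁺ (Allₚ.applyUpTo⁺₂ f q c<f) (c<d ∷ All.map (ℚₚ.<-trans c<d) (proj₂ above))

  s<1 : ∀ i → s i ℚ.< 1ℚ
  s<1 i = ≡.subst (s i ℚ.<_) recip-0 (recip-anti {0} {1 ℕ.+ i} (s≤s z≤n))

  half<1 : recip 1 ℚ.< 1ℚ
  half<1 = s<1 0

  w<half : ∀ i → w i ℚ.< recip 1
  w<half i = recip-anti {1} {2 ℕ.+ i} (s≤s (s≤s z≤n))

  neg-inj : ∀ {x y} → x ≢ y → - x ≢ - y
  neg-inj ne eq = ne (ℚₚ.neg-injective eq)

  1+-inj : ∀ {x y} → x ≢ y → 1ℚ + x ≢ 1ℚ + y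
  1+-inj {x} {y} ne eq = ne (trans (cancel x) (trans (cong (_- 1ℚ) eq) (sym (cancel y))))
    where
    cancel : ∀ x → x ≡ (1ℚ + x) - 1ℚ
    cancel = solve-∀ ℚ-ring

  p-inj : ∀ {i j} → i < j → p i ≢ p j
  p-inj {i} {j} i<j = ℚₚ.<⇒≢ (ι-mono-< {3 ℕ.+ i} {3 ℕ.+ j} (s≤s (s≤s (s≤s i<j))))

  u-inj : ∀ {i j} → i < j → u i ≢ u j
  u-inj {i} {j} i<j = ℚₚ.<⇒≢ (ι-mono-< {2 ℕ.+ i} {2 ℕ.+ j} (s≤s (s≤s i<j)))

  w-inj : ∀ {i j} → i < j → w i ≢ w j
  w-inj {i} {j} i<j eq = ℚₚ.<⇒≢ (recip-anti {2 ℕ.+ i} {2 ℕ.+ j} (s≤s (s≤s i<j))) (sym eq)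

  s-inj : ∀ {i j} → i < j → s i ≢ s j
  s-inj {i} {j} i<j eq = ℚₚ.<⇒≢ (recip-anti {1 ℕ.+ i} {1 ℕ.+ j} (s≤s i<j)) (sym eq)

  unique-roots : Unique roots
  unique-roots =
    join-left (- 1ℚ) {λ i → - u i} (λ {i} {j} i<j → neg-inj {u i} {u j} (u-inj i<j)) (λ i → ℚₚ.neg-antimono-< (1<u i))
    (join (- 1ℚ) 0ℚ (ℚₚ.neg-antimono-< 0<1) (λ {i} {j} i<j → neg-inj {s i} {s j} (s-inj i<j))
       (λ i → ℚₚ.neg-antimono-< (s<1 i)) (λ i → ℚₚ.neg-antimono-< (0<recip (1 ℕ.+ i)))
    (join 0ℚ (recip 1) (0<recip 1) (λ {i} {j} → w-inj {i} {j}) (λ i → 0<recip (2 ℕ.+ i)) w<half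
    (join (recip 1) 1ℚ half<1 (λ {i} {j} i<j → 1+-inj { - w i} { - w j} (neg-inj {w i} {w j} (w-inj i<j)))
       (λ i → ≡.subst (ℚ._< 1ℚ - w i) 1-recip-1 (ℚₚ.+-monoʳ-< 1ℚ (ℚₚ.neg-antimono-< (w<half i))))
       (λ i → ≡.subst (1ℚ - w i ℚ.<_) (ℚₚ.+-identityʳ 1ℚ) (ℚₚ.+-monoʳ-< 1ℚ (ℚₚ.neg-antimono-< (0<recip (2 ℕ.+ i)))))
    (join 1ℚ (ι 2) (1<u 0) (λ {i} {j} i<j → 1+-inj {s i} {s j} (s-inj i<j))
       (λ i → ≡.subst (ℚ._< 1ℚ + s i) (ℚₚ.+-identityʳ 1ℚ) (ℚₚ.+-monoʳ-< 1ℚ (0<recip (1 ℕ.+ i))))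
       (λ i → ℚₚ.+-monoʳ-< 1ℚ (ℚₚ.<-≤-trans (s<1 i) (ℚₚ.≤-reflexive (sym (ℚₚ.+-identityʳ 1ℚ)))))
    (APₚ.applyUpTo⁺₁ p q (λ {i} {j} i<j _ → p-inj {i} {j} i<j) ,
     Allₚ.applyUpTo⁺₂ p q (λ i → ι-mono-< {2} {3 ℕ.+ i} (s≤s (s≤s (s≤s z≤n)))))))))
    where
    1<u : ∀ i → 1ℚ ℚ.< u i
    1<u i = ≡.subst (ℚ._< u i) (ℚₚ.+-identityʳ 1ℚ) (ι-mono-< {1} {2 ℕ.+ i} (s≤s (s≤s z≤n)))

-- R = ihara₂ P is anti-invariant under (y,z) ↦ (z,y) and (y,z) ↦ (z-y,z), so a root y of R(·,1) yields the
-- roots 1-y and 1/y: a root at each of 3, …, q+2 produces 6q+5 roots in total.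
module PeriodPolynomial (P : ℚ → ℚ → ℚ) (D q : ℕ)
  (even : ∀ y z → P (- y) z ≡ P y z)
  (anti : ∀ y z → P z y ≡ - P y z)
  (homogeneous : ∀ c y z → P (c * y) (c * z) ≡ c ^ D * P y z)
  (polynomial : PolyFun (suc D) (λ y → ihara₂ P y 1ℚ))
  (D<6q+6 : suc D ≤ 6 ℕ.* q ℕ.+ 5)
  (vanishes : ∀ i → i < q → ihara₂ P (ι (3 ℕ.+ i)) 1ℚ ≡ 0ℚ) where

  R : ℚ → ℚ → ℚ
  R = ihara₂ P

  r : ℚ → ℚ
  r y = R y 1ℚ

  flip : ∀ y z → P (y - z) z ≡ P (z - y) z
  flip y z = trans (cong (λ t → P t z) (negate y z)) (even (z - y) z)
    where
    negate : ∀ y z → y - z ≡ - (z - y)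
    negate = solve-∀ ℚ-ring

  -- The first term changes sign by antisymmetry; the other two trade places, as `P` is even in its
  -- first argument.
  R-swap : ∀ y z → R z y ≡ - R y z
  R-swap y z = collapse (P y z) (P (z - y) y) (P (z - y) z) (anti y z) (flip y z) (flip z y)
    where
    collapse : ∀ p a b {p′ b′ a′} → p′ ≡ - p → b′ ≡ b → a ≡ a′ → p′ + b′ - a′ ≡ - (p + a - b)
    collapse p a b refl refl refl = identity p a b
      where
      identity : ∀ p a b → (- p) + b - a ≡ - (p + a - b)
      identity = solve-∀ ℚ-ring

  -- The first and third terms trade places because z - (z - y) is y; the second changes sign by
  -- antisymmetry.
  R-reflect : ∀ y z → R (z - y) z ≡ - R y z
  R-reflect y z = collapse (P y z) (P (z - y) y) (P (z - y) z)
    (trans (cong (λ t → P t (z - y)) (double y z)) (anti (z - y) y)) (cong (λ t → P t z) (double y z))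
    where
    double : ∀ y z → z - (z - y) ≡ y
    double = solve-∀ ℚ-ring
    collapse : ∀ p a b {a′ p′} → a′ ≡ - a → p′ ≡ p → b + a′ - p′ ≡ - (p + a - b)
    collapse p a b refl refl = identity p a b
      where
      identity : ∀ p a b → b + (- a) - p ≡ - (p + a - b)
      identity = solve-∀ ℚ-ring

  R-homogeneous : ∀ c y z → R (c * y) (c * z) ≡ c ^ D * R y z
  R-homogeneous c y z = collapse (P y z) (P (z - y) y) (P (z - y) z) (homogeneous c y z)
    (trans (cong (λ t → P t (c * y)) (sym (distrib c y z))) (homogeneous c (z - y) y))
    (trans (cong (λ t → P t (c * z)) (sym (distrib c y z))) (homogeneous c (z - y) z))
    where
    distrib : ∀ c y z → c * (z - y) ≡ c * z - c * y
    distrib = solve-∀ ℚ-ring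
    collapse : ∀ p a b {p′ a′ b′} → p′ ≡ c ^ D * p → a′ ≡ c ^ D * a → b′ ≡ c ^ D * b → p′ + a′ - b′ ≡ c ^ D * (p + a - b)
    collapse p a b refl refl refl = identity (c ^ D) p a b
      where
      identity : ∀ k p a b → k * p + k * a - k * b ≡ k * (p + a - b)
      identity = solve-∀ ℚ-ring

  ≡-0⇒≡0 : ∀ {x y} → x ≡ - y → y ≡ 0ℚ → x ≡ 0ℚ
  ≡-0⇒≡0 refl refl = refl

  root-1- : ∀ {y} → r y ≡ 0ℚ → r (1ℚ - y) ≡ 0ℚ
  root-1- {y} = ≡-0⇒≡0 (R-reflect y 1ℚ)

  -- Scaling the point (1, y) by `y′` gives (y′, 1).
  root-inverse : ∀ {y y′} → y * y′ ≡ 1ℚ → r y ≡ 0ℚ → r y′ ≡ 0ℚ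
  root-inverse {y} {y′} yy′≡1 ry≡0 = begin
    R y′ 1ℚ                   ≡⟨ cong₂ R (sym (ℚₚ.*-identityʳ y′)) (trans (sym yy′≡1) (ℚₚ.*-comm y y′)) ⟩
    R (y′ * 1ℚ) (y′ * y)      ≡⟨ R-homogeneous y′ 1ℚ y ⟩
    y′ ^ D * R 1ℚ y           ≡⟨ cong (y′ ^ D *_) (≡-0⇒≡0 (R-swap y 1ℚ) ry≡0) ⟩
    y′ ^ D * 0ℚ               ≡⟨ ℚₚ.*-zeroʳ (y′ ^ D) ⟩
    0ℚ                        ∎
    where open ≡-Reasoning

  open Roots q

  root-p : ∀ {i} → i < q → r (p i) ≡ 0ℚ
  root-p {i} = vanishes i

  1-p≡-u : ∀ i → 1ℚ - p i ≡ - u i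
  1-p≡-u i = identity (ι i)
    where
    identity : ∀ x → 1ℚ - (1ℚ + (1ℚ + (1ℚ + x))) ≡ - (1ℚ + (1ℚ + x))
    identity = solve-∀ ℚ-ring

  root--u : ∀ {i} → i < q → r (- u i) ≡ 0ℚ
  root--u {i} i<q = trans (cong r (sym (1-p≡-u i))) (root-1- (root-p i<q))

  root--s : ∀ {i} → i < q → r (- s i) ≡ 0ℚ
  root--s {i} i<q = root-inverse (trans (neg*neg (u i) (s i)) (ι*recip (1 ℕ.+ i))) (root--u i<q)
    where
    neg*neg : ∀ x y → - x * - y ≡ x * y
    neg*neg = solve-∀ ℚ-ring

  root-1+s : ∀ {i} → i < q → r (1ℚ + s i) ≡ 0ℚ
  root-1+s {i} i<q = trans (cong r (1--x (s i))) (root-1- (root--s i<q))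
    where
    1--x : ∀ x → 1ℚ + x ≡ 1ℚ - (- x)
    1--x = solve-∀ ℚ-ring

  root-w : ∀ {i} → i < q → r (w i) ≡ 0ℚ
  root-w {i} i<q = root-inverse (ι*recip (2 ℕ.+ i)) (root-p i<q)

  root-1 : r 1ℚ ≡ 0ℚ
  root-1 = x≡-x⇒x≡0 (R-swap 1ℚ 1ℚ)

  root-0 : r 0ℚ ≡ 0ℚ
  root-0 = trans (cong r (sym (ℚₚ.+-inverseʳ 1ℚ))) (root-1- root-1)

  root-half : r (recip 1) ≡ 0ℚ
  root-half = x≡-x⇒x≡0 (trans (cong r (sym 1-recip-1)) (R-reflect (recip 1) 1ℚ))

  root-2 : r (ι 2) ≡ 0ℚ
  root-2 = root-inverse (trans (ℚₚ.*-comm (recip 1) (ι 2)) (ι*recip 1)) root-half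

  root--1 : r (- 1ℚ) ≡ 0ℚ
  root--1 = trans (cong r 1-2) (root-1- root-2)
    where
    1-2 : - 1ℚ ≡ 1ℚ - ι 2
    1-2 = refl

  all-roots : All (λ y → r y ≡ 0ℚ) roots
  all-roots =
    Allₚ.++⁺ (Allₚ.applyUpTo⁺₁ (λ i → - u i) q root--u) (root--1 ∷
    Allₚ.++⁺ (Allₚ.applyUpTo⁺₁ (λ i → - s i) q root--s) (root-0 ∷
    Allₚ.++⁺ (Allₚ.applyUpTo⁺₁ w q root-w) (root-half ∷
    Allₚ.++⁺ (Allₚ.applyUpTo⁺₁ (λ i → 1ℚ - w i) q (root-1- ∘ root-w)) (root-1 ∷
    Allₚ.++⁺ (Allₚ.applyUpTo⁺₁ (λ i → 1ℚ + s i) q root-1+s) (root-2 ∷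
    Allₚ.applyUpTo⁺₁ p q root-p)))))

  r≡0 : ∀ y → r y ≡ 0ℚ
  r≡0 = many-roots⇒0 polynomial unique-roots all-roots (≡.subst (suc D ≤_) (sym length-roots) D<6q+6)

  R≡0-off : ∀ y z → z ≢ 0ℚ → R y z ≡ 0ℚ
  R≡0-off y z z≢0 with inverse z≢0
  ... | z′ , zz′≡1 = begin
    R y z                          ≡⟨ cong₂ R (sym (cancel y)) (sym (ℚₚ.*-identityʳ z)) ⟩
    R (z * (y * z′)) (z * 1ℚ)      ≡⟨ R-homogeneous z (y * z′) 1ℚ ⟩
    z ^ D * r (y * z′)             ≡⟨ cong (z ^ D *_) (r≡0 (y * z′)) ⟩
    z ^ D * 0ℚ                     ≡⟨ ℚₚ.*-zeroʳ (z ^ D) ⟩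
    0ℚ                             ∎
    where
    open ≡-Reasoning
    cancel : ∀ y → z * (y * z′) ≡ y
    cancel y = trans (shuffle z y z′) (trans (cong (y *_) zz′≡1) (ℚₚ.*-identityʳ y))
      where
      shuffle : ∀ z y z′ → z * (y * z′) ≡ y * (z * z′)
      shuffle = solve-∀ ℚ-ring

  R≡0 : ∀ y z → R y z ≡ 0ℚ
  R≡0 y z with z ℚₚ.≟ 0ℚ | y ℚₚ.≟ 0ℚ
  ... | no z≢0   | _        = R≡0-off y z z≢0
  ... | yes refl | no y≢0   = ≡-0⇒≡0 (R-swap 0ℚ y) (R≡0-off 0ℚ y y≢0)
  ... | yes refl | yes refl = x≡-x⇒x≡0 (R-swap 0ℚ 0ℚ)

ihara₂-sum : ∀ {n} (w : Vect n) (G : Fin n → ℚ → ℚ → ℚ) y z →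
  ihara₂ (λ y z → sumFin (λ k → w k * G k y z)) y z ≡ sumFin (λ k → w k * ihara₂ (G k) y z)
ihara₂-sum {zero}  w G y z = refl
ihara₂-sum {suc n} w G y z =
  trans (regroup (w zero) (G zero y z) (G zero (z - y) y) (G zero (z - y) z) _ _ _)
        (cong (w zero * ihara₂ (G zero) y z +_) (ihara₂-sum (w ∘ suc) (G ∘ suc) y z))
  where
  regroup : ∀ w g₁ g₂ g₃ s₁ s₂ s₃ → (w * g₁ + s₁) + (w * g₂ + s₂) - (w * g₃ + s₃) ≡ w * (g₁ + g₂ - g₃) + (s₁ + s₂ - s₃)
  regroup = solve-∀ ℚ-ring

-- The alternative `w k ≡ 0ℚ` admits indices outside a fibre, whose functions may have a larger
-- degree.
PolyFun-sum : ∀ {n D} (w : Vect n) (g : Fin n → ℚ → ℚ) → (∀ k → w k ≡ 0ℚ ⊎ PolyFun D (g k)) →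
  PolyFun D (λ y → sumFin (λ k → w k * g k y))
PolyFun-sum {zero}  w g pg = PolyFun-0
PolyFun-sum {suc n} w g pg = PolyFun-+ (head (pg zero)) (PolyFun-sum (w ∘ suc) (g ∘ suc) (pg ∘ suc))
  where
  head : w zero ≡ 0ℚ ⊎ PolyFun _ (g zero) → PolyFun _ (λ y → w zero * g zero y)
  head (inj₁ w≡0) = PolyFun-cong (λ y → sym (trans (cong (_* g zero y) w≡0) (ℚₚ.*-zeroˡ (g zero y)))) PolyFun-0
  head (inj₂ pf)  = PolyFun-*ˡ (w zero) pf

-- On the indices with a given key the factor `f (key i)` is constant. With the exponent of the
-- first variable as key, this separates the powers of that variable from the period relation in the
-- other two.
sum-by-key : ∀ {n K} (key : Fin n → ℕ) → (∀ i → key i < K) → ∀ (f : ℕ → ℚ) (g : Vect n) →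
  (∀ a → sumFin (λ i → δ (key i ∷ []) (a ∷ []) * g i) ≡ 0ℚ) → sumFin (λ i → f (key i) * g i) ≡ 0ℚ
sum-by-key {n} {K} key key<K f g fibre≡0 = begin
  sumFin (λ i → f (key i) * g i)
    ≡⟨ sum-cong (λ i → cong (_* g i) (sym (expand i))) ⟩
  sumFin (λ i → sumFin (λ a → χ i a * f′ a) * g i)
    ≡⟨ sum-cong (λ i → trans (sym (sum-*ʳ (g i) (λ a → χ i a * f′ a))) (sum-cong (λ a → shuffle (χ i a) (f′ a) (g i)))) ⟩
  sumFin (λ i → sumFin (λ a → f′ a * (χ i a * g i)))
    ≡⟨ sum-swap (λ i a → f′ a * (χ i a * g i)) ⟩
  sumFin (λ a → sumFin (λ i → f′ a * (χ i a * g i)))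
    ≡⟨ sum-zero (λ a → trans (sum-*ˡ (f′ a) (λ i → χ i a * g i)) (trans (cong (f′ a *_) (fibre≡0 (Fin.toℕ a))) (ℚₚ.*-zeroʳ (f′ a)))) ⟩
  0ℚ ∎
  where
  open ≡-Reasoning
  f′ : Vect K
  f′ a = f (Fin.toℕ a)
  χ : Fin n → Fin K → ℚ
  χ i a = δ (key i ∷ []) (Fin.toℕ a ∷ [])
  shuffle : ∀ x y z → x * y * z ≡ y * (x * z)
  shuffle = solve-∀ ℚ-ring
  expand : ∀ i → sumFin (λ a → χ i a * f′ a) ≡ f (key i)
  expand i = trans (sum-cong (λ a → cong (_* f′ a) (trans (cong (λ k → δ (k ∷ []) (Fin.toℕ a ∷ [])) (sym (Finₚ.toℕ-fromℕ< (key<K i))))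
                                                          (δ-injective {f = λ a → Fin.toℕ a ∷ []} (Finₚ.toℕ-injective ∘ Lₚ.∷-injectiveˡ) (fromℕ< (key<K i)) a))))
             (trans (sum-idMˡ (fromℕ< (key<K i)) f′) (cong f (Finₚ.toℕ-fromℕ< (key<K i))))

even-half : ∀ {n} → Even n → ∃ λ h → n ≡ 2 ℕ.* h
even-half even-0      = 0 , refl
even-half (even-2+ e) with even-half e
... | h , refl = suc h , cong suc (sym (ℕₚ.+-suc h (h ℕ.+ 0)))

tail-degree : ∀ {N} a b c → 3 ℕ.+ (a ℕ.+ (b ℕ.+ (c ℕ.+ 0))) ≡ N → N ∸ suc a ∸ 2 ≡ b ℕ.+ c
tail-degree a b c wt = trans (cong (λ n → n ∸ suc a ∸ 2) (trans (sym wt) (regroup a b c)))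
                             (cong (_∸ 2) (ℕₚ.m+n∸m≡n (suc a) (2 ℕ.+ (b ℕ.+ c))))
  where
  regroup : ∀ a b c → 3 ℕ.+ (a ℕ.+ (b ℕ.+ (c ℕ.+ 0))) ≡ suc a ℕ.+ (2 ℕ.+ (b ℕ.+ c))
  regroup = ℕ-solver.solve-∀

-- Permuting the variables

module IndexPermutation (N : ℕ) where

  open CoefficientVectors N public

  permute : (π : List ℕ → List ℕ) → (∀ {b} → Ex b → Ex (π b)) → Fin (∣S∣ N 3) → Fin (∣S∣ N 3)
  permute π pres i = proj₁ (expo-complete N 3 (pres (expo-sound N 3 i)))

  ex-permute : ∀ π (pres : ∀ {b} → Ex b → Ex (π b)) i → ex (permute π pres i) ≡ π (ex i)
  ex-permute π pres i = proj₂ (expo-complete N 3 (pres (expo-sound N 3 i)))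

  permute-inverse : ∀ π (pres : ∀ {b} → Ex b → Ex (π b)) π⁻¹ (pres⁻¹ : ∀ {b} → Ex b → Ex (π⁻¹ b)) →
    (∀ {b} → Ex b → π (π⁻¹ b) ≡ b) → ∀ i → permute π pres (permute π⁻¹ pres⁻¹ i) ≡ i
  permute-inverse π pres π⁻¹ pres⁻¹ inverse i = expo-injective N 3 _ _
    (trans (ex-permute π pres (permute π⁻¹ pres⁻¹ i)) (trans (cong π (ex-permute π⁻¹ pres⁻¹ i)) (inverse (expo-sound N 3 i))))

  swapTail rotate rotate⁻¹ : List ℕ → List ℕ
  swapTail (a ∷ b ∷ c ∷ []) = a ∷ c ∷ b ∷ []
  swapTail b                = b
  rotate   (a ∷ b ∷ c ∷ []) = c ∷ a ∷ b ∷ []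
  rotate   b                = b
  rotate⁻¹ (a ∷ b ∷ c ∷ []) = b ∷ c ∷ a ∷ []
  rotate⁻¹ b                = b

  Ex-swapTail : ∀ {b} → Ex b → Ex (swapTail b)
  Ex-swapTail {a ∷ b ∷ c ∷ []} (exponents refl (pa ∷ pb ∷ pc ∷ []) wt) = exponents refl (pa ∷ pc ∷ pb ∷ []) (trans (commute a b c) wt)
    where
    commute : ∀ a b c → 3 ℕ.+ (a ℕ.+ (c ℕ.+ (b ℕ.+ 0))) ≡ 3 ℕ.+ (a ℕ.+ (b ℕ.+ (c ℕ.+ 0)))
    commute = ℕ-solver.solve-∀

  Ex-rotate : ∀ {b} → Ex b → Ex (rotate b)
  Ex-rotate {a ∷ b ∷ c ∷ []} (exponents refl (pa ∷ pb ∷ pc ∷ []) wt) = exponents refl (pc ∷ pa ∷ pb ∷ []) (trans (commute a b c) wt)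
    where
    commute : ∀ a b c → 3 ℕ.+ (c ℕ.+ (a ℕ.+ (b ℕ.+ 0))) ≡ 3 ℕ.+ (a ℕ.+ (b ℕ.+ (c ℕ.+ 0)))
    commute = ℕ-solver.solve-∀

  Ex-rotate⁻¹ : ∀ {b} → Ex b → Ex (rotate⁻¹ b)
  Ex-rotate⁻¹ {a ∷ b ∷ c ∷ []} (exponents refl (pa ∷ pb ∷ pc ∷ []) wt) = exponents refl (pb ∷ pc ∷ pa ∷ []) (trans (commute a b c) wt)
    where
    commute : ∀ a b c → 3 ℕ.+ (b ℕ.+ (c ℕ.+ (a ℕ.+ 0))) ≡ 3 ℕ.+ (a ℕ.+ (b ℕ.+ (c ℕ.+ 0)))
    commute = ℕ-solver.solve-∀

  σ ρ ρ⁻¹ : Fin (∣S∣ N 3) → Fin (∣S∣ N 3)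
  σ   = permute swapTail Ex-swapTail
  ρ   = permute rotate Ex-rotate
  ρ⁻¹ = permute rotate⁻¹ Ex-rotate⁻¹

  σσ : ∀ i → σ (σ i) ≡ i
  σσ = permute-inverse swapTail Ex-swapTail swapTail Ex-swapTail λ { {_ ∷ _ ∷ _ ∷ []} (exponents refl _ _) → refl }

  ρρ⁻¹ : ∀ i → ρ (ρ⁻¹ i) ≡ i
  ρρ⁻¹ = permute-inverse rotate Ex-rotate rotate⁻¹ Ex-rotate⁻¹ λ { {_ ∷ _ ∷ _ ∷ []} (exponents refl _ _) → refl }

  ρ⁻¹ρ : ∀ i → ρ⁻¹ (ρ i) ≡ i
  ρ⁻¹ρ = permute-inverse rotate⁻¹ Ex-rotate⁻¹ rotate Ex-rotate λ { {_ ∷ _ ∷ _ ∷ []} (exponents refl _ _) → refl }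

  P-sum : ∀ v x y z → P⟦ v ⟧ x y z ≡ sumFin (λ i → v i * mono (ex i) (x ∷ y ∷ z ∷ []))
  P-sum v x y z = trans (eval-lin (polyOf N 3 v) (x ∷ y ∷ z ∷ [])) (lin-polyOf (λ b → mono b (x ∷ y ∷ z ∷ [])) v)

  -- W asks for the relation in the first two variables, the constraints give it in the last two;
  -- the rotation carries the latter situation to the former.
  rotateVec : V → V
  rotateVec v = v ∘ ρ

  P-rotateVec : ∀ v x y z → P⟦ rotateVec v ⟧ x y z ≡ P⟦ v ⟧ z x y
  P-rotateVec v x y z = begin
    P⟦ rotateVec v ⟧ x y z                                    ≡⟨ P-sum (rotateVec v) x y z ⟩
    sumFin (λ i → v (ρ i) * mono (ex i) (x ∷ y ∷ z ∷ []))     ≡⟨ sum-cong (λ i → cong (v (ρ i) *_) (mono-rotate i)) ⟩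
    sumFin (λ i → v (ρ i) * mono (ex (ρ i)) (z ∷ x ∷ y ∷ [])) ≡⟨ sum-reindex ρ ρ⁻¹ ρρ⁻¹ ρ⁻¹ρ (λ i → v i * mono (ex i) (z ∷ x ∷ y ∷ [])) ⟩
    sumFin (λ i → v i * mono (ex i) (z ∷ x ∷ y ∷ []))         ≡⟨ sym (P-sum v z x y) ⟩
    P⟦ v ⟧ z x y                                              ∎
    where
    open ≡-Reasoning
    rotated : ∀ {b} → Ex b → mono b (x ∷ y ∷ z ∷ []) ≡ mono (rotate b) (z ∷ x ∷ y ∷ [])
    rotated {a ∷ b ∷ c ∷ []} _ = commute (x ^ a) (y ^ b) (z ^ c)
      where
      commute : ∀ a b c → a * (b * (c * 1ℚ)) ≡ c * (a * (b * 1ℚ))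
      commute = solve-∀ ℚ-ring
    mono-rotate : ∀ i → mono (ex i) (x ∷ y ∷ z ∷ []) ≡ mono (ex (ρ i)) (z ∷ x ∷ y ∷ [])
    mono-rotate i = trans (rotated (expo-sound N 3 i)) (cong (λ b → mono b (z ∷ x ∷ y ∷ [])) (sym (ex-permute rotate Ex-rotate i)))

-- The space of v whose polynomial lies in W in its last two variables, for each exponent a of the first one:
-- antisymmetry takes ⌊D/4⌋ conditions and the period relation ⌊D/6⌋, D being the degree in the last two variables.
module Constraints (N : ℕ) where

  open IndexPermutation N public

  key : Fin (∣S∣ N 3) → ℕ
  key k = at 0 (ex k)

  M : Fin (∣S∣ N 3) → ℚ → ℚ → ℚ
  M k y z = mono (at 1 (ex k) ∷ at 2 (ex k) ∷ []) (y ∷ z ∷ [])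

  χ : ℕ → Fin (∣S∣ N 3) → ℚ
  χ a k = δ (key k ∷ []) (a ∷ [])

  -- One condition for each unordered pair of exponents: b = 2(j + 1) is at most D - b exactly when
  -- j + 1 ≤ D/4. On the diagonal b = D - b the row is twice a coefficient, which thereby vanishes.
  antisymmetryRow : ℕ → ℕ → ℕ → V
  antisymmetryRow a D j k = δ (a ∷ b ∷ (D ∸ b) ∷ []) (ex k) + δ (a ∷ (D ∸ b) ∷ b ∷ []) (ex k)
    where
    b : ℕ
    b = 2 ℕ.* suc j

  -- Paired with `v`, this is the value at (j + 3, 1) of `ihara₂` applied to the coefficient of the
  -- a-th power of the first variable.
  periodRow : ℕ → ℕ → V
  periodRow a j k = χ a k * ihara₂ (M k) (ι (3 ℕ.+ j)) 1ℚ

  block : ℕ → List V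
  block n₁ = map (antisymmetryRow (ℕ.pred n₁) D) (upTo (D ℕ./ 4)) ++ map (periodRow (ℕ.pred n₁)) (upTo (D ℕ./ 6))
    where
    D : ℕ
    -- The exponents n₂ - 1 and n₃ - 1 of the last two variables add up to N - n₁ - 2.
    D = N ∸ n₁ ∸ 2

  constraints : List V
  constraints = concatMap block (oddsDown N)

  module _ (v : V) (ann : Annihilated constraints v) where

    block-annihilated : ∀ {a} → PosEven a → suc a ≤ N → Annihilated (block (suc a)) v
    block-annihilated pa a<N = All.lookup (Allₚ.map⁻ (Allₚ.concat⁻ ann)) (∈-oddsDown⁺ pa a<N)

    antisymmetry-row : ∀ {a j} → PosEven a → suc a ≤ N → j < (N ∸ suc a ∸ 2) ℕ./ 4 → dot (antisymmetryRow a (N ∸ suc a ∸ 2) j) v ≡ 0ℚ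
    antisymmetry-row pa a<N j< = All.lookup (Allₚ.map⁻ (Allₚ.++⁻ˡ _ (block-annihilated pa a<N))) (∈ₚ.∈-upTo⁺ j<)

    period-row : ∀ {a j} → PosEven a → suc a ≤ N → j < (N ∸ suc a ∸ 2) ℕ./ 6 → dot (periodRow a j) v ≡ 0ℚ
    period-row pa a<N j< = All.lookup (Allₚ.map⁻ (Allₚ.++⁻ʳ (map _ (upTo ((N ∸ suc _ ∸ 2) ℕ./ 4))) (block-annihilated pa a<N))) (∈ₚ.∈-upTo⁺ j<)

    v-antisymmetric-≤ : ∀ {i a b c} → ex i ≡ a ∷ b ∷ c ∷ [] → Ex (a ∷ b ∷ c ∷ []) → b ≤ c → v i + v (σ i) ≡ 0ℚ
    v-antisymmetric-≤ {i} {a} {b} {c} ex-i (exponents _ (pa ∷ (ev-b , 0<b) ∷ _) wt) b≤c = prove (even-half ev-b)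
      where
      D : ℕ
      D = N ∸ suc a ∸ 2
      D≡b+c : D ≡ b ℕ.+ c
      D≡b+c = tail-degree a b c wt
      a<N : suc a ≤ N
      a<N = ≡.subst (suc a ≤_) wt (s≤s (ℕₚ.m≤n⇒m≤o+n 2 (ℕₚ.m≤m+n a _)))
      prove : (∃ λ h → b ≡ 2 ℕ.* h) → v i + v (σ i) ≡ 0ℚ
      prove (zero , refl)  = contradiction 0<b (λ ())
      prove (suc j , refl) = begin
        v i + v (σ i)
          ≡⟨ sym (cong₂ _+_ (sum-δ i v) (sum-δ (σ i) v)) ⟩
        sumFin (λ k → δ (ex i) (ex k) * v k) + sumFin (λ k → δ (ex (σ i)) (ex k) * v k)
          ≡⟨ sym (sum-+ (λ k → δ (ex i) (ex k) * v k) (λ k → δ (ex (σ i)) (ex k) * v k)) ⟩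
        sumFin (λ k → δ (ex i) (ex k) * v k + δ (ex (σ i)) (ex k) * v k)
          ≡⟨ sum-cong (λ k → trans (sym (ℚₚ.*-distribʳ-+ (v k) (δ (ex i) (ex k)) (δ (ex (σ i)) (ex k))))
               (cong (_* v k) (cong₂ (λ l m → δ l (ex k) + δ m (ex k)) ex-i′ ex-σi))) ⟩
        dot (antisymmetryRow a D j) v
          ≡⟨ antisymmetry-row pa a<N j<D/4 ⟩
        0ℚ ∎
        where
        open ≡-Reasoning
        c≡ : c ≡ D ∸ b
        c≡ = trans (sym (ℕₚ.m+n∸m≡n b c)) (cong (_∸ b) (sym D≡b+c))
        ex-i′ : ex i ≡ a ∷ b ∷ (D ∸ b) ∷ []
        ex-i′ = trans ex-i (cong (λ c → a ∷ b ∷ c ∷ []) c≡)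
        ex-σi : ex (σ i) ≡ a ∷ (D ∸ b) ∷ b ∷ []
        ex-σi = trans (ex-permute swapTail Ex-swapTail i) (cong swapTail ex-i′)
        j<D/4 : j < D ℕ./ 4
        j<D/4 = ≡.subst (_≤ D ℕ./ 4) (DM.m*n/n≡m (suc j) 4) (DM./-monoˡ-≤ 4 (≡.subst₂ _≤_ (four j) (sym D≡b+c) (ℕₚ.+-monoʳ-≤ b b≤c)))
          where
          four : ∀ j → 2 ℕ.* suc j ℕ.+ 2 ℕ.* suc j ≡ suc j ℕ.* 4
          four = ℕ-solver.solve-∀

    v-antisymmetric : ∀ i → v (σ i) ≡ - v i
    v-antisymmetric i = opposite (go (expo-sound N 3 i) refl)
      where
      cancel : ∀ x y → y ≡ - x + (x + y)
      cancel = solve-∀ ℚ-ring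
      opposite : v i + v (σ i) ≡ 0ℚ → v (σ i) ≡ - v i
      opposite eq = trans (cancel (v i) (v (σ i))) (trans (cong (- v i +_) eq) (ℚₚ.+-identityʳ (- v i)))
      go : ∀ {l} → Ex l → ex i ≡ l → v i + v (σ i) ≡ 0ℚ
      go {a ∷ b ∷ c ∷ []} exl eq with ℕₚ.≤-total b c
      ... | inj₁ b≤c = v-antisymmetric-≤ eq exl b≤c
      ... | inj₂ c≤b = trans (ℚₚ.+-comm (v i) (v (σ i))) (trans (cong (λ k → v (σ i) + v k) (sym (σσ i)))
                         (v-antisymmetric-≤ (trans (ex-permute swapTail Ex-swapTail i) (cong swapTail eq)) (Ex-swapTail exl) c≤b))

ihara₂-mono-PolyFun : ∀ b c → PolyFun (suc (b ℕ.+ c)) (λ y → ihara₂ (λ y z → mono (b ∷ c ∷ []) (y ∷ z ∷ [])) y 1ℚ)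
ihara₂-mono-PolyFun b c =
  PolyFun-cong (λ y → sub (y ^ b * m) ((1ℚ - y) ^ b * (y ^ c * 1ℚ)) ((1ℚ - y) ^ b * m))
    (PolyFun-+ (PolyFun-+ (PolyFun-≤ b+1≤ (PolyFun-x^ b (PolyFun-const m)))
                          (PolyFun-≤ b+c+1≤ (PolyFun-[1-x]^ b (PolyFun-x^ c (PolyFun-const 1ℚ)))))
               (PolyFun-*ˡ (- 1ℚ) (PolyFun-≤ b+1≤ (PolyFun-[1-x]^ b (PolyFun-const m)))))
  where
  m : ℚ
  m = 1ℚ ^ c * 1ℚ
  sub : ∀ x y z → x + y + (- 1ℚ) * z ≡ x + y - z
  sub = solve-∀ ℚ-ring
  b+1≤ : b ℕ.+ 1 ≤ suc (b ℕ.+ c)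
  b+1≤ = ≡.subst (_≤ suc (b ℕ.+ c)) (ℕₚ.+-comm 1 b) (s≤s (ℕₚ.m≤m+n b c))
  b+c+1≤ : b ℕ.+ (c ℕ.+ 1) ≤ suc (b ℕ.+ c)
  b+c+1≤ = ℕₚ.≤-reflexive (rearrange b c)
    where
    rearrange : ∀ b c → b ℕ.+ (c ℕ.+ 1) ≡ suc (b ℕ.+ c)
    rearrange = ℕ-solver.solve-∀

module TailPeriod (N : ℕ) (v : Vect (∣S∣ N 3)) (ann : Annihilated (Constraints.constraints N) v) where

  open Constraints N

  ex-shape : ∀ k → ex k ≡ key k ∷ at 1 (ex k) ∷ at 2 (ex k) ∷ []
  ex-shape k with ex k | expo-sound N 3 k
  ... | _ ∷ _ ∷ _ ∷ [] | _ = refl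

  shape : ∀ k → Ex (key k ∷ at 1 (ex k) ∷ at 2 (ex k) ∷ [])
  shape k = ≡.subst Ex (ex-shape k) (expo-sound N 3 k)

  key-posEven : ∀ k → PosEven (key k)
  key-posEven k with shape k
  ... | exponents _ (pa ∷ _) _ = pa

  key<N : ∀ k → suc (key k) ≤ N
  key<N k with shape k
  ... | exponents _ _ wt = ≡.subst (suc (key k) ≤_) wt (s≤s (ℕₚ.m≤n⇒m≤o+n 2 (ℕₚ.m≤m+n (key k) _)))

  at-1-even : ∀ k → Even (at 1 (ex k))
  at-1-even k with shape k
  ... | exponents _ (_ ∷ (ev , _) ∷ _) _ = ev

  key-σ : ∀ k → key (σ k) ≡ key k
  key-σ k = trans (cong (at 0) (ex-permute swapTail Ex-swapTail k)) (trans (cong (at 0 ∘ swapTail) (ex-shape k)) refl)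

  mono-ex : ∀ k x y z → mono (ex k) (x ∷ y ∷ z ∷ []) ≡ x ^ key k * M k y z
  mono-ex k x y z = cong (λ b → mono b (x ∷ y ∷ z ∷ [])) (ex-shape k)

  M-σ : ∀ k y z → M (σ k) y z ≡ M k z y
  M-σ k y z = trans (cong (λ b → mono (at 1 b ∷ at 2 b ∷ []) (y ∷ z ∷ [])) (trans (ex-permute swapTail Ex-swapTail k) (cong swapTail (ex-shape k))))
    (commute (y ^ at 2 (ex k)) (z ^ at 1 (ex k)))
    where
    commute : ∀ a b → a * (b * 1ℚ) ≡ b * (a * 1ℚ)
    commute = solve-∀ ℚ-ring

  M-even : ∀ k y z → M k (- y) z ≡ M k y z
  M-even k y z = cong (_* (z ^ at 2 (ex k) * 1ℚ)) (neg-^-even y (at-1-even k))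

  M-homogeneous : ∀ k c y z → M k (c * y) (c * z) ≡ c ^ (at 1 (ex k) ℕ.+ at 2 (ex k)) * M k y z
  M-homogeneous k c y z = trans (cong₂ (λ a b → a * (b * 1ℚ)) (*-^ c y (at 1 (ex k))) (*-^ c z (at 2 (ex k))))
    (trans (regroup (c ^ at 1 (ex k)) (c ^ at 2 (ex k)) (y ^ at 1 (ex k)) (z ^ at 2 (ex k)))
           (cong (_* M k y z) (sym (^-+ c (at 1 (ex k)) (at 2 (ex k))))))
    where
    regroup : ∀ a b y z → a * y * (b * z * 1ℚ) ≡ a * b * (y * (z * 1ℚ))
    regroup = solve-∀ ℚ-ring

  -- The polynomial is homogeneous in its last two variables only after the exponent of the first is
  -- fixed, so the root count is done separately for each coefficient `Pₐ` of the a-th power.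
  module Fibre (a : ℕ) where

    D : ℕ
    D = N ∸ suc a ∸ 2

    c : Vect (∣S∣ N 3)
    c k = χ a k * v k

    c-cases : ∀ k → c k ≡ 0ℚ ⊎ key k ≡ a
    c-cases k with key k ℕ.≟ a
    ... | yes eq = inj₂ eq
    ... | no ne  = inj₁ (trans (cong (_* v k) (δ-≢ {key k ∷ []} {a ∷ []} (ne ∘ Lₚ.∷-injectiveˡ))) (ℚₚ.*-zeroˡ (v k)))

    degree : ∀ {k} → key k ≡ a → D ≡ at 1 (ex k) ℕ.+ at 2 (ex k)
    degree {k} refl with shape k
    ... | exponents _ _ wt = tail-degree (key k) (at 1 (ex k)) (at 2 (ex k)) wt

    Pₐ : ℚ → ℚ → ℚ
    Pₐ y z = sumFin (λ k → c k * M k y z)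

    Pₐ-even : ∀ y z → Pₐ (- y) z ≡ Pₐ y z
    Pₐ-even y z = sum-cong (λ k → cong (c k *_) (M-even k y z))

    Pₐ-anti : ∀ y z → Pₐ z y ≡ - Pₐ y z
    Pₐ-anti y z = begin
      sumFin (λ k → c k * M k z y)                      ≡⟨ sum-cong term ⟩
      sumFin (λ k → - 1ℚ * (c (σ k) * M (σ k) y z))     ≡⟨ sum-*ˡ (- 1ℚ) (λ k → c (σ k) * M (σ k) y z) ⟩
      - 1ℚ * sumFin (λ k → c (σ k) * M (σ k) y z)       ≡⟨ cong (- 1ℚ *_) (sum-reindex σ σ σσ σσ (λ k → c k * M k y z)) ⟩
      - 1ℚ * Pₐ y z                                     ≡⟨ -1* (Pₐ y z) ⟩
      - Pₐ y z                                          ∎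
      where
      open ≡-Reasoning
      negate : ∀ χ v m → χ * v * m ≡ - 1ℚ * (χ * (- v) * m)
      negate = solve-∀ ℚ-ring
      term : ∀ k → c k * M k z y ≡ - 1ℚ * (c (σ k) * M (σ k) y z)
      term k = trans (negate (χ a k) (v k) (M k z y))
        (cong (- 1ℚ *_) (cong₂ _*_ (cong₂ _*_ (cong (λ n → δ (n ∷ []) (a ∷ [])) (sym (key-σ k))) (sym (v-antisymmetric v ann k))) (sym (M-σ k y z))))

    Pₐ-homogeneous : ∀ t y z → Pₐ (t * y) (t * z) ≡ t ^ D * Pₐ y z
    Pₐ-homogeneous t y z = trans (sum-cong (λ k → term k (c-cases k))) (sum-*ˡ (t ^ D) (λ k → c k * M k y z))
      where
      exchange : ∀ c t m → c * (t * m) ≡ t * (c * m)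
      exchange = solve-∀ ℚ-ring
      vanish : ∀ {c} m t m′ → c ≡ 0ℚ → c * m ≡ t * (c * m′)
      vanish m t m′ refl = identity m t m′
        where
        identity : ∀ m t m′ → 0ℚ * m ≡ t * (0ℚ * m′)
        identity = solve-∀ ℚ-ring
      term : ∀ k → c k ≡ 0ℚ ⊎ key k ≡ a → c k * M k (t * y) (t * z) ≡ t ^ D * (c k * M k y z)
      term k (inj₁ c≡0) = vanish (M k (t * y) (t * z)) (t ^ D) (M k y z) c≡0
      term k (inj₂ eq)  = trans (cong (c k *_) (trans (M-homogeneous k t y z) (cong (λ n → t ^ n * M k y z) (sym (degree eq)))))
                                (exchange (c k) (t ^ D) (M k y z))

    Pₐ-polynomial : PolyFun (suc D) (λ y → ihara₂ Pₐ y 1ℚ)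
    Pₐ-polynomial = PolyFun-cong (λ y → sym (ihara₂-sum c M y 1ℚ))
      (PolyFun-sum c (λ k y → ihara₂ (M k) y 1ℚ) (λ k → Sum.map₂ (summand k) (c-cases k)))
      where
      summand : ∀ k → key k ≡ a → PolyFun (suc D) (λ y → ihara₂ (M k) y 1ℚ)
      summand k eq = ≡.subst (λ n → PolyFun (suc n) (λ y → ihara₂ (M k) y 1ℚ)) (sym (degree eq)) (ihara₂-mono-PolyFun (at 1 (ex k)) (at 2 (ex k)))

    -- The remainder modulo 6 is at most 5, and parity excludes 5. So the 6q + 5 roots outnumber the
    -- degree, with q no larger than ⌊D/6⌋.
    D<6q+5 : Even D → D < 6 ℕ.* (D ℕ./ 6) ℕ.+ 5
    D<6q+5 ev = ℕₚ.≤∧≢⇒< (≡.subst₂ _≤_ (sym (DM.m≡m%n+[m/n]*n D 6)) (rearrange q) (ℕₚ.+-monoˡ-≤ (q ℕ.* 6) (ℕₚ.≤-pred (DM.m%n<n D 6))))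
      (λ eq → ¬even-5 (Even-+⁻ (even-6* q) (≡.subst Even eq ev)))
      where
      q : ℕ
      q = D ℕ./ 6
      rearrange : ∀ q → 5 ℕ.+ q ℕ.* 6 ≡ 6 ℕ.* q ℕ.+ 5
      rearrange = ℕ-solver.solve-∀
      ¬even-5 : ¬ Even 5
      ¬even-5 (even-2+ (even-2+ ()))
      even-6* : ∀ q → Even (6 ℕ.* q)
      even-6* zero    = even-0
      even-6* (suc q) = ≡.subst Even (sym (ℕₚ.*-suc 6 q)) (even-2+ (even-2+ (even-2+ (even-6* q))))

    -- An index `k` in the fibre shows that `D` is even and that the conditions for `a` are among
    -- the constraints.
    Pₐ-period : ∀ {k} → key k ≡ a → ∀ y z → ihara₂ Pₐ y z ≡ 0ℚ
    Pₐ-period {k} refl = R≡0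
      where
      even-D : Even D
      even-D with shape k
      ... | exponents _ (_ ∷ (ev-b , _) ∷ (ev-c , _) ∷ []) _ = ≡.subst Even (sym (degree {k} refl)) (Even-+ ev-b ev-c)
      vanishes : ∀ i → i < D ℕ./ 6 → ihara₂ Pₐ (ι (3 ℕ.+ i)) 1ℚ ≡ 0ℚ
      vanishes i i<q = trans (ihara₂-sum c M (ι (3 ℕ.+ i)) 1ℚ)
        (trans (sum-cong (λ l → exchange (χ a l) (v l) (ihara₂ (M l) (ι (3 ℕ.+ i)) 1ℚ)))
               (period-row v ann (key-posEven k) (key<N k) i<q))
        where
        exchange : ∀ x v m → x * v * m ≡ x * m * v
        exchange = solve-∀ ℚ-ring
      open PeriodPolynomial Pₐ D (D ℕ./ 6) Pₐ-even Pₐ-anti Pₐ-homogeneous Pₐ-polynomial (D<6q+5 even-D) vanishes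

    fibre-vanishes : ∀ y z → sumFin (λ k → χ a k * (v k * ihara₂ (M k) y z)) ≡ 0ℚ
    fibre-vanishes y z with Finₚ.any? (λ k → key k ℕ.≟ a)
    ... | yes (k , eq) = trans (sum-cong (λ l → sym (ℚₚ.*-assoc (χ a l) (v l) (ihara₂ (M l) y z))))
                               (trans (sym (ihara₂-sum c M y z)) (Pₐ-period eq y z))
    ... | no none      = sum-zero (λ l → trans (cong (_* (v l * ihara₂ (M l) y z)) (δ-≢ {key l ∷ []} {a ∷ []} (λ eq → none (l , Lₚ.∷-injectiveˡ eq))))
                                               (ℚₚ.*-zeroˡ (v l * ihara₂ (M l) y z)))

  period : ∀ x y z → ihara₂ (P⟦ v ⟧ x) y z ≡ 0ℚ
  period x y z = begin
    ihara₂ (P⟦ v ⟧ x) y z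
      ≡⟨ cong₂ _-_ (cong₂ _+_ (P-by-key y z) (P-by-key (z - y) y)) (P-by-key (z - y) z) ⟩
    ihara₂ (λ y z → sumFin (λ k → (x ^ key k * v k) * M k y z)) y z
      ≡⟨ ihara₂-sum (λ k → x ^ key k * v k) M y z ⟩
    sumFin (λ k → (x ^ key k * v k) * ihara₂ (M k) y z)
      ≡⟨ sum-cong (λ k → ℚₚ.*-assoc (x ^ key k) (v k) (ihara₂ (M k) y z)) ⟩
    sumFin (λ k → x ^ key k * (v k * ihara₂ (M k) y z))
      ≡⟨ sum-by-key key key<N (x ^_) (λ k → v k * ihara₂ (M k) y z) (λ a → Fibre.fibre-vanishes a y z) ⟩
    0ℚ ∎
    where
    open ≡-Reasoning
    exchange : ∀ v x m → v * (x * m) ≡ (x * v) * m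
    exchange = solve-∀ ℚ-ring
    P-by-key : ∀ y z → P⟦ v ⟧ x y z ≡ sumFin (λ k → (x ^ key k * v k) * M k y z)
    P-by-key y z = trans (P-sum v x y z) (sum-cong (λ k → trans (cong (v k *_) (mono-ex k x y z)) (exchange (v k) (x ^ key k) (M k y z))))

-- Counting

-- Terms are split off at the front, so that a sum over 13 + n terms unfolds its first twelve by
-- computation.
∑< : ℕ → (ℕ → ℕ) → ℕ
∑< zero    f = 0
∑< (suc n) f = f 0 ℕ.+ ∑< n (f ∘ suc)

sum-upTo : ∀ f n → sumℕ (map f (upTo n)) ≡ ∑< n f
sum-upTo f n = trans (cong sumℕ (Lₚ.map-upTo f n)) (go f n)
  where
  go : ∀ f n → sumℕ (applyUpTo f n) ≡ ∑< n f
  go f zero    = refl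
  go f (suc n) = cong (f 0 ℕ.+_) (go (f ∘ suc) n)

∑<-xpow : ∀ c n (g : ℕ → ℕ) → c < n → ∑< n (λ j → xpow c j ℕ.* g j) ≡ g c
∑<-xpow zero    (suc n) g _         = trans (cong (g 0 ℕ.+ 0 ℕ.+_) (zeros n)) (trans (ℕₚ.+-identityʳ _) (ℕₚ.+-identityʳ _))
  where
  zeros : ∀ n → ∑< n (λ _ → 0) ≡ 0
  zeros zero    = refl
  zeros (suc n) = zeros n
∑<-xpow (suc c) (suc n) g (s≤s c<n) = ∑<-xpow c n (g ∘ suc) c<n

∑<-xpow-beyond : ∀ c n (g : ℕ → ℕ) → n ≤ c → ∑< n (λ j → xpow c j ℕ.* g j) ≡ 0
∑<-xpow-beyond c       zero    g _         = refl
∑<-xpow-beyond (suc c) (suc n) g (s≤s n≤c) = ∑<-xpow-beyond c n (g ∘ suc) n≤c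

xpow-⊛ : ∀ c f {n} → c ≤ n → (xpow c ⊛ f) n ≡ f (n ∸ c)
xpow-⊛ c f {n} c≤n = trans (sum-upTo (λ k → xpow c k ℕ.* f (n ∸ k)) (suc n)) (∑<-xpow c (suc n) (λ k → f (n ∸ k)) (s≤s c≤n))

xpow-⊛-below : ∀ c f {n} → n < c → (xpow c ⊛ f) n ≡ 0
xpow-⊛-below c f {n} n<c = trans (sum-upTo (λ k → xpow c k ℕ.* f (n ∸ k)) (suc n)) (∑<-xpow-beyond c (suc n) (λ k → f (n ∸ k)) n<c)

g₄g₆ : Series
g₄g₆ = geom 4 ⊛ geom 6

-- Counts the ways to write n + 12 as 4i + 6j with i < 3. Among n, n + 2, n + 4 exactly one is
-- divisible by 6 if n is even, and none if n is odd.
g₆-triple : ℕ → ℕ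
g₆-triple n = geom 6 n ℕ.+ (geom 6 (2 ℕ.+ n) ℕ.+ geom 6 (4 ℕ.+ n))

g₆-triple-even : ∀ {n} → Even n → g₆-triple n ≡ 1
g₆-triple-even even-0                          = refl
g₆-triple-even (even-2+ even-0)                = refl
g₆-triple-even (even-2+ (even-2+ even-0))      = refl
g₆-triple-even (even-2+ (even-2+ (even-2+ e))) = g₆-triple-even e

g₆-triple-odd : ∀ {n} → Even (suc n) → g₆-triple n ≡ 0
g₆-triple-odd (even-2+ even-0)                = refl
g₆-triple-odd (even-2+ (even-2+ even-0))      = refl
g₆-triple-odd (even-2+ (even-2+ (even-2+ even-0))) = refl
g₆-triple-odd (even-2+ (even-2+ (even-2+ (even-2+ e)))) = g₆-triple-odd (even-2+ e)

-- Of the first twelve terms those at k = 0, 4, 8 survive; the periods of `geom 4` and `geom 6` are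
-- absorbed by computation.
g₄g₆-12+ : ∀ n → g₄g₆ (12 ℕ.+ n) ≡ g₆-triple n ℕ.+ g₄g₆ n
g₄g₆-12+ n = trans (sum-upTo (λ k → geom 4 k ℕ.* geom 6 (12 ℕ.+ n ∸ k)) (suc (12 ℕ.+ n)))
  (trans (rearrange (geom 6 n) (geom 6 (2 ℕ.+ n)) (geom 6 (4 ℕ.+ n)) (∑< (suc n) (λ k → geom 4 k ℕ.* geom 6 (n ∸ k))))
         (cong (g₆-triple n ℕ.+_) (sym (sum-upTo (λ k → geom 4 k ℕ.* geom 6 (n ∸ k)) (suc n)))))
  where
  rearrange : ∀ a b c t → a ℕ.+ 0 ℕ.+ (b ℕ.+ 0 ℕ.+ (c ℕ.+ 0 ℕ.+ t)) ≡ a ℕ.+ (b ℕ.+ c) ℕ.+ t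
  rearrange = ℕ-solver.solve-∀

g₄g₆-odd : ∀ {n} → Even (suc n) → g₄g₆ n ≡ 0
g₄g₆-odd (even-2+ even-0) = refl
g₄g₆-odd (even-2+ (even-2+ even-0)) = refl
g₄g₆-odd (even-2+ (even-2+ (even-2+ even-0))) = refl
g₄g₆-odd (even-2+ (even-2+ (even-2+ (even-2+ even-0)))) = refl
g₄g₆-odd (even-2+ (even-2+ (even-2+ (even-2+ (even-2+ even-0))))) = refl
g₄g₆-odd (even-2+ (even-2+ (even-2+ (even-2+ (even-2+ (even-2+ even-0)))))) = refl
g₄g₆-odd (even-2+ (even-2+ (even-2+ (even-2+ (even-2+ (even-2+ (even-2+ {n} e))))))) =
  trans (g₄g₆-12+ (suc n)) (cong₂ ℕ._+_ (g₆-triple-odd (even-2+ e)) (g₄g₆-odd (even-2+ e)))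

𝕊-12+ : ∀ n → 𝕊 (12 ℕ.+ n) ≡ g₄g₆ n
𝕊-12+ n = xpow-⊛ 12 g₄g₆ {12 ℕ.+ n} (ℕₚ.m≤m+n 12 n)

𝕊-below : ∀ {n} → n < 12 → 𝕊 n ≡ 0
𝕊-below = xpow-⊛-below 12 g₄g₆

even-2* : ∀ m → Even (2 ℕ.* m)
even-2* zero    = even-0
even-2* (suc m) = ≡.subst Even (sym (ℕₚ.*-suc 2 m)) (even-2+ (even-2* m))

𝕊-odd : ∀ {n} → Even (suc n) → 𝕊 n ≡ 0
𝕊-odd {n} od = [ 𝕊-below , (λ 12≤n → beyond (ℕₚ.m≤n⇒∃[o]m+o≡n 12≤n)) ]′ (ℕₚ.<-≤-connex n 12)
  where
  beyond : (∃ λ o → 12 ℕ.+ o ≡ n) → 𝕊 n ≡ 0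
  beyond (o , eq) = trans (cong 𝕊 (sym eq)) (trans (𝕊-12+ o) (g₄g₆-odd (Even-+⁻ {12} (even-2* 6)
    (≡.subst Even (sym (trans (ℕₚ.+-suc 12 o) (cong suc eq))) od))))

-- Equality holds except at n = 2, as the coefficient at 14 is still zero; this is why the first
-- cases are computed separately.
𝕊-step : ∀ {n} → Even n → 𝕊 (12 ℕ.+ n) ≤ suc (𝕊 n)
𝕊-step even-0                                                   = ℕₚ.≤-trans (ℕₚ.≤-reflexive (𝕊-12+ 0)) (s≤s z≤n)
𝕊-step (even-2+ even-0)                                         = ℕₚ.≤-trans (ℕₚ.≤-reflexive (𝕊-12+ 2)) z≤n
𝕊-step (even-2+ (even-2+ even-0))                               = ℕₚ.≤-trans (ℕₚ.≤-reflexive (𝕊-12+ 4)) (s≤s z≤n)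
𝕊-step (even-2+ (even-2+ (even-2+ even-0)))                     = ℕₚ.≤-trans (ℕₚ.≤-reflexive (𝕊-12+ 6)) (s≤s z≤n)
𝕊-step (even-2+ (even-2+ (even-2+ (even-2+ even-0))))           = ℕₚ.≤-trans (ℕₚ.≤-reflexive (𝕊-12+ 8)) (s≤s z≤n)
𝕊-step (even-2+ (even-2+ (even-2+ (even-2+ (even-2+ even-0))))) = ℕₚ.≤-trans (ℕₚ.≤-reflexive (𝕊-12+ 10)) (s≤s z≤n)
𝕊-step (even-2+ (even-2+ (even-2+ (even-2+ (even-2+ (even-2+ {n} e)))))) = ℕₚ.≤-reflexive (begin
  𝕊 (24 ℕ.+ n)             ≡⟨ 𝕊-12+ (12 ℕ.+ n) ⟩
  g₄g₆ (12 ℕ.+ n)          ≡⟨ g₄g₆-12+ n ⟩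
  g₆-triple n ℕ.+ g₄g₆ n   ≡⟨ cong (ℕ._+ g₄g₆ n) (g₆-triple-even e) ⟩
  suc (g₄g₆ n)             ≡⟨ cong suc (sym (𝕊-12+ n)) ⟩
  suc (𝕊 (12 ℕ.+ n))       ∎)
  where open ≡-Reasoning

-- The left side counts dim S_{2m+4} and the constraints in degree 2m+2, which has m pairs of positive even exponents.
pairs-minus-constraints : ∀ m → 𝕊 (4 ℕ.+ 2 ℕ.* m) ℕ.+ ((2 ℕ.+ 2 ℕ.* m) ℕ./ 4 ℕ.+ (2 ℕ.+ 2 ℕ.* m) ℕ./ 6) ≤ m
pairs-minus-constraints 0 = z≤n
pairs-minus-constraints 1 = s≤s z≤n
pairs-minus-constraints 2 = s≤s (s≤s z≤n)
pairs-minus-constraints 3 = s≤s (s≤s (s≤s z≤n))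
pairs-minus-constraints 4 = s≤s (s≤s (s≤s (s≤s z≤n)))
pairs-minus-constraints 5 = s≤s (s≤s (s≤s (s≤s (s≤s z≤n))))
-- When m grows by 6, D grows by 12: the quotients grow by 3 and 2 and `𝕊` by at most 1, which makes
-- six in all.
pairs-minus-constraints (suc (suc (suc (suc (suc (suc m)))))) = begin
  𝕊 (4 ℕ.+ 2 ℕ.* (6 ℕ.+ m)) ℕ.+ ((2 ℕ.+ 2 ℕ.* (6 ℕ.+ m)) ℕ./ 4 ℕ.+ (2 ℕ.+ 2 ℕ.* (6 ℕ.+ m)) ℕ./ 6)
    ≡⟨ cong₂ (λ a b → 𝕊 a ℕ.+ (b ℕ./ 4 ℕ.+ b ℕ./ 6)) (shift 4 m) (shift 2 m) ⟩
  𝕊 (12 ℕ.+ (4 ℕ.+ 2 ℕ.* m)) ℕ.+ ((12 ℕ.+ D) ℕ./ 4 ℕ.+ (12 ℕ.+ D) ℕ./ 6)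
    ≡⟨ cong (𝕊 (12 ℕ.+ (4 ℕ.+ 2 ℕ.* m)) ℕ.+_)
         (cong₂ ℕ._+_ (DM.+-distrib-/-∣ˡ {12} D {4} (divides 3 refl)) (DM.+-distrib-/-∣ˡ {12} D {6} (divides 2 refl))) ⟩
  𝕊 (12 ℕ.+ (4 ℕ.+ 2 ℕ.* m)) ℕ.+ ((3 ℕ.+ D ℕ./ 4) ℕ.+ (2 ℕ.+ D ℕ./ 6))
    ≤⟨ ℕₚ.+-monoˡ-≤ _ (𝕊-step (even-2+ (even-2+ (even-2* m)))) ⟩
  suc (𝕊 (4 ℕ.+ 2 ℕ.* m)) ℕ.+ ((3 ℕ.+ D ℕ./ 4) ℕ.+ (2 ℕ.+ D ℕ./ 6))
    ≡⟨ collect (𝕊 (4 ℕ.+ 2 ℕ.* m)) (D ℕ./ 4) (D ℕ./ 6) ⟩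
  6 ℕ.+ (𝕊 (4 ℕ.+ 2 ℕ.* m) ℕ.+ (D ℕ./ 4 ℕ.+ D ℕ./ 6))
    ≤⟨ ℕₚ.+-monoʳ-≤ 6 (pairs-minus-constraints m) ⟩
  6 ℕ.+ m ∎
  where
  open ℕₚ.≤-Reasoning
  D : ℕ
  D = 2 ℕ.+ 2 ℕ.* m
  shift : ∀ k m → k ℕ.+ 2 ℕ.* (6 ℕ.+ m) ≡ 12 ℕ.+ (k ℕ.+ 2 ℕ.* m)
  shift = ℕ-solver.solve-∀
  collect : ∀ s a b → suc s ℕ.+ ((3 ℕ.+ a) ℕ.+ (2 ℕ.+ b)) ≡ 6 ℕ.+ (s ℕ.+ (a ℕ.+ b))
  collect = ℕ-solver.solve-∀

-- The exponent pairs (2i + 2, 2m - 2i) with i < m belong to the index set and differ in their first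
-- entries.
tails≤∣S∣ : ∀ m → m ≤ ∣S∣ (4 ℕ.+ 2 ℕ.* m) 2
tails≤∣S∣ m = Finₚ.injective⇒≤ {f = index} λ {i} {j} eq →
  Finₚ.toℕ-injective (ℕₚ.suc-injective (ℕₚ.*-cancelˡ-≡ _ _ 2 (Lₚ.∷-injectiveˡ
    (trans (sym (proj₂ (found i))) (trans (cong (expo (4 ℕ.+ 2 ℕ.* m) 2) eq) (proj₂ (found j)))))))
  where
  tail : Fin m → List ℕ
  tail i = 2 ℕ.* suc (Fin.toℕ i) ∷ 2 ℕ.* (m ∸ Fin.toℕ i) ∷ []
  positive : ∀ {n} → 0 < n → PosEven (2 ℕ.* n)
  positive {suc n} _ = even-2* (suc n) , s≤s z≤n
  total : ∀ i l → l ℕ.+ i ≡ m → 2 ℕ.+ (2 ℕ.* suc i ℕ.+ (2 ℕ.* l ℕ.+ 0)) ≡ 4 ℕ.+ 2 ℕ.* m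
  total i l refl = rearrange i l
    where
    rearrange : ∀ i l → 2 ℕ.+ (2 ℕ.* suc i ℕ.+ (2 ℕ.* l ℕ.+ 0)) ≡ 4 ℕ.+ 2 ℕ.* (l ℕ.+ i)
    rearrange = ℕ-solver.solve-∀
  found : ∀ i → ∃ λ k → expo (4 ℕ.+ 2 ℕ.* m) 2 k ≡ tail i
  found i = expo-complete (4 ℕ.+ 2 ℕ.* m) 2 (exponents refl (positive (s≤s z≤n) ∷ positive (ℕₚ.m<n⇒0<n∸m (Finₚ.toℕ<n i)) ∷ [])
    (total (Fin.toℕ i) (m ∸ Fin.toℕ i) (ℕₚ.m∸n+n≡m (ℕₚ.<⇒≤ (Finₚ.toℕ<n i)))))
  index : Fin m → Fin (∣S∣ (4 ℕ.+ 2 ℕ.* m) 2)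
  index i = proj₁ (found i)

constraint-count : ℕ → ℕ
constraint-count M = (M ∸ 2) ℕ./ 4 ℕ.+ (M ∸ 2) ℕ./ 6

𝕊+constraints≤∣S∣ : ∀ {M} → Even M → 𝕊 M ℕ.+ constraint-count M ≤ ∣S∣ M 2
𝕊+constraints≤∣S∣ even-0           = z≤n
𝕊+constraints≤∣S∣ (even-2+ even-0) = z≤n
𝕊+constraints≤∣S∣ (even-2+ (even-2+ e)) = bound (even-half e)
  where
  bound : ∀ {n} → (∃ λ m → n ≡ 2 ℕ.* m) → 𝕊 (4 ℕ.+ n) ℕ.+ constraint-count (4 ℕ.+ n) ≤ ∣S∣ (4 ℕ.+ n) 2
  bound (m , refl) = ℕₚ.≤-trans (pairs-minus-constraints m) (tails≤∣S∣ m)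

length-concatMap : ∀ {A B : Set} (f : A → List B) xs → length (concatMap f xs) ≡ sumℕ (map (length ∘ f) xs)
length-concatMap f []       = refl
length-concatMap f (x ∷ xs) = trans (Lₚ.length-++ (f x)) (cong (length (f x) ℕ.+_) (length-concatMap f xs))

sumℕ-map-+ : ∀ {A : Set} (f g : A → ℕ) xs → sumℕ (map f xs) ℕ.+ sumℕ (map g xs) ≡ sumℕ (map (λ x → f x ℕ.+ g x) xs)
sumℕ-map-+ f g []       = refl
sumℕ-map-+ f g (x ∷ xs) = trans (interchange (f x) _ (g x) _) (cong (f x ℕ.+ g x ℕ.+_) (sumℕ-map-+ f g xs))
  where
  interchange : ∀ a b c d → a ℕ.+ b ℕ.+ (c ℕ.+ d) ≡ a ℕ.+ c ℕ.+ (b ℕ.+ d)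
  interchange = ℕ-solver.solve-∀

sumℕ-map-≤ : ∀ {A : Set} {f g : A → ℕ} {xs} → All (λ x → f x ≤ g x) xs → sumℕ (map f xs) ≤ sumℕ (map g xs)
sumℕ-map-≤ []           = z≤n
sumℕ-map-≤ (f≤g ∷ rest) = ℕₚ.+-mono-≤ f≤g (sumℕ-map-≤ rest)

sumℕ-map-filter : ∀ {A : Set} {P : A → Set} (P? : ∀ x → Dec (P x)) (f : A → ℕ) → (∀ {x} → ¬ P x → f x ≡ 0) →
  ∀ xs → sumℕ (map f xs) ≡ sumℕ (map f (filter P? xs))
sumℕ-map-filter P? f f≡0 []       = refl
sumℕ-map-filter P? f f≡0 (x ∷ xs) with P? x
... | yes px = cong (f x ℕ.+_) (sumℕ-map-filter P? f f≡0 xs)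
... | no ¬px = cong₂ ℕ._+_ (f≡0 ¬px) (sumℕ-map-filter P? f f≡0 xs)

sumℕ-reverse-upTo : ∀ (f : ℕ → ℕ) n → sumℕ (map f (upTo n)) ≡ sumℕ (map f (downFrom n))
sumℕ-reverse-upTo f n = ListActionₚ.sum-↭ (↭ₚ.map⁺ f (≡.subst (upTo n ↭_) (Lₚ.reverse-upTo n) (↭-sym (↭ₚ.↭-reverse (upTo n)))))

𝕆≤1 : ∀ k → 𝕆 k ≤ 1
𝕆≤1 k = [
      (λ k<3 → ℕₚ.≤-trans (ℕₚ.≤-reflexive (xpow-⊛-below 3 (geom 2) k<3)) z≤n)
    , (λ 3≤k → ℕₚ.≤-trans (ℕₚ.≤-reflexive (xpow-⊛ 3 (geom 2) 3≤k)) (geom≤1 (k ∸ 3)))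
    ]′ (ℕₚ.<-≤-connex k 3)
  where
  geom≤1 : ∀ n → geom 2 n ≤ 1
  geom≤1 n with does (2 ∣? n)
  ... | true  = ℕₚ.≤-refl
  ... | false = z≤n

𝕆-below : ∀ {k} → ¬ (3 ≤ k) → 𝕆 k ≡ 0
𝕆-below 3≰k = xpow-⊛-below 3 (geom 2) (ℕₚ.≰⇒> 3≰k)

𝕆-even : ∀ {k} → ¬ (k ℕ.% 2 ≡ 1) → 𝕆 k ≡ 0
𝕆-even {k} ¬odd =
  [ xpow-⊛-below 3 (geom 2) , (λ 3≤k → trans (xpow-⊛ 3 (geom 2) 3≤k) (beyond (ℕₚ.m≤n⇒∃[o]m+o≡n 3≤k)))
  ]′ (ℕₚ.<-≤-connex k 3)
  where
  geom-odd : ∀ n → ¬ (suc n ℕ.% 2 ≡ 1) → geom 2 n ≡ 0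
  geom-odd zero          ne = contradiction refl ne
  geom-odd (suc zero)    ne = refl
  geom-odd (suc (suc n)) ne = geom-odd n ne
  beyond : (∃ λ o → 3 ℕ.+ o ≡ k) → geom 2 (k ∸ 3) ≡ 0
  beyond (o , refl) = geom-odd o ¬odd

-- The coefficients of `𝕆` are at most 1 and vanish wherever one of the two filters in `oddsDown`
-- discards an index.
𝕆⊛𝕊≤ : ∀ N → (𝕆 ⊛ 𝕊) N ≤ sumℕ (map (λ n → 𝕊 (N ∸ n)) (oddsDown N))
𝕆⊛𝕊≤ N = begin
  sumℕ (map f (upTo (suc N)))
    ≡⟨ sumℕ-reverse-upTo f (suc N) ⟩
  sumℕ (map f (downFrom (suc N)))
    ≡⟨ sumℕ-map-filter (λ n → n ℕ.% 2 ℕ.≟ 1) f (λ {k} ne → cong (ℕ._* 𝕊 (N ∸ k)) (𝕆-even {k} ne)) (downFrom (suc N)) ⟩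
  sumℕ (map f (filter (λ n → n ℕ.% 2 ℕ.≟ 1) (downFrom (suc N))))
    ≡⟨ sumℕ-map-filter (λ n → 3 ≤? n) f (λ {k} ne → cong (ℕ._* 𝕊 (N ∸ k)) (𝕆-below {k} ne))
         (filter (λ n → n ℕ.% 2 ℕ.≟ 1) (downFrom (suc N))) ⟩
  sumℕ (map f (oddsDown N))
    ≤⟨ sumℕ-map-≤ (All.universal (λ k → ℕₚ.≤-trans (ℕₚ.*-monoˡ-≤ (𝕊 (N ∸ k)) (𝕆≤1 k))
         (ℕₚ.≤-reflexive (ℕₚ.+-identityʳ (𝕊 (N ∸ k))))) (oddsDown N)) ⟩
  sumℕ (map (λ n → 𝕊 (N ∸ n)) (oddsDown N)) ∎
  where
  open ℕₚ.≤-Reasoning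
  f : ℕ → ℕ
  f k = 𝕆 k ℕ.* 𝕊 (N ∸ k)

Even-∸ : ∀ {N p} → Even (suc N) → Even p → suc p ≤ N → Even (N ∸ suc p)
Even-∸ {N} {p} ev-N ev-p p<N = Even-+⁻ {2 ℕ.+ p} (even-2+ ev-p) (≡.subst Even (sym (cong suc (ℕₚ.m+[n∸m]≡n p<N))) ev-N)

Odd-∸ : ∀ {N p} → Even N → Even p → suc p ≤ N → Even (suc (N ∸ suc p))
Odd-∸ {N} {p} ev-N ev-p p<N = Even-+⁻ ev-p (≡.subst Even (sym (trans (ℕₚ.+-suc p (N ∸ suc p)) (ℕₚ.m+[n∸m]≡n p<N))) ev-N)

length-constraints : ∀ N → length (Constraints.constraints N) ≡ sumℕ (map (λ n → constraint-count (N ∸ n)) (oddsDown N))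
length-constraints N = trans (length-concatMap block (oddsDown N)) (cong sumℕ (Lₚ.map-cong length-block (oddsDown N)))
  where
  open Constraints N
  length-block : ∀ n → length (block n) ≡ constraint-count (N ∸ n)
  length-block n = trans (Lₚ.length-++ (map _ (upTo ((N ∸ n ∸ 2) ℕ./ 4))))
    (cong₂ ℕ._+_ (trans (Lₚ.length-map _ (upTo ((N ∸ n ∸ 2) ℕ./ 4))) (Lₚ.length-upTo ((N ∸ n ∸ 2) ℕ./ 4)))
                 (trans (Lₚ.length-map _ (upTo ((N ∸ n ∸ 2) ℕ./ 6))) (Lₚ.length-upTo ((N ∸ n ∸ 2) ℕ./ 6))))

∣S∣-suc : ∀ N r → ∣S∣ N (suc r) ≡ sumℕ (map (λ n → ∣S∣ (N ∸ n) r) (oddsDown N))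
∣S∣-suc N r = trans (cong length (S-suc N r)) (trans (length-concatMap (λ n → map (n ∷_) (S (N ∸ n) r)) (oddsDown N))
  (cong sumℕ (Lₚ.map-cong (λ n → Lₚ.length-map (n ∷_) (S (N ∸ n) r)) (oddsDown N))))

𝕆⊛𝕊+constraints≤∣S∣ : ∀ {N} → Even (suc N) → (𝕆 ⊛ 𝕊) N ℕ.+ length (Constraints.constraints N) ≤ ∣S∣ N 3
𝕆⊛𝕊+constraints≤∣S∣ {N} odd-N = begin
  (𝕆 ⊛ 𝕊) N ℕ.+ length (Constraints.constraints N)
    ≤⟨ ℕₚ.+-mono-≤ (𝕆⊛𝕊≤ N) (ℕₚ.≤-reflexive (length-constraints N)) ⟩
  sumℕ (map (λ n → 𝕊 (N ∸ n)) (oddsDown N)) ℕ.+ sumℕ (map (λ n → constraint-count (N ∸ n)) (oddsDown N))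
    ≡⟨ sumℕ-map-+ (λ n → 𝕊 (N ∸ n)) (λ n → constraint-count (N ∸ n)) (oddsDown N) ⟩
  sumℕ (map (λ n → 𝕊 (N ∸ n) ℕ.+ constraint-count (N ∸ n)) (oddsDown N))
    ≤⟨ sumℕ-map-≤ (All.tabulate (λ {n} n∈ → bound n (∈-oddsDown⁻ {N} n∈))) ⟩
  sumℕ (map (λ n → ∣S∣ (N ∸ n) 2) (oddsDown N))
    ≡⟨ sym (∣S∣-suc N 2) ⟩
  ∣S∣ N 3 ∎
  where
  open ℕₚ.≤-Reasoning
  bound : ∀ n → (∃ λ p → n ≡ suc p × PosEven p × suc p ≤ N) → 𝕊 (N ∸ n) ℕ.+ constraint-count (N ∸ n) ≤ ∣S∣ (N ∸ n) 2
  bound _ (p , refl , (ev-p , _) , p<N) = 𝕊+constraints≤∣S∣ (Even-∸ odd-N ev-p p<N)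

𝕆⊛𝕊-even : ∀ {N} → Even N → (𝕆 ⊛ 𝕊) N ≡ 0
𝕆⊛𝕊-even {N} ev-N = ℕₚ.n≤0⇒n≡0
  (ℕₚ.≤-trans (𝕆⊛𝕊≤ N)
    (ℕₚ.≤-trans (sumℕ-map-≤ {g = λ _ → 0} (All.tabulate (λ {n} n∈ → bound n (∈-oddsDown⁻ {N} n∈))))
      (ℕₚ.≤-reflexive (zeros (oddsDown N)))))
  where
  bound : ∀ n → (∃ λ p → n ≡ suc p × PosEven p × suc p ≤ N) → 𝕊 (N ∸ n) ≤ 0
  bound _ (p , refl , (ev-p , _) , p<N) = ℕₚ.≤-reflexive (𝕊-odd (Odd-∸ ev-N ev-p p<N))
  zeros : ∀ (xs : List ℕ) → sumℕ (map (λ _ → 0) xs) ≡ 0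
  zeros []       = refl
  zeros (x ∷ xs) = zeros xs

-- The left kernel of C and the conclusion

⟨·-·M : ∀ {k} (v : Vect k) (A B : Mat k) j → (v ⟨· (A ·M B)) j ≡ ((v ⟨· A) ⟨· B) j
⟨·-·M v A B j = begin
  sumFin (λ i → v i * sumFin (λ l → A i l * B l j))
    ≡⟨ sum-cong (λ i → sym (sum-*ˡ (v i) (λ l → A i l * B l j))) ⟩
  sumFin (λ i → sumFin (λ l → v i * (A i l * B l j)))
    ≡⟨ sum-swap (λ i l → v i * (A i l * B l j)) ⟩
  sumFin (λ l → sumFin (λ i → v i * (A i l * B l j)))
    ≡⟨ sum-cong (λ l → trans (sum-cong (λ i → sym (ℚₚ.*-assoc (v i) (A i l) (B l j)))) (sum-*ʳ (B l j) (λ i → v i * A i l))) ⟩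
  sumFin (λ l → sumFin (λ i → v i * A i l) * B l j) ∎
  where open ≡-Reasoning

sum-↑ : ∀ m n (f : Vect (m ℕ.+ n)) → sumFin f ≡ sumFin (λ i → f (i ↑ˡ n)) + sumFin (λ i → f (m ↑ʳ i))
sum-↑ zero    n f = sym (ℚₚ.+-identityˡ _)
sum-↑ (suc m) n f = trans (cong (f zero +_) (sum-↑ m n (f ∘ suc))) (sym (ℚₚ.+-assoc (f zero) _ _))

↑-cases : ∀ m {n} {P : Fin (m ℕ.+ n) → Set} → (∀ i → P (i ↑ˡ n)) → (∀ i → P (m ↑ʳ i)) → ∀ i → P i
↑-cases m {n} {P} left right i = ≡.subst P (Finₚ.join-splitAt m n i) (cases (splitAt m i))
  where
  cases : ∀ s → P (Fin.join m n s)
  cases (inj₁ i) = left i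
  cases (inj₂ i) = right i

module LeftKernel (hypothesis : InjectivityHypothesis) (N : ℕ) (1≤N : 1 ≤ N) where

  open Constraints N

  InW-polyOf : ∀ v → PeriodRelation P⟦ v ⟧ → InW 3 (polyOf N 3 v)
  InW-polyOf v rel a = trans
    (coeff-≡-by-eval (Arity-polyOf v) (Arity--P (Arity-sub L₁ arity₁ refl) (Arity-sub L₂ arity₂ refl)) evals a)
    (coeff--P (subst 3 p L₁) (subst 3 p L₂) a)
    where
    p : Poly
    p = polyOf N 3 v
    L₁ L₂ : List Poly
    L₁ = (X 3 1 -P X 3 0) ∷ X 3 1 ∷ X 3 2 ∷ []
    L₂ = (X 3 1 -P X 3 0) ∷ X 3 0 ∷ X 3 2 ∷ []
    arity₁ : All (Arity 3) L₁
    arity₁ = Arity-X-X 3 1 0 ∷ Arity-X 3 1 ∷ Arity-X 3 2 ∷ []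
    arity₂ : All (Arity 3) L₂
    arity₂ = Arity-X-X 3 1 0 ∷ Arity-X 3 0 ∷ Arity-X 3 2 ∷ []
    Arity-sub : ∀ L → All (Arity 3) L → length L ≡ 3 → Arity 3 (subst 3 p L)
    Arity-sub L aL len = Arity-subst 3 p L (Arity-polyOf v) len aL
    evals : ∀ x y z → P⟦ v ⟧ x y z ≡ eval₃ (subst 3 p L₁ -P subst 3 p L₂) x y z
    evals x y z = begin
      P⟦ v ⟧ x y z
        ≡⟨ rel x y z ⟩
      P⟦ v ⟧ (y - x) y z - P⟦ v ⟧ (y - x) x z
        ≡⟨ sym (cong₂ (λ l₁ l₂ → eval p l₁ - eval p l₂) values₁ values₂) ⟩
      eval p (map (λ L → eval L xyz) L₁) - eval p (map (λ L → eval L xyz) L₂)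
        ≡⟨ sym (cong₂ _-_ (eval-subst 3 p L₁ arity₁ xyz) (eval-subst 3 p L₂ arity₂ xyz)) ⟩
      eval (subst 3 p L₁) xyz - eval (subst 3 p L₂) xyz
        ≡⟨ sym (eval--P (subst 3 p L₁) (subst 3 p L₂) xyz) ⟩
      eval₃ (subst 3 p L₁ -P subst 3 p L₂) x y z ∎
      where
      open ≡-Reasoning
      xyz : List ℚ
      xyz = x ∷ y ∷ z ∷ []
      eval-X₁-X₀ : eval (X 3 1 -P X 3 0) xyz ≡ y - x
      eval-X₁-X₀ = trans (eval--P (X 3 1) (X 3 0) xyz) (cong₂ _-_ (eval-X₃₁ x y z) (eval-X₃₀ x y z))
      values₁ : map (λ L → eval L xyz) L₁ ≡ y - x ∷ y ∷ z ∷ []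
      values₁ = cong₂ _∷_ eval-X₁-X₀ (cong₂ _∷_ (eval-X₃₁ x y z) (cong (_∷ []) (eval-X₃₂ x y z)))
      values₂ : map (λ L → eval L xyz) L₂ ≡ y - x ∷ x ∷ z ∷ []
      values₂ = cong₂ _∷_ eval-X₁-X₀ (cong₂ _∷_ (eval-X₃₀ x y z) (cong (_∷ []) (eval-X₃₂ x y z)))

  period-rotateVec : ∀ v → Annihilated constraints v → PeriodRelation P⟦ rotateVec v ⟧
  period-rotateVec v ann x y z = begin
    P⟦ rotateVec v ⟧ x y z                                          ≡⟨ P-rotateVec v x y z ⟩
    P⟦ v ⟧ z x y                                                    ≡⟨ isolate _ _ _ (TailPeriod.period N v ann z x y) ⟩
    P⟦ v ⟧ z (y - x) y - P⟦ v ⟧ z (y - x) x                         ≡⟨ sym (cong₂ _-_ (P-rotateVec v (y - x) y z) (P-rotateVec v (y - x) x z)) ⟩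
    P⟦ rotateVec v ⟧ (y - x) y z - P⟦ rotateVec v ⟧ (y - x) x z     ∎
    where
    open ≡-Reasoning
    isolate : ∀ p q r → p + q - r ≡ 0ℚ → p ≡ r - q
    isolate p q r eq = trans (identity p q r) (trans (cong (_+ (r - q)) eq) (ℚₚ.+-identityˡ (r - q)))
      where
      identity : ∀ p q r → p ≡ (p + q - r) + (r - q)
      identity = solve-∀ ℚ-ring

  tail-E² : ∀ v → Annihilated constraints v → ∀ k → (v ⟨· E^ N 3 2) k ≡ 0ℚ
  tail-E² v ann = E²-vanishes v (TailPeriod.period N v ann)

  tail-C₃ : ∀ v → Annihilated constraints v → ∀ j → (v ⟨· C₃ N) j ≡ 0ℚ
  tail-C₃ v ann j = trans (⟨·-·M v (E^ N 3 2) (E N 3) j)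
    (sum-zero (λ l → trans (cong (_* E N 3 l j) (tail-E² v ann l)) (ℚₚ.*-zeroˡ (E N 3 l j))))

  rotated-C₃ : ∀ v → Annihilated constraints v → ∀ j → (rotateVec v ⟨· C₃ N) j ≡ 0ℚ
  rotated-C₃ v ann j = trans (⟨·-·M (rotateVec v) (E^ N 3 2) (E N 3) j) (E²E-vanishes (rotateVec v) (period-rotateVec v ann) j)

  0V : V
  0V _ = 0ℚ

  annihilated-0 : Annihilated constraints 0V
  annihilated-0 = All.universal (λ φ → sum-zero (λ j → ℚₚ.*-zeroʳ (φ j))) constraints

  rotated-E²-injective : ∀ v → Annihilated constraints v → (∀ k → (rotateVec v ⟨· E^ N 3 2) k ≡ 0ℚ) → ∀ i → v i ≡ 0ℚ
  rotated-E²-injective v ann vE²≡0 i = trans (cong v (sym (ρρ⁻¹ i))) (rotated≡0 (ρ⁻¹ i))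
    where
    rel : PeriodRelation P⟦ rotateVec v ⟧
    rel = period-rotateVec v ann
    neg-zero : ∀ {x y} → x ≡ - y → x ≡ 0ℚ → y ≡ 0ℚ
    neg-zero {x} {y} x≡-y x≡0 = ℚₚ.neg-injective (trans (sym x≡-y) x≡0)
    vF≡0 : ∀ k → (rotateVec v ⟨· F N 3) k ≡ 0ℚ
    vF≡0 k = neg-zero (E²-row≡-F-row (rotateVec v) rel k) (vE²≡0 k)
    rotated≡0 : ∀ i → rotateVec v i ≡ 0ℚ
    -- The comparison vector is 0, which satisfies the constraints and is its own rotation.
    rotated≡0 = hypothesis 3 N (s≤s (s≤s z≤n)) 1≤N (rotateVec v) 0V
      (InW-polyOf (rotateVec v) rel) (InW-polyOf 0V (period-rotateVec 0V annihilated-0))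
      (λ k → trans (vF≡0 k) (sym (sum-zero (λ i → ℚₚ.*-zeroˡ (F N 3 i k)))))

  -- The two copies of a solution z: rotated, it is an element of W_{N,3}; as it stands, it is killed by E^(2).
  module _ {d} (z : Fin d → V) (ann : ∀ t → Annihilated constraints (z t)) (ind : LinIndep z) where

    both : Fin (d ℕ.+ d) → V
    both t = [ rotateVec ∘ z , z ]′ (splitAt d t)

    both-↑ˡ : ∀ t → both (t ↑ˡ d) ≡ rotateVec (z t)
    both-↑ˡ t = cong [ rotateVec ∘ z , z ]′ (Finₚ.splitAt-↑ˡ d t d)

    both-↑ʳ : ∀ t → both (d ↑ʳ t) ≡ z t
    both-↑ʳ t = cong [ rotateVec ∘ z , z ]′ (Finₚ.splitAt-↑ʳ d d t)

    both-C₃ : ∀ t j → (both t ⟨· C₃ N) j ≡ 0ℚ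
    both-C₃ = ↑-cases d
      (λ t j → trans (cong (λ v → (v ⟨· C₃ N) j) (both-↑ˡ t)) (rotated-C₃ (z t) (ann t) j))
      (λ t j → trans (cong (λ v → (v ⟨· C₃ N) j) (both-↑ʳ t)) (tail-C₃ (z t) (ann t) j))

    annihilated-lincomb : ∀ λs → Annihilated constraints (lincomb z λs)
    annihilated-lincomb λs = All.tabulate (λ {φ} φ∈ → dot-annihilates-lincomb φ z λs (λ t → All.lookup (ann t) φ∈))

    -- In a relation the unrotated part is killed by E^(2), hence so is the rotated part, which is
    -- then zero by injectivity. The unrotated part is therefore zero as well, and `ind` applies to
    -- each.
    both-indep : LinIndep both
    both-indep λs both≡0 = ↑-cases d (ind α Zα≡0) (ind β Zβ≡0)
      where
      α β : Vect d
      α t = λs (t ↑ˡ d)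
      β t = λs (d ↑ʳ t)
      split : ∀ j → rotateVec (lincomb z α) j + lincomb z β j ≡ 0ℚ
      split j = begin
        sumFin (λ t → α t * z t (ρ j)) + sumFin (λ t → β t * z t j)
          ≡⟨ sym (cong₂ _+_ (sum-cong (λ t → cong (λ v → α t * v j) (both-↑ˡ t)))
                            (sum-cong (λ t → cong (λ v → β t * v j) (both-↑ʳ t)))) ⟩
        sumFin (λ t → λs (t ↑ˡ d) * both (t ↑ˡ d) j) + sumFin (λ t → λs (d ↑ʳ t) * both (d ↑ʳ t) j)
          ≡⟨ sym (sum-↑ d d (λ t → λs t * both t j)) ⟩
        lincomb both λs j
          ≡⟨ both≡0 j ⟩
        0ℚ ∎
        where open ≡-Reasoning
      opposite : ∀ {x y} → x + y ≡ 0ℚ → x ≡ - 1ℚ * y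
      opposite {x} {y} eq = trans (identity x y) (trans (cong (_+ - 1ℚ * y) eq) (ℚₚ.+-identityˡ (- 1ℚ * y)))
        where
        identity : ∀ x y → x ≡ (x + y) + - 1ℚ * y
        identity = solve-∀ ℚ-ring
      Zα-E² : ∀ k → (rotateVec (lincomb z α) ⟨· E^ N 3 2) k ≡ 0ℚ
      Zα-E² k = begin
        sumFin (λ i → rotateVec (lincomb z α) i * E^ N 3 2 i k)
          ≡⟨ sum-cong (λ i → trans (cong (_* E^ N 3 2 i k) (opposite {rotateVec (lincomb z α) i} {lincomb z β i} (split i)))
                              (ℚₚ.*-assoc (- 1ℚ) (lincomb z β i) (E^ N 3 2 i k))) ⟩
        sumFin (λ i → - 1ℚ * (lincomb z β i * E^ N 3 2 i k))
          ≡⟨ sum-*ˡ (- 1ℚ) (λ i → lincomb z β i * E^ N 3 2 i k) ⟩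
        - 1ℚ * (lincomb z β ⟨· E^ N 3 2) k
          ≡⟨ cong (- 1ℚ *_) (tail-E² (lincomb z β) (annihilated-lincomb β) k) ⟩
        0ℚ ∎
        where open ≡-Reasoning
      Zα≡0 : ∀ j → lincomb z α j ≡ 0ℚ
      Zα≡0 = rotated-E²-injective (lincomb z α) (annihilated-lincomb α) Zα-E²
      Zβ≡0 : ∀ j → lincomb z β j ≡ 0ℚ
      Zβ≡0 j = trans (sym (ℚₚ.+-identityˡ (lincomb z β j))) (trans (cong (_+ lincomb z β j) (sym (Zα≡0 (ρ j)))) (split j))

theorem1p4 : InjectivityHypothesis → ∀ (N : ℕ) → 1 ≤ N → Σ ℕ (λ d → DimKer (C₃ N) d × twoOS N ≤ d)
theorem1p4 hypothesis N 1≤N = conclude (annihilator-basis constraints)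
  where
  open LeftKernel hypothesis N 1≤N
  open Constraints N using (constraints)
  𝕆⊛𝕊≤d : ∀ {d} → ∣S∣ N 3 ≤ d ℕ.+ length constraints → (𝕆 ⊛ 𝕊) N ≤ d
  𝕆⊛𝕊≤d ∣S∣≤ with even⊎odd N
  ... | inj₁ ev = ℕₚ.≤-trans (ℕₚ.≤-reflexive (𝕆⊛𝕊-even ev)) z≤n
  ... | inj₂ od = ℕₚ.+-cancelʳ-≤ (length constraints) _ _ (ℕₚ.≤-trans (𝕆⊛𝕊+constraints≤∣S∣ od) ∣S∣≤)
  conclude : Σ ℕ (λ d → Basis (Annihilated constraints) d × ∣S∣ N 3 ≤ d ℕ.+ length constraints) →
             Σ ℕ (λ d → DimKer (C₃ N) d × twoOS N ≤ d)
  conclude (d , (z , ann , ind , _) , ∣S∣≤) =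
    finish (left-kernel⇒kernel-basis (C₃ N) (both z ann ind) (both-indep z ann ind) (both-C₃ z ann ind))
    where
    finish : Σ ℕ (λ d′ → Basis (λ v → ∀ i → dot (C₃ N i) v ≡ 0ℚ) d′ × ∣S∣ N 3 ℕ.+ (d ℕ.+ d) ≤ d′ ℕ.+ ∣S∣ N 3) →
             Σ ℕ (λ d → DimKer (C₃ N) d × twoOS N ≤ d)
    -- The matrix is square, so its size cancels and 2d ≤ d′ remains.
    finish (d′ , basis , n+2d≤d′+n) = d′ , basis , ℕₚ.≤-trans
      (≡.subst (twoOS N ≤_) (cong (d ℕ.+_) (ℕₚ.+-identityʳ d)) (ℕₚ.*-monoʳ-≤ 2 (𝕆⊛𝕊≤d ∣S∣≤)))
      (ℕₚ.+-cancelˡ-≤ (∣S∣ N 3) _ _ (≡.subst (∣S∣ N 3 ℕ.+ (d ℕ.+ d) ≤_) (ℕₚ.+-comm d′ (∣S∣ N 3)) n+2d≤d′+n))
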